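{- There is a simple $2$-tardy c.e. set $A$ with $A''\equiv_T \emptyset''$ (i.e. $A$ is low$_2$).
   Context: Sets are subsets of $\omega$; $\{W_{e}\}_{e\in\omega}$ is the standard listing of the c.e. sets with standard stagewise enumeration $\{W_{e,s}\}_{s\in\omega}$ (only numbers less than $s$ belong to $W_{e,s}$). $\overline{A}=\omega\setminus A$; $A''$ is the double Turing jump. A c.e. set $A$ is simple if $\overline{A}$ is infinite and $A$ meets every infinite c.e. set. $2$-c.e. sets: a set $X$ is $2$-c.e. iff $X=X_1-X_2$ for some c.e. sets $X_1,X_2$. Fix an effective listing of all such presentations (pairs $W_{e_1},W_{e_2}$ of c.e. sets given by indices); $X^2_e=W_{e_1}-W_{e_2}$ denotes the $e$-th $2$-c.e. set in this listing, and $X^2_{e,s}=W_{e_1,s}-W_{e_2,s}$ its stage-$s$ approximation. $2$-tardy: let $A$ be c.e. with a computable enumeration $\{A_s\}_{s\in\omega}$. $A$ is $2$-tardy iff for every nondecreasing total computable function $p$ there is an $e$ such that $X^2_e=\overline{A}$ and, for all $x$ and all $s$, $x\in X^2_{e,s}$ implies $x\notin A_{p(s)}$. (This does not depend on the choice of enumeration of $A$.) -}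

module Defs where

open import Data.Bool using (Bool; true; false; if_then_else_)
open import Data.List using (List; head; drop; replicate)
open import Data.List.Membership.Propositional using () renaming (_∈_ to _∈ₗ_)
open import Data.Maybe using (Maybe; just; nothing; _>>=_; Is-just)
open import Data.Nat using (ℕ; zero; suc; _+_; _^_; _/_; _%_; _≤_; _<_; z≤n; s≤s)
open import Data.Nat.Properties
open import Data.Product using (Σ-syntax; ∃; ∃-syntax; _×_; _,_; proj₁; proj₂)
open import Function.Bundles using (_⇔_)
open import Level using (0ℓ)
open import Relation.Binary.Definitions using (Monotonic₁)
open import Relation.Binary.PropositionalEquality
open import Relation.Nullary using (¬_; Reflects)
open import Relation.Unary using (Pred; _∈_; _∉_; _⊆_; _≐_; ∁; _∖_; _≬_)

-- The Cantor pairing.  `unpair` walks along the antidiagonals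
-- (0,0); (0,1), (1,0); (0,2), (1,1), (2,0); …

triangle : ℕ → ℕ
triangle zero    = zero
triangle (suc n) = suc n + triangle n

⟨_,_⟩ : ℕ → ℕ → ℕ
⟨ a , b ⟩ = triangle (a + b) + a

next : ℕ × ℕ → ℕ × ℕ
next (a , zero)  = zero , suc a
next (a , suc b) = suc a , b

unpair : ℕ → ℕ × ℕ
unpair zero    = zero , zero
unpair (suc n) = next (unpair n)

unpair-⟨⟩ : ∀ a b → unpair ⟨ a , b ⟩ ≡ (a , b)
unpair-⟨⟩ a b = walk (a + b) a b refl
  where
  walk : ∀ d a b → a + b ≡ d → unpair (triangle d + a) ≡ (a , b)
  walk d (suc a) b eq rewrite +-suc (triangle d) a
                            | walk d a (suc b) (trans (+-suc a b) eq) = refl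
  walk zero    zero .zero    refl = refl
  walk (suc d) zero .(suc d) refl
    rewrite +-identityʳ (d + triangle d) | +-comm d (triangle d)
          | walk d d zero (+-identityʳ d) = refl

-- Partial recursive functionals of one argument, with an oracle.
-- On input ⟨ a , n ⟩, `prec f g` iterates g for n steps from f a, and
-- `rfind f` searches for the least m ≥ n with f ⟨ a , m ⟩ = 0.

data Code : Set where
  zero succ left right query : Code
  pair comp prec             : Code → Code → Code
  rfind                      : Code → Code

-- `run σ s c x` evaluates c on x with recursion depth at most s, where the
-- finite string σ is an initial segment of the oracle; a query beyond the
-- end of σ does not converge.

run : List Bool → ℕ → Code → ℕ → Maybe ℕ
run σ zero    _          x = nothing
run σ (suc s) zero       x = just 0
run σ (suc s) succ       x = just (suc x)
run σ (suc s) left       x = just (proj₁ (unpair x))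
run σ (suc s) right      x = just (proj₂ (unpair x))
run σ (suc s) query      x = head (drop x σ) >>= λ b → just (if b then 1 else 0)
run σ (suc s) (pair f g) x = run σ s f x >>= λ y → run σ s g x >>= λ z → just ⟨ y , z ⟩
run σ (suc s) (comp f g) x = run σ s g x >>= run σ s f
run σ (suc s) (prec f g) x with unpair x
... | a , zero  = run σ s f a
... | a , suc n = run σ s (prec f g) ⟨ a , n ⟩ >>= λ y → run σ s g ⟨ a , ⟨ n , y ⟩ ⟩
run σ (suc s) (rfind f)  x with unpair x
... | a , n = run σ s f x >>= λ { zero    → just n
                                ; (suc _) → run σ s (rfind f) ⟨ a , suc n ⟩ }

-- Gödel numbering: every number is an index, and by `decode-encode` every
-- code has one.  The first argument of `decodeWith` is fuel, which `decode`
-- supplies in sufficient quantity.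

encode : Code → ℕ
encode zero       = ⟨ 0 , 0 ⟩
encode succ       = ⟨ 1 , 0 ⟩
encode left       = ⟨ 2 , 0 ⟩
encode right      = ⟨ 3 , 0 ⟩
encode query      = ⟨ 4 , 0 ⟩
encode (pair f g) = ⟨ 5 , ⟨ encode f , encode g ⟩ ⟩
encode (comp f g) = ⟨ 6 , ⟨ encode f , encode g ⟩ ⟩
encode (prec f g) = ⟨ 7 , ⟨ encode f , encode g ⟩ ⟩
encode (rfind f)  = ⟨ 8 , encode f ⟩

decodeWith : ℕ → ℕ → Code
decodeNode : ℕ → ℕ × ℕ → Code

decodeWith zero    n = zero
decodeWith (suc k) n = decodeNode k (unpair n)

decodeNode k (0 , _) = zero
decodeNode k (1 , _) = succ
decodeNode k (2 , _) = left
decodeNode k (3 , _) = right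
decodeNode k (4 , _) = query
decodeNode k (5 , m) = pair (decodeWith k (proj₁ (unpair m))) (decodeWith k (proj₂ (unpair m)))
decodeNode k (6 , m) = comp (decodeWith k (proj₁ (unpair m))) (decodeWith k (proj₂ (unpair m)))
decodeNode k (7 , m) = prec (decodeWith k (proj₁ (unpair m))) (decodeWith k (proj₂ (unpair m)))
decodeNode k (suc (suc (suc (suc (suc (suc (suc (suc _))))))) , m) = rfind (decodeWith k m)

decode : ℕ → Code
decode n = decodeWith (suc n) n

+≤⟨⟩ : ∀ a b → a + b ≤ ⟨ a , b ⟩
+≤⟨⟩ a b = ≤-trans (n≤triangle (a + b)) (m≤m+n _ a)
  where
  n≤triangle : ∀ n → n ≤ triangle n
  n≤triangle zero    = z≤n
  n≤triangle (suc n) = s≤s (m≤m+n n _)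

decode-encode : ∀ c → decode (encode c) ≡ c
decode-encode c = go c _ ≤-refl
  where
  arg : ∀ {k} t m → ⟨ suc t , m ⟩ ≤ k → m < k
  arg t m h = ≤-trans (s≤s (m≤n+m m t)) (≤-trans (+≤⟨⟩ (suc t) m) h)

  argˡ : ∀ {k} t a b → ⟨ suc t , ⟨ a , b ⟩ ⟩ ≤ k → a < k
  argˡ t a b h = ≤-<-trans (≤-trans (m≤m+n a b) (+≤⟨⟩ a b)) (arg t ⟨ a , b ⟩ h)

  argʳ : ∀ {k} t a b → ⟨ suc t , ⟨ a , b ⟩ ⟩ ≤ k → b < k
  argʳ t a b h = ≤-<-trans (≤-trans (m≤n+m b a) (+≤⟨⟩ a b)) (arg t ⟨ a , b ⟩ h)

  go : ∀ c k → encode c < k → decodeWith k (encode c) ≡ c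
  binary : ∀ t f g k → ⟨ suc t , ⟨ encode f , encode g ⟩ ⟩ ≤ k →
           (decodeWith k (proj₁ (unpair ⟨ encode f , encode g ⟩)) ≡ f) ×
           (decodeWith k (proj₂ (unpair ⟨ encode f , encode g ⟩)) ≡ g)

  go zero       (suc k) _ = refl
  go succ       (suc k) _ = refl
  go left       (suc k) _ = refl
  go right      (suc k) _ = refl
  go query      (suc k) _ = refl
  go (pair f g) (suc k) (s≤s h) =
    trans (cong (decodeNode k) (unpair-⟨⟩ 5 ⟨ encode f , encode g ⟩))
          (cong₂ pair (proj₁ (binary 4 f g k h)) (proj₂ (binary 4 f g k h)))
  go (comp f g) (suc k) (s≤s h) =
    trans (cong (decodeNode k) (unpair-⟨⟩ 6 ⟨ encode f , encode g ⟩))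
          (cong₂ comp (proj₁ (binary 5 f g k h)) (proj₂ (binary 5 f g k h)))
  go (prec f g) (suc k) (s≤s h) =
    trans (cong (decodeNode k) (unpair-⟨⟩ 7 ⟨ encode f , encode g ⟩))
          (cong₂ prec (proj₁ (binary 6 f g k h)) (proj₂ (binary 6 f g k h)))
  go (rfind f)  (suc k) (s≤s h) =
    trans (cong (decodeNode k) (unpair-⟨⟩ 8 (encode f)))
          (cong rfind (go f k (arg 7 (encode f) h)))

  binary t f g k h rewrite unpair-⟨⟩ (encode f) (encode g) =
    go f k (argˡ t (encode f) (encode g) h) , go g k (argʳ t (encode f) (encode g) h)

Subset : Set₁
Subset = Pred ℕ 0ℓ

∅ : Subset
∅ = Relation.Unary.∅

infix 4 _≺_
_≺_ : List Bool → Subset → Set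
σ ≺ A = ∀ n b → head (drop n σ) ≡ just b → Reflects (n ∈ A) b

-- Φ e A x y says that the e-th functional with oracle A converges on x to y.

Φ : ℕ → Subset → ℕ → ℕ → Set
Φ e A x y = ∃[ σ ] ∃[ s ] (σ ≺ A × run σ s (decode e) x ≡ just y)

infix 4 _≤T_ _≡T_

_≤T_ : Subset → Subset → Set
A ≤T B = ∃[ e ] (∀ n → (n ∈ A → Φ e B n 1) × (n ∉ A → Φ e B n 0))

_≡T_ : Subset → Subset → Set
A ≡T B = A ≤T B × B ≤T A

infix 10 _′
_′ : Subset → Subset
(A ′) e = ∃[ y ] Φ e A e y

Computable : (ℕ → ℕ) → Set
Computable f = ∃[ e ] (∀ x → Φ e ∅ x (f x))

-- At stage s the e-th functional is run with the initial segment of length s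
-- of the empty oracle.

W[_,_] : ℕ → ℕ → Subset
W[ e , s ] x = x < s × Is-just (run (replicate s false) s (decode e) x)

W : ℕ → Subset
W e x = ∃[ s ] (x ∈ W[ e , s ])

CE : Subset → Set
CE A = ∃[ e ] (A ≐ W e)

Finite : Subset → Set
Finite A = ∃[ xs ] (∀ {x} → x ∈ A → x ∈ₗ xs)

Infinite : Subset → Set
Infinite A = ¬ Finite A

Simple : Subset → Set
Simple A = CE A × Infinite (∁ A) × (∀ e → Infinite (W e) → A ≬ W e)

X²[_,_] : ℕ → ℕ → Subset
X²[ e , s ] = W[ proj₁ (unpair e) , s ] ∖ W[ proj₂ (unpair e) , s ]

X² : ℕ → Subset
X² e = W (proj₁ (unpair e)) ∖ W (proj₂ (unpair e))

-- The finite set with canonical index n: those i for which 2 ^ i occurs in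
-- the binary expansion of n.

D : ℕ → Subset
D n i = (n / 2 ^ i) % 2 ≡ 1
  where instance _ = m^n≢0 2 i

record ComputableEnumeration (A : Subset) : Set where
  field
    index      : ℕ → ℕ
    computable : Computable index

  stage : ℕ → Subset
  stage s = D (index s)

  field
    increasing : ∀ s → stage s ⊆ stage (suc s)
    union      : ∀ x → x ∈ A ⇔ (∃[ s ] (x ∈ stage s))

-- The choice of the enumeration of A is immaterial: if (B_s) is another one,
-- there is a nondecreasing computable q with B_s ⊆ A_{q(s)}, and the condition
-- for (A_s) and q ∘ p gives the condition for (B_s) and p.

TwoTardy : Subset → Set
TwoTardy A = Σ[ enum ∈ ComputableEnumeration A ]
  let open ComputableEnumeration enum in
  (∀ (p : ℕ → ℕ) → Computable p → Monotonic₁ _≤_ _≤_ p →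
    ∃[ e ] (X² e ≐ ∁ A × (∀ x s → x ∈ X²[ e , s ] → x ∉ stage (p s))))

{-# OPTIONS --safe #-}
module Submission where

-- A tree construction.  A node γ of length ⟨ 0 , i ⟩ asks whether the i-th function is total, and a
-- node of length ⟨ 1 , i ⟩ asks whether i ∉ A″; both are Π₂ questions, with evidence R at y computed
-- from a finite initial segment of A.  The stages at which there is more evidence than at the last
-- such stage visit true ∷ γ, which lies to the left of false ∷ γ.
--
-- To make A simple, a node β of length n launches an element of W n as a ball, which has to
-- pass the gates γ with true ∷ γ ⊑ β, the longest first, before it enters A.  A gate opens when the
-- evidence for γ extends to the stage at which the ball arrived.  If γ asks about the totality of p,
-- this is the delay that tardiness demands of the 2-c.e. set of γ, into which numbers go at visits to
-- true ∷ γ and which they leave on their arrival at γ.  (To allow for the time it takes to enumerate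
-- this set, p is replaced by p ∘ delay.)
--
-- A visit cancels the balls waiting to its right, whence the balls are nested in time: the last one
-- launched is the first to be cancelled or to enter A.  Therefore the evidence for a node of the true
-- path is injured by ever older balls only, so it is injured finitely often, and the leftmost path
-- visited infinitely often answers all questions correctly.  The double jump of ∅ finds this path.

open import Defs
open import Axiom.ExcludedMiddle using (ExcludedMiddle)
open import Data.Bool using (Bool; true; false; if_then_else_; not; _∧_; _∨_)
open import Data.Empty using (⊥; ⊥-elim)
open import Data.Fin as Fin using (Fin; toℕ; fromℕ<; _↑ʳ_)
open import Data.Fin.Properties using (pigeonhole; toℕ<n; toℕ-↑ʳ; toℕ-fromℕ<; toℕ-injective)
open import Data.List using (List; []; _∷_; _++_; _∷ʳ_; head; drop; take; length; lookup; applyUpTo; upTo;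
  replicate; foldl; foldr; reverse)
open import Data.List.Membership.Propositional using () renaming (_∈_ to _∈ₗ_)
open import Data.List.Membership.Propositional.Properties using (∈-upTo⁺)
open import Data.List.Properties using (applyUpTo-∷ʳ; length-applyUpTo; reverse-foldl; reverse-involutive)
open import Data.List.Relation.Unary.Any using () renaming (index to position)
open import Data.List.Relation.Unary.Any.Properties using (lookup-index)
open import Data.Maybe using (Maybe; just; nothing; _>>=_; Is-just; is-just)
open import Data.Maybe.Properties using (just-injective)
open import Data.Maybe.Relation.Unary.Any using (just)
open import Data.Nat
open import Data.Nat.DivMod using (0/n≡0; n/1≡n; m%n<n; m*n/n≡m; m*n%n≡0; [m+kn]%n≡m%n; +-distrib-/; m/n/o≡m/[n*o])
open import Data.Nat.Induction using (<-rec)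
open import Data.Nat.Properties
open import Data.Product using (∃-syntax; ∃₂; _×_; _,_; proj₁; proj₂)
open import Data.Sum using (_⊎_; inj₁; inj₂; [_,_]′)
open import Data.Unit using (tt)
open import Function using (_∘_; id; case_of_; _⇔_; mk⇔; Equivalence)
open import Level using (0ℓ)
open import Relation.Binary.Definitions using (Monotonic₁; tri<; tri≈; tri>)
open import Relation.Binary.PropositionalEquality
open import Relation.Nullary using (¬_; Dec; yes; no; does; contradiction; Reflects; ofʸ; ofⁿ; proof)
open import Relation.Nullary.Decidable using (dec-true; dec-false; map′; _⊎-dec_)
open import Relation.Unary using (_∈_; _∉_; _≐_; ∁)
open Equivalence using (to; from)

-- Computations with an oracle

-- Restraint can act on launches only. A ball under way is stopped by nothing but a visit to the
-- left of its gate, and it may enter `A` long after evidence was found whose use exceeds it; so a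
-- visit cannot protect its evidence for good. Against balls launched after the visit there are
-- three defences. A node at or below the true edge launches only numbers beyond the use of the
-- evidence it relies on; a node to the right launches only numbers beyond the stage of the visit;
-- and each node contributes at most one element to `A`, which disposes of the finitely many nodes
-- of small code, among them those above the true edge. What remains are the balls launched before
-- the visit, and it is for these that nesting is needed.

unpair-surjective : ∀ n → ⟨ proj₁ (unpair n) , proj₂ (unpair n) ⟩ ≡ n
unpair-surjective zero = refl
unpair-surjective (suc n) = trans (next-suc (unpair n)) (cong suc (unpair-surjective n))
  where
  next-suc : ∀ p → ⟨ proj₁ (next p) , proj₂ (next p) ⟩ ≡ suc ⟨ proj₁ p , proj₂ p ⟩
  next-suc (a , zero) rewrite +-identityʳ a | +-identityʳ (a + triangle a) =
    cong suc (+-comm a (triangle a))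
  next-suc (a , suc b) rewrite +-suc a b = +-suc _ a

unpair-sum : ∀ n → proj₁ (unpair n) + proj₂ (unpair n) ≤ n
unpair-sum n = subst (proj₁ (unpair n) + proj₂ (unpair n) ≤_) (unpair-surjective n)
    (+≤⟨⟩ (proj₁ (unpair n)) (proj₂ (unpair n)))

⟨⟩-injective : ∀ {a b c d} → ⟨ a , b ⟩ ≡ ⟨ c , d ⟩ → (a , b) ≡ (c , d)
⟨⟩-injective {a} {b} {c} {d} eq = trans (sym (unpair-⟨⟩ a b)) (trans (cong unpair eq) (unpair-⟨⟩ c d))

>>=-just : ∀ {A B : Set} (m : Maybe A) (f : A → Maybe B) {y} →
           (m >>= f) ≡ just y → ∃[ z ] (m ≡ just z × f z ≡ just y)
>>=-just (just z) f eq = z , refl , eq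

just->>= : ∀ {A B : Set} {m : Maybe A} {f : A → Maybe B} {y z} →
           m ≡ just z → f z ≡ just y → (m >>= f) ≡ just y
just->>= refl eq = eq

infix 4 _≼_
_≼_ : List Bool → List Bool → Set
σ ≼ τ = ∀ n {b} → head (drop n σ) ≡ just b → head (drop n τ) ≡ just b

run-mono : ∀ {σ τ} → σ ≼ τ → ∀ {s t} → s ≤ t → ∀ c x {y} →
           run σ s c x ≡ just y → run τ t c x ≡ just y
run-mono p (s≤s q) zero x eq = eq
run-mono p (s≤s q) succ x eq = eq
run-mono p (s≤s q) left x eq = eq
run-mono p (s≤s q) right x eq = eq
run-mono {σ} p (s≤s q) query x eq with >>=-just (head (drop x σ)) _ eq
... | b , e₁ , e₂ rewrite p x e₁ = e₂
run-mono p (s≤s q) (pair f g) x eq with >>=-just _ _ eq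
... | y , e₁ , e₂ with >>=-just _ _ e₂
... | z , e₃ , e₄ rewrite run-mono p q f x e₁ | run-mono p q g x e₃ = e₄
run-mono p (s≤s q) (comp f g) x eq with >>=-just _ _ eq
... | y , e₁ , e₂ rewrite run-mono p q g x e₁ = run-mono p q f y e₂
run-mono p (s≤s q) (prec f g) x eq with unpair x
... | a , zero = run-mono p q f a eq
... | a , suc n with >>=-just _ _ eq
... | y , e₁ , e₂ rewrite run-mono p q (prec f g) ⟨ a , n ⟩ e₁ = run-mono p q g _ e₂
run-mono {σ} {τ} p {suc s} (s≤s q) (rfind f) x eq with unpair x
... | a , n with >>=-just (run σ s f x) _ eq
... | zero  , e₁ , e₂ rewrite run-mono p q f x e₁ = e₂
... | suc k , e₁ , e₂ rewrite run-mono p q f x e₁ = run-mono p q (rfind f) _ e₂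

head-drop-applyUpTo : ∀ {A : Set} (f : ℕ → A) {n i} → i < n → head (drop i (applyUpTo f n)) ≡ just (f i)
head-drop-applyUpTo f {suc n} {zero}  _       = refl
head-drop-applyUpTo f {suc n} {suc i} (s≤s h) = head-drop-applyUpTo (f ∘ suc) h

head-drop-bound : ∀ {A : Set} (f : ℕ → A) n i {b} → head (drop i (applyUpTo f n)) ≡ just b → i < n × b ≡ f i
head-drop-bound f (suc n) zero    refl = s≤s z≤n , refl
head-drop-bound f (suc n) (suc i) eq   with head-drop-bound (f ∘ suc) n i eq
... | p , q = s≤s p , q

applyUpTo-≼ : ∀ {f g : ℕ → Bool} {m n} → m ≤ n → (∀ {i} → i < m → f i ≡ g i) → applyUpTo f m ≼ applyUpTo g n
applyUpTo-≼ {f} {g} {m} {n} m≤n f≡g i eq with head-drop-bound f m i eq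
... | i<m , refl = trans (head-drop-applyUpTo g (<-≤-trans i<m m≤n)) (cong just (sym (f≡g i<m)))

-- String length and fuel get separate bounds: inside a compound program the string keeps length
-- `suc (s ⊔ t)`, while the parts run with fuel `s ⊔ t`.
run-widen : ∀ (χ : ℕ → Bool) {s s′ t} → s ≤ s′ → s ≤ t → ∀ c x {y} →
            run (applyUpTo χ s) s c x ≡ just y → run (applyUpTo χ s′) t c x ≡ just y
run-widen χ h h′ = run-mono (applyUpTo-≼ h λ _ → refl) h′

run-extend : ∀ (χ : ℕ → Bool) {s t} → s ≤ t → ∀ c x {y} →
             run (applyUpTo χ s) s c x ≡ just y → run (applyUpTo χ t) t c x ≡ just y
run-extend χ s≤t = run-widen χ s≤t s≤t

Converges : (ℕ → Bool) → Code → ℕ → ℕ → Set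
Converges χ c x y = ∃[ s ] (run (applyUpTo χ s) s c x ≡ just y)

Converges-det : ∀ {χ c x y z} → Converges χ c x y → Converges χ c x z → y ≡ z
Converges-det {χ} {c} {x} (s , p) (t , q) = just-injective
  (trans (sym (run-extend χ (m≤m⊔n s t) c x p)) (run-extend χ (m≤n⊔m s t) c x q))

module _ {χ : ℕ → Bool} where

  conv-pair : ∀ {f g x y z} → Converges χ f x y → Converges χ g x z → Converges χ (pair f g) x ⟨ y , z ⟩
  conv-pair {f} {g} {x} (s , p) (t , q) = suc (s ⊔ t) ,
    just->>= {m = run _ (s ⊔ t) f x} (run-widen χ (m≤n⇒m≤1+n (m≤m⊔n s t)) (m≤m⊔n s t) f x p)
      (just->>= {m = run _ (s ⊔ t) g x} (run-widen χ (m≤n⇒m≤1+n (m≤n⊔m s t)) (m≤n⊔m s t) g x q) refl)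

  conv-comp : ∀ {f g x y z} → Converges χ g x y → Converges χ f y z → Converges χ (comp f g) x z
  conv-comp {f} {g} {x} {y} (s , p) (t , q) = suc (s ⊔ t) ,
    just->>= {m = run _ (s ⊔ t) g x}
      (run-widen χ (m≤n⇒m≤1+n (m≤m⊔n s t)) (m≤m⊔n s t) g x p)
      (run-widen χ (m≤n⇒m≤1+n (m≤n⊔m s t)) (m≤n⊔m s t) f y q)

  conv-prec-zero : ∀ a {f g y} → Converges χ f a y → Converges χ (prec f g) ⟨ a , 0 ⟩ y
  conv-prec-zero a {f} {g} {y} (s , p) = suc s , go
    where
    go : run (applyUpTo χ (suc s)) (suc s) (prec f g) ⟨ a , 0 ⟩ ≡ just y
    go rewrite unpair-⟨⟩ a 0 = run-widen χ (n≤1+n s) (≤-refl {s}) f a p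

  conv-prec-suc : ∀ a n {f g y z} → Converges χ (prec f g) ⟨ a , n ⟩ y → Converges χ g ⟨ a , ⟨ n , y ⟩ ⟩ z →
                  Converges χ (prec f g) ⟨ a , suc n ⟩ z
  conv-prec-suc a n {f} {g} {y} {z} (s , p) (t , q) = suc (s ⊔ t) , go
    where
    go : run (applyUpTo χ (suc (s ⊔ t))) (suc (s ⊔ t)) (prec f g) ⟨ a , suc n ⟩ ≡ just z
    go rewrite unpair-⟨⟩ a (suc n) = just->>= {m = run _ (s ⊔ t) (prec f g) ⟨ a , n ⟩}
      (run-widen χ (m≤n⇒m≤1+n (m≤m⊔n s t)) (m≤m⊔n s t) (prec f g) _ p)
      (run-widen χ (m≤n⇒m≤1+n (m≤n⊔m s t)) (m≤n⊔m s t) g _ q)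

  conv-rfind-zero : ∀ a n {f} → Converges χ f ⟨ a , n ⟩ 0 → Converges χ (rfind f) ⟨ a , n ⟩ n
  conv-rfind-zero a n {f} (s , p) = suc s , go
    where
    go : run (applyUpTo χ (suc s)) (suc s) (rfind f) ⟨ a , n ⟩ ≡ just n
    go rewrite unpair-⟨⟩ a n = just->>= {m = run _ s f ⟨ a , n ⟩}
      (run-widen χ (n≤1+n s) (≤-refl {s}) f _ p) refl

  conv-rfind-suc : ∀ a n {f k y} → Converges χ f ⟨ a , n ⟩ (suc k) → Converges χ (rfind f) ⟨ a , suc n ⟩ y →
                   Converges χ (rfind f) ⟨ a , n ⟩ y
  conv-rfind-suc a n {f} {k} {y} (s , p) (t , q) = suc (s ⊔ t) , go
    where
    go : run (applyUpTo χ (suc (s ⊔ t))) (suc (s ⊔ t)) (rfind f) ⟨ a , n ⟩ ≡ just y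
    go rewrite unpair-⟨⟩ a n = just->>= {m = run _ (s ⊔ t) f ⟨ a , n ⟩}
      (run-widen χ (m≤n⇒m≤1+n (m≤m⊔n s t)) (m≤m⊔n s t) f _ p)
      (run-widen χ (m≤n⇒m≤1+n (m≤n⊔m s t)) (m≤n⊔m s t) (rfind f) _ q)

rfind-sound : ∀ σ s f a n {y} → run σ s (rfind f) ⟨ a , n ⟩ ≡ just y → ∃[ t ] (run σ t f ⟨ a , y ⟩ ≡ just 0)
rfind-sound σ (suc s) f a n eq rewrite unpair-⟨⟩ a n with run σ s f ⟨ a , n ⟩ in e
rfind-sound σ (suc s) f a n refl | just zero    = s , e
rfind-sound σ (suc s) f a n eq   | just (suc k) = rfind-sound σ s f a (suc n) eq

caseM : ∀ {A B : Set} → B → (A → B) → Maybe A → B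
caseM z s nothing  = z
caseM z s (just x) = s x

-- Functions computable from an oracle

record Coded (A : Set) : Set where
  field enc : A → ℕ
open Coded ⦃ ... ⦄ public

instance
  codedℕ : Coded ℕ
  codedℕ = record { enc = id }

  codedBool : Coded Bool
  codedBool = record { enc = λ b → if b then 1 else 0 }

  coded× : ∀ {A B} ⦃ _ : Coded A ⦄ ⦃ _ : Coded B ⦄ → Coded (A × B)
  coded× = record { enc = λ (a , b) → ⟨ enc a , enc b ⟩ }

  codedMaybe : ∀ {A} ⦃ _ : Coded A ⦄ → Coded (Maybe A)
  codedMaybe = record { enc = caseM 0 (suc ∘ enc) }

encList : ∀ {A} ⦃ _ : Coded A ⦄ → List A → ℕ
encList []       = 0
encList (x ∷ xs) = suc ⟨ enc x , encList xs ⟩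

instance
  codedList : ∀ {A} ⦃ _ : Coded A ⦄ → Coded (List A)
  codedList = record { enc = encList }

-- The combinators below follow the shapes of definitions, so that a program is assembled along the
-- definition of its function. This is why the construction is written mostly with `natrec`, `recL`,
-- `caseM` and their like instead of pattern matching.
record Comp (χ : ℕ → Bool) {A B : Set} ⦃ _ : Coded A ⦄ ⦃ _ : Coded B ⦄ (f : A → B) : Set where
  constructor _computedBy_
  field
    code : Code
    computes : ∀ a → Converges χ code (enc a) (enc (f a))
open Comp public

idCode : Code
idCode = pair left right

constCode : ℕ → Code
constCode zero    = zero
constCode (suc n) = comp succ (constCode n)

predCode signCode : Code
predCode = comp (prec zero (comp left right)) (pair zero idCode)
signCode = comp (prec zero (constCode 1)) (pair zero idCode)

-- Codes have no conditional. Definition by cases is a primitive recursion of at most one step: the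
-- number of steps is the sign of `n`, and the step recovers the predecessor from the parameter
-- `⟨ x , n ⟩`.
caseCode : Code → Code → Code → Code
caseCode n z s = comp (prec (comp z left) (comp s (pair (comp left left) (comp predCode (comp right left)))))
                      (pair (pair idCode n) (comp signCode n))

module _ {χ : ℕ → Bool} where

  conv-succ : ∀ {x} → Converges χ succ x (suc x)
  conv-succ = 1 , refl

  conv-left : ∀ a b → Converges χ left ⟨ a , b ⟩ a
  conv-left a b = 1 , cong (just ∘ proj₁) (unpair-⟨⟩ a b)

  conv-right : ∀ a b → Converges χ right ⟨ a , b ⟩ b
  conv-right a b = 1 , cong (just ∘ proj₂) (unpair-⟨⟩ a b)

  conv-id : ∀ {x} → Converges χ idCode x x
  conv-id {x} = subst (Converges χ idCode x) (unpair-surjective x) (conv-pair (1 , refl) (1 , refl))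

  conv-const : ∀ n {x} → Converges χ (constCode n) x n
  conv-const zero    = 1 , refl
  conv-const (suc n) = conv-comp (conv-const n) conv-succ

  conv-pred : ∀ n → Converges χ predCode n (pred n)
  conv-pred n = conv-comp (conv-pair {y = 0} (1 , refl) conv-id) (go n)
    where
    go : ∀ n → Converges χ (prec zero (comp left right)) ⟨ 0 , n ⟩ (pred n)
    go zero    = conv-prec-zero 0 (1 , refl)
    go (suc n) = conv-prec-suc 0 n (go n) (conv-comp (conv-right 0 ⟨ n , pred n ⟩) (conv-left n (pred n)))

  conv-sign : ∀ n → Converges χ signCode n (n ⊓ 1)
  conv-sign n = conv-comp (conv-pair {y = 0} (1 , refl) conv-id) (go n)
    where
    go : ∀ n → Converges χ (prec zero (constCode 1)) ⟨ 0 , n ⟩ (n ⊓ 1)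
    go zero    = conv-prec-zero 0 (1 , refl)
    go (suc n) = subst (Converges χ _ _) (cong suc (sym (⊓-zeroʳ n))) (conv-prec-suc 0 n (go n) (conv-const 1))

  -- prec evaluates z in either case, so z has to converge even when it is not selected.
  conv-case : ∀ {n z s x k u} → Converges χ n x k → Converges χ z x u →
              ∀ {y} → (k ≡ 0 → u ≡ y) → (∀ {j} → k ≡ suc j → Converges χ s ⟨ x , j ⟩ y) →
              Converges χ (caseCode n z s) x y
  conv-case {n} {z} {s} {x} {k} {u} cn cz {y} hz hs =
    conv-comp (conv-pair (conv-pair conv-id cn) (conv-comp cn (conv-sign k))) (go k hz hs)
    where
    g : Code
    g = comp s (pair (comp left left) (comp predCode (comp right left)))
    base : ∀ k → Converges χ (prec (comp z left) g) ⟨ ⟨ x , k ⟩ , 0 ⟩ u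
    base k = conv-prec-zero ⟨ x , k ⟩ (conv-comp (conv-left x k) cz)
    go : ∀ k → (k ≡ 0 → u ≡ y) → (∀ {j} → k ≡ suc j → Converges χ s ⟨ x , j ⟩ y) →
         Converges χ (prec (comp z left) g) ⟨ ⟨ x , k ⟩ , k ⊓ 1 ⟩ y
    go zero hz hs = subst (Converges χ _ _) (hz refl) (base 0)
    go (suc j) hz hs rewrite ⊓-zeroʳ j = conv-prec-suc ⟨ x , suc j ⟩ 0 (base (suc j))
      (conv-comp (conv-pair (conv-comp (conv-left ⟨ x , suc j ⟩ ⟨ 0 , u ⟩) (conv-left x (suc j)))
        (conv-comp (conv-comp (conv-left ⟨ x , suc j ⟩ ⟨ 0 , u ⟩) (conv-right x (suc j)))
            (conv-pred (suc j)))) (hs refl))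

natrec : ∀ {A : Set} → A → (ℕ → A → A) → ℕ → A
natrec z s zero    = z
natrec z s (suc n) = s n (natrec z s n)

caseℕ : ∀ {A : Set} → A → (ℕ → A) → ℕ → A
caseℕ z s zero    = z
caseℕ z s (suc n) = s n

caseL : ∀ {A B : Set} → B → (A → List A → B) → List A → B
caseL z s []       = z
caseL z s (x ∷ xs) = s x xs

recL : ∀ {A B : Set} → B → (A → List A → B → B) → List A → B
recL z s []       = z
recL z s (x ∷ xs) = s x xs (recL z s xs)

module _ {χ : ℕ → Bool} {Γ : Set} ⦃ _ : Coded Γ ⦄ where

  idC : Comp χ {Γ} id
  idC = idCode computedBy λ _ → conv-id

  infixr 9 _∘C_
  _∘C_ : ∀ {A B} ⦃ _ : Coded A ⦄ ⦃ _ : Coded B ⦄ {g : A → B} {f : Γ → A} → Comp χ g → Comp χ f →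
      Comp χ (λ γ → g (f γ))
  _∘C_ {f = f} cg cf = comp (code cg) (code cf) computedBy λ a → conv-comp (computes cf a) (computes cg (f a))

  extC : ∀ {B} ⦃ _ : Coded B ⦄ {f g : Γ → B} → (∀ γ → f γ ≡ g γ) → Comp χ f → Comp χ g
  extC eq cf = code cf computedBy λ a → subst (Converges χ _ _) (cong enc (eq a)) (computes cf a)

  constC : ∀ {B} ⦃ _ : Coded B ⦄ (b : B) → Comp χ {Γ} (λ _ → b)
  constC b = constCode (enc b) computedBy λ _ → conv-const (enc b)

  infixr 4 _,C_
  _,C_ : ∀ {A B} ⦃ _ : Coded A ⦄ ⦃ _ : Coded B ⦄ {f : Γ → A} {g : Γ → B} → Comp χ f → Comp χ g →
      Comp χ (λ γ → f γ , g γ)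
  cf ,C cg = pair (code cf) (code cg) computedBy λ a → conv-pair (computes cf a) (computes cg a)

  fstC : ∀ {A B} ⦃ _ : Coded A ⦄ ⦃ _ : Coded B ⦄ {f : Γ → A × B} → Comp χ f → Comp χ (λ γ → proj₁ (f γ))
  fstC {f = f} cf = comp left (code cf) computedBy λ a →
      conv-comp (computes cf a) (conv-left (enc (proj₁ (f a))) (enc (proj₂ (f a))))

  sndC : ∀ {A B} ⦃ _ : Coded A ⦄ ⦃ _ : Coded B ⦄ {f : Γ → A × B} → Comp χ f → Comp χ (λ γ → proj₂ (f γ))
  sndC {f = f} cf = comp right (code cf) computedBy λ a →
      conv-comp (computes cf a) (conv-right (enc (proj₁ (f a))) (enc (proj₂ (f a))))

  sucC : {f : Γ → ℕ} → Comp χ f → Comp χ (λ γ → suc (f γ))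
  sucC cf = comp succ (code cf) computedBy λ a → conv-comp (computes cf a) conv-succ

  queryC : {f : Γ → ℕ} → Comp χ f → Comp χ (λ γ → χ (f γ))
  queryC {f} cf = comp query (code cf) computedBy λ a → conv-comp (computes cf a) (suc (suc (f a)) , go (f a))
    where
    go : ∀ n → run (applyUpTo χ (suc (suc n))) (suc (suc n)) query n ≡ just (enc (χ n))
    go n rewrite head-drop-applyUpTo χ {suc (suc n)} {n} (m<n⇒m<1+n (n<1+n n)) = refl

  -- Cantor pairing and its inverse are invisible to the encoding.
  ⟨⟩C : {f g : Γ → ℕ} → Comp χ f → Comp χ g → Comp χ (λ γ → ⟨ f γ , g γ ⟩)
  ⟨⟩C cf cg = pair (code cf) (code cg) computedBy λ a → conv-pair (computes cf a) (computes cg a)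

  unpairC : {f : Γ → ℕ} → Comp χ f → Comp χ (λ γ → unpair (f γ))
  unpairC {f} cf = code cf computedBy λ a → subst (Converges χ _ _) (sym (unpair-surjective (f a))) (computes cf a)

  encC : ∀ {A} ⦃ _ : Coded A ⦄ {f : Γ → A} → Comp χ f → Comp χ (λ γ → enc (f γ))
  encC cf = code cf computedBy computes cf

  natrecC : ∀ {A} ⦃ _ : Coded A ⦄ {z : Γ → A} {s : Γ × ℕ × A → A} {n : Γ → ℕ} →
            Comp χ z → Comp χ s → Comp χ n → Comp χ (λ γ → natrec (z γ) (λ k r → s (γ , k , r)) (n γ))
  natrecC {z = z} {s} {n} cz cs cn = comp (prec (code cz) (code cs)) (pair idCode (code cn))
    computedBy λ a → conv-comp (conv-pair conv-id (computes cn a)) (go a (n a))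
    where
    go : ∀ a n → Converges χ (prec (code cz) (code cs)) ⟨ enc a , n ⟩ (enc (natrec (z a) (λ k r → s (a , k , r)) n))
    go a zero    = conv-prec-zero (enc a) (computes cz a)
    go a (suc n) = conv-prec-suc (enc a) n (go a n) (computes cs (a , n , natrec (z a) (λ k r → s (a , k , r)) n))

  caseℕC : ∀ {A} ⦃ _ : Coded A ⦄ {z : Γ → A} {s : Γ × ℕ → A} {n : Γ → ℕ} →
           Comp χ z → Comp χ s → Comp χ n → Comp χ (λ γ → caseℕ (z γ) (λ k → s (γ , k)) (n γ))
  caseℕC {z = z} {s} {n} cz cs cn = caseCode (code cn) (code cz) (code cs) computedBy λ a →
    conv-case (computes cn a) (computes cz a) (zero-case a) (suc-case a)
    where
    zero-case : ∀ a → n a ≡ 0 → enc (z a) ≡ enc (caseℕ (z a) (λ k → s (a , k)) (n a))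
    zero-case a eq with n a
    zero-case a refl | zero = refl
    suc-case : ∀ a {j} → n a ≡ suc j → Converges χ (code cs) ⟨ enc a , j ⟩ (enc (caseℕ (z a) (λ k → s (a , k)) (n a)))
    suc-case a eq with n a
    suc-case a refl | suc j = computes cs (a , j)

  ifC : ∀ {A} ⦃ _ : Coded A ⦄ {b : Γ → Bool} {x y : Γ → A} →
        Comp χ b → Comp χ x → Comp χ y → Comp χ (λ γ → if b γ then x γ else y γ)
  ifC {b = b} {x} {y} cb cx cy = caseCode (code cb) (code cy) (comp (code cx) left) computedBy λ a →
    conv-case (computes cb a) (computes cy a) (zero-case a) (suc-case a)
    where
    zero-case : ∀ a → enc (b a) ≡ 0 → enc (y a) ≡ enc (if b a then x a else y a)
    zero-case a eq with b a
    ... | false = refl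
    suc-case : ∀ a {j} → enc (b a) ≡ suc j → Converges χ (comp (code cx) left) ⟨ enc a , j ⟩
        (enc (if b a then x a else y a))
    suc-case a {j} eq with b a
    ... | true = conv-comp (conv-left (enc a) j) (computes cx a)

  caseMC : ∀ {A B} ⦃ _ : Coded A ⦄ ⦃ _ : Coded B ⦄ {z : Γ → B} {s : Γ × A → B} {m : Γ → Maybe A} →
           Comp χ z → Comp χ s → Comp χ m → Comp χ (λ γ → caseM (z γ) (λ x → s (γ , x)) (m γ))
  caseMC {z = z} {s} {m} cz cs cm = caseCode (code cm) (code cz) (code cs) computedBy λ a →
    conv-case (computes cm a) (computes cz a) (zero-case a) (suc-case a)
    where
    zero-case : ∀ a → enc (m a) ≡ 0 → enc (z a) ≡ enc (caseM (z a) (λ x → s (a , x)) (m a))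
    zero-case a eq with m a
    ... | nothing = refl
    suc-case : ∀ a {j} → enc (m a) ≡ suc j → Converges χ (code cs) ⟨ enc a , j ⟩
        (enc (caseM (z a) (λ x → s (a , x)) (m a)))
    suc-case a eq with m a
    suc-case a refl | just x = computes cs (a , x)

  caseLC : ∀ {A B} ⦃ _ : Coded A ⦄ ⦃ _ : Coded B ⦄ {z : Γ → B} {s : Γ × A × List A → B} {l : Γ → List A} →
           Comp χ z → Comp χ s → Comp χ l → Comp χ (λ γ → caseL (z γ) (λ x xs → s (γ , x , xs)) (l γ))
  caseLC {z = z} {s} {l} cz cs cl = caseCode (code cl) (code cz) (code cs) computedBy λ a →
    conv-case (computes cl a) (computes cz a) (zero-case a) (suc-case a)
    where
    zero-case : ∀ a → enc (l a) ≡ 0 → enc (z a) ≡ enc (caseL (z a) (λ x xs → s (a , x , xs)) (l a))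
    zero-case a eq with l a
    ... | [] = refl
    suc-case : ∀ a {j} → enc (l a) ≡ suc j → Converges χ (code cs) ⟨ enc a , j ⟩
        (enc (caseL (z a) (λ x xs → s (a , x , xs)) (l a)))
    suc-case a eq with l a
    suc-case a refl | x ∷ xs = computes cs (a , x , xs)

  justC : ∀ {A} ⦃ _ : Coded A ⦄ {f : Γ → A} → Comp χ f → Comp χ (λ γ → just (f γ))
  justC cf = comp succ (code cf) computedBy λ a → conv-comp (computes cf a) conv-succ

  infixr 5 _∷C_
  _∷C_ : ∀ {A} ⦃ _ : Coded A ⦄ {f : Γ → A} {l : Γ → List A} → Comp χ f → Comp χ l → Comp χ (λ γ → f γ ∷ l γ)
  cf ∷C cl = comp succ (pair (code cf) (code cl)) computedBy λ a →
    conv-comp (conv-pair (computes cf a) (computes cl a)) conv-succ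

  notC : {f : Γ → Bool} → Comp χ f → Comp χ (λ γ → not (f γ))
  notC {f} cf = extC (λ γ → go (f γ)) (ifC cf (constC false) (constC true))
    where
    go : ∀ b → (if b then false else true) ≡ not b
    go false = refl
    go true  = refl

  infixr 6 _∧C_
  _∧C_ : {f g : Γ → Bool} → Comp χ f → Comp χ g → Comp χ (λ γ → f γ ∧ g γ)
  _∧C_ {f} {g} cf cg = extC (λ γ → go (f γ) (g γ)) (ifC cf cg (constC false))
    where
    go : ∀ b c → (if b then c else false) ≡ b ∧ c
    go false c = refl
    go true  c = refl

  infixr 5 _∨C_
  _∨C_ : {f g : Γ → Bool} → Comp χ f → Comp χ g → Comp χ (λ γ → f γ ∨ g γ)
  _∨C_ {f} {g} cf cg = extC (λ γ → go (f γ) (g γ)) (ifC cf (constC true) cg)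
    where
    go : ∀ b c → (if b then true else c) ≡ b ∨ c
    go false c = refl
    go true  c = refl

  predC : {f : Γ → ℕ} → Comp χ f → Comp χ (λ γ → pred (f γ))
  predC {f} cf = comp predCode (code cf) computedBy λ a → conv-comp (computes cf a) (conv-pred (f a))

module _ {χ : ℕ → Bool} where

  v₁ : ∀ {A B} ⦃ _ : Coded A ⦄ ⦃ _ : Coded B ⦄ → Comp χ {A × B} proj₁
  v₁ = fstC idC

  v₂ : ∀ {A B} ⦃ _ : Coded A ⦄ ⦃ _ : Coded B ⦄ → Comp χ {A × B} proj₂
  v₂ = sndC idC

  -- The index and the previous value in the step context of natrecC.
  vₖ : ∀ {A B C} ⦃ _ : Coded A ⦄ ⦃ _ : Coded B ⦄ ⦃ _ : Coded C ⦄ → Comp χ {A × B × C} (λ p → proj₁ (proj₂ p))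
  vₖ = fstC (sndC idC)

  vᵣ : ∀ {A B C} ⦃ _ : Coded A ⦄ ⦃ _ : Coded B ⦄ ⦃ _ : Coded C ⦄ → Comp χ {A × B × C} (λ p → proj₂ (proj₂ p))
  vᵣ = sndC (sndC idC)

module _ {χ : ℕ → Bool} {Γ : Set} ⦃ _ : Coded Γ ⦄ where

  +C : {f g : Γ → ℕ} → Comp χ f → Comp χ g → Comp χ (λ γ → f γ + g γ)
  +C {f} {g} cf cg = extC (λ γ → go (f γ) (g γ)) (natrecC cg (sucC vᵣ) cf)
    where
    go : ∀ m n → natrec n (λ _ r → suc r) m ≡ m + n
    go zero    n = refl
    go (suc m) n = cong suc (go m n)

  ∸C : {f g : Γ → ℕ} → Comp χ f → Comp χ g → Comp χ (λ γ → f γ ∸ g γ)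
  ∸C {f} {g} cf cg = extC (λ γ → go (f γ) (g γ)) (natrecC cf (predC vᵣ) cg)
    where
    go : ∀ m n → natrec m (λ _ r → pred r) n ≡ m ∸ n
    go m zero    = refl
    go m (suc n) = trans (cong pred (go m n)) (pred[m∸n]≡m∸[1+n] m n)

  ≤?C : {f g : Γ → ℕ} → Comp χ f → Comp χ g → Comp χ (λ γ → does (f γ ≤? g γ))
  ≤?C {f} {g} cf cg = extC (λ γ → go (f γ) (g γ)) (caseℕC (constC true) (constC false) (∸C cf cg))
    where
    go : ∀ m n → caseℕ true (λ _ → false) (m ∸ n) ≡ does (m ≤? n)
    go m n with m ≤? n
    ... | yes m≤n rewrite m≤n⇒m∸n≡0 m≤n = sym (dec-true (m ≤? n) m≤n)
    ... | no m≰n with m ∸ n in eq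
    ...   | zero  = contradiction (m∸n≡0⇒m≤n eq) m≰n
    ...   | suc _ = sym (dec-false (m ≤? n) m≰n)

  <?C : {f g : Γ → ℕ} → Comp χ f → Comp χ g → Comp χ (λ γ → does (f γ <? g γ))
  <?C cf cg = ≤?C (sucC cf) cg

  ≟C : {f g : Γ → ℕ} → Comp χ f → Comp χ g → Comp χ (λ γ → does (f γ ≟ g γ))
  ≟C {f} {g} cf cg = extC (λ γ → go (f γ) (g γ)) (≤?C cf cg ∧C ≤?C cg cf)
    where
    go : ∀ m n → does (m ≤? n) ∧ does (n ≤? m) ≡ does (m ≟ n)
    go m n with m ≟ n
    ... | yes refl rewrite dec-true (m ≤? m) ≤-refl = sym (dec-true (m ≟ m) refl)
    ... | no m≢n rewrite dec-false (m ≟ n) m≢n with m ≤? n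
    ...   | no m≰n rewrite dec-false (m ≤? n) m≰n = refl
    ...   | yes m≤n rewrite dec-true (m ≤? n) m≤n = dec-false (n ≤? m) λ n≤m → m≢n (≤-antisym m≤n n≤m)

allB anyB : ℕ → (ℕ → Bool) → Bool
allB n p = natrec true (λ k r → p k ∧ r) n
anyB n p = natrec false (λ k r → p k ∨ r) n

findB : ℕ → (ℕ → Bool) → Maybe ℕ
findB n p = natrec nothing (λ k r → caseM (if p k then just k else nothing) just r) n

module _ {χ : ℕ → Bool} {Γ : Set} ⦃ _ : Coded Γ ⦄ where

  allC : {p : Γ × ℕ → Bool} {n : Γ → ℕ} → Comp χ n → Comp χ p → Comp χ (λ γ → allB (n γ) (λ k → p (γ , k)))
  allC cn cp = natrecC (constC true) ((cp ∘C (v₁ ,C vₖ)) ∧C vᵣ) cn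

  anyC : {p : Γ × ℕ → Bool} {n : Γ → ℕ} → Comp χ n → Comp χ p → Comp χ (λ γ → anyB (n γ) (λ k → p (γ , k)))
  anyC cn cp = natrecC (constC false) ((cp ∘C (v₁ ,C vₖ)) ∨C vᵣ) cn

  findC : {p : Γ × ℕ → Bool} {n : Γ → ℕ} → Comp χ n → Comp χ p → Comp χ (λ γ → findB (n γ) (λ k → p (γ , k)))
  findC cn cp = natrecC (constC nothing)
    (caseMC (ifC (cp ∘C (v₁ ,C vₖ)) (justC vₖ) (constC nothing)) (justC v₂) vᵣ) cn

-- Unbounded search

least : (p : ℕ → Bool) → ∃[ n ] (p n ≡ true) → ∃[ n ] (p n ≡ true × ∀ {m} → m < n → p m ≡ false)
least p (k , e) = go k p e
  where
  go : ∀ k (p : ℕ → Bool) → p k ≡ true → ∃[ n ] (p n ≡ true × ∀ {m} → m < n → p m ≡ false)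
  go zero    p e = 0 , e , λ ()
  go (suc k) p e with p 0 in eq
  ... | true  = 0 , eq , λ ()
  ... | false with go k (p ∘ suc) e
  ...   | m , pm , below = suc m , pm , λ { {zero} _ → eq ; {suc k} (s≤s h) → below h }

μ : (p : ℕ → Bool) → ∃[ n ] (p n ≡ true) → ℕ
μ p ex = proj₁ (least p ex)

run⇒Converges : ∀ {χ s t c x y} → run (applyUpTo χ s) t c x ≡ just y → Converges χ c x y
run⇒Converges {χ} {s} {t} {c} {x} eq = s ⊔ t ,
  run-mono (applyUpTo-≼ {f = χ} (m≤m⊔n s t) λ _ → refl) (m≤n⊔m s t) c x eq

module _ {χ : ℕ → Bool} {A : Set} ⦃ _ : Coded A ⦄ {p : A × ℕ → Bool} (cp : Comp χ p) where

  private
    search : Code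
    search = rfind (code (notC cp))

  search-converges : ∀ a {n} → p (a , n) ≡ true → (∀ {m} → m < n → p (a , m) ≡ false) →
                     ∀ k m → k + m ≡ n → Converges χ search ⟨ enc a , m ⟩ n
  search-converges a {n} pn below zero .n refl = conv-rfind-zero (enc a) n
    (subst (Converges χ _ _) (cong (enc ∘ not) pn) (computes (notC cp) (a , n)))
  search-converges a {n} pn below (suc k) m eq = conv-rfind-suc (enc a) m
    (subst (Converges χ _ _) (cong (enc ∘ not) (below (subst (m <_) eq (s≤s (m≤n+m m k)))))
      (computes (notC cp) (a , m)))
    (search-converges a pn below k (suc m) (trans (+-suc k m) eq))

  searchCode : Code
  searchCode = comp search (pair idCode zero)

  searchCode-total : ∀ a (ex : ∃[ n ] (p (a , n) ≡ true)) → Converges χ searchCode (enc a) (μ (λ n → p (a , n)) ex)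
  searchCode-total a ex with least (λ n → p (a , n)) ex
  ... | n , pn , below = conv-comp (conv-pair conv-id (1 , refl)) (search-converges a pn below n 0 (+-identityʳ n))

  searchCode-sound : ∀ a {y} → Converges χ searchCode (enc a) y → ∃[ n ] (p (a , n) ≡ true)
  searchCode-sound a {y} (suc s , eq) =
    let z , e₁ , e₂ = >>=-just (run (applyUpTo χ (suc s)) s (pair idCode zero) (enc a)) _ eq
        z≡ : z ≡ ⟨ enc a , 0 ⟩
        z≡ = Converges-det (run⇒Converges {χ} {suc s} {s} {pair idCode zero} {enc a} e₁)
            (conv-pair conv-id (1 , refl))
        t , e₃ = rfind-sound _ s (code (notC cp)) (enc a) 0
                   (subst (λ z → run (applyUpTo χ (suc s)) s search z ≡ just y) z≡ e₂)
    in y , zero-not (p (a , y)) (Converges-det (run⇒Converges {χ} {suc s} {t} {code (notC cp)} e₃)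
        (computes (notC cp) (a , y)))
    where
    zero-not : ∀ b → 0 ≡ enc (not b) → b ≡ true
    zero-not true _ = refl

  μC : (ex : ∀ a → ∃[ n ] (p (a , n) ≡ true)) → Comp χ (λ a → μ (λ n → p (a , n)) (ex a))
  μC ex = searchCode computedBy λ a → searchCode-total a (ex a)

-- Folds and recursion on coded lists

length≤enc : ∀ {A} ⦃ _ : Coded A ⦄ (xs : List A) → length xs ≤ enc xs
length≤enc []       = z≤n
length≤enc (x ∷ xs) = s≤s (≤-trans (length≤enc xs) (≤-trans (m≤n+m _ (enc x)) (+≤⟨⟩ (enc x) (enc xs))))

module _ {A R : Set} (f : R → A → R) where

  foldStep : List A × R → List A × R
  foldStep (l , r) = caseL (l , r) (λ x xs → xs , f r x) l

  -- Since the code of a list bounds its length, `enc l` rounds of a primitive recursion exhaust it;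
  -- surplus rounds leave the empty list alone.
  foldSteps : ∀ n l r → length l ≤ n → natrec (l , r) (λ _ → foldStep) n ≡ ([] , foldl f r l)
  foldSteps n l r h = go n l r h
    where
    shift : ∀ n st → natrec st (λ _ → foldStep) (suc n) ≡ natrec (foldStep st) (λ _ → foldStep) n
    shift zero    st = refl
    shift (suc n) st = cong foldStep (shift n st)
    go : ∀ n l r → length l ≤ n → natrec (l , r) (λ _ → foldStep) n ≡ ([] , foldl f r l)
    go zero    []       r _       = refl
    go (suc n) []       r _       = trans (shift n _) (go n [] r z≤n)
    go (suc n) (x ∷ xs) r (s≤s h) = trans (shift n _) (go n xs (f r x) h)

-- Recursion on a list needs the tail at each step. A fold that rebuilds the list alongside the
-- value supplies it, and becomes a left fold, hence an iteration, over the reversed list.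
recL-foldr : ∀ {A B : Set} (z : B) (s : A → List A → B → B) l →
  foldr (λ x (xs , r) → x ∷ xs , s x xs r) ([] , z) l ≡ (l , recL z s l)
recL-foldr z s []       = refl
recL-foldr z s (x ∷ xs) rewrite recL-foldr z s xs = refl

module _ {χ : ℕ → Bool} {Γ : Set} ⦃ _ : Coded Γ ⦄ {A : Set} ⦃ _ : Coded A ⦄ where

  foldlC : ∀ {R} ⦃ _ : Coded R ⦄ {z : Γ → R} {s : Γ × R × A → R} {l : Γ → List A} →
           Comp χ z → Comp χ s → Comp χ l → Comp χ (λ γ → foldl (λ r x → s (γ , r , x)) (z γ) (l γ))
  foldlC {R} {z} {s} {l} cz cs cl = extC
    (λ γ → cong proj₂ (foldSteps (λ r x → s (γ , r , x)) (enc (l γ)) (l γ) (z γ) (length≤enc (l γ))))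
    (sndC (natrecC (cl ,C cz) step (encC cl)))
    where
    step : Comp χ {Γ × ℕ × List A × R} (λ (γ , _ , l , r) → foldStep (λ r x → s (γ , r , x)) (l , r))
    step = caseLC vᵣ (vᵣ ,C cs ∘C (fstC v₁ ,C sndC (sndC (sndC v₁)) ,C vₖ)) (fstC vᵣ)

  reverseC : {l : Γ → List A} → Comp χ l → Comp χ (λ γ → reverse (l γ))
  reverseC cl = foldlC (constC []) (vᵣ ∷C vₖ) cl

  recLC : ∀ {B} ⦃ _ : Coded B ⦄ {z : Γ → B} {s : Γ × A × List A × B → B} {l : Γ → List A} →
          Comp χ z → Comp χ s → Comp χ l → Comp χ (λ γ → recL (z γ) (λ x xs r → s (γ , x , xs , r)) (l γ))
  recLC {B} {z} {s} {l} cz cs cl = extC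
    (λ γ → trans (cong proj₂ (reverse-foldl _ ([] , z γ) (l γ))) (cong proj₂ (recL-foldr (z γ) _ (l γ))))
    (sndC (foldlC {s = λ (γ , (xs , r) , x) → x ∷ xs , s (γ , x , xs , r)} (constC [] ,C cz)
      (vᵣ ∷C fstC vₖ ,C cs ∘C (v₁ ,C vᵣ ,C vₖ)) (reverseC cl)))

  lengthC : {l : Γ → List A} → Comp χ l → Comp χ (λ γ → length (l γ))
  lengthC {l} cl = extC (λ γ → go (l γ)) (recLC (constC 0) (sucC (sndC vᵣ)) cl)
    where
    go : ∀ l → recL 0 (λ _ _ r → suc r) l ≡ length l
    go []       = refl
    go (x ∷ xs) = cong suc (go xs)

  headC : {l : Γ → List A} → Comp χ l → Comp χ (λ γ → head (l γ))
  headC {l} cl = extC (λ γ → go (l γ)) (caseLC (constC nothing) (justC vₖ) cl)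
    where
    go : ∀ l → caseL nothing (λ x _ → just x) l ≡ head l
    go []       = refl
    go (x ∷ xs) = refl

  dropC : {n : Γ → ℕ} {l : Γ → List A} → Comp χ n → Comp χ l → Comp χ (λ γ → drop (n γ) (l γ))
  dropC {n} {l} cn cl = extC (λ γ → go (n γ) (l γ)) (natrecC cl (caseLC (constC []) vᵣ vᵣ) cn)
    where
    tail : List A → List A
    tail = caseL [] (λ _ xs → xs)
    tail-drop : ∀ n l → tail (drop n l) ≡ drop (suc n) l
    tail-drop zero    []       = refl
    tail-drop zero    (x ∷ l)  = refl
    tail-drop (suc n) []       = refl
    tail-drop (suc n) (x ∷ l)  = tail-drop n l
    go : ∀ n l → natrec l (λ _ r → tail r) n ≡ drop n l
    go zero    l = refl
    go (suc n) l = trans (cong tail (go n l)) (tail-drop n l)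

  ++C : {k l : Γ → List A} → Comp χ k → Comp χ l → Comp χ (λ γ → k γ ++ l γ)
  ++C {k} {l} ck cl = extC (λ γ → go (k γ) (l γ)) (recLC cl (vₖ ∷C sndC vᵣ) ck)
    where
    go : ∀ k l → recL l (λ x _ r → x ∷ r) k ≡ k ++ l
    go []      l = refl
    go (x ∷ k) l = cong (x ∷_) (go k l)

module _ {χ : ℕ → Bool} {Γ : Set} ⦃ _ : Coded Γ ⦄ {A : Set} ⦃ _ : Coded A ⦄ where

  applyUpToC : {f : Γ × ℕ → A} {n : Γ → ℕ} → Comp χ f → Comp χ n → Comp χ (λ γ → applyUpTo (λ k → f (γ , k)) (n γ))
  applyUpToC {f} {n} cf cn = extC (λ γ → go _ (n γ))
    (natrecC (constC []) (++C vᵣ (cf ∘C (v₁ ,C vₖ) ∷C constC [])) cn)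
    where
    go : ∀ (f : ℕ → A) n → natrec [] (λ k r → r ++ (f k ∷ [])) n ≡ applyUpTo f n
    go f zero    = refl
    go f (suc n) = trans (cong (_∷ʳ f n) (go f n)) (applyUpTo-∷ʳ f n)

  takeC : {n : Γ → ℕ} {l : Γ → List A} → Comp χ n → Comp χ l → Comp χ (λ γ → take (n γ) (l γ))
  takeC {n} {l} cn cl = extC (λ γ → go (n γ) (l γ)) (reverseC (sndC (natrecC (cl ,C constC [])
      (caseLC vᵣ (vᵣ ,C vₖ ∷C sndC (sndC (sndC v₁))) (fstC vᵣ)) cn)))
    where
    step : List A × List A → List A × List A
    step (l , r) = caseL (l , r) (λ x xs → xs , x ∷ r) l
    shift : ∀ n st → natrec st (λ _ → step) (suc n) ≡ natrec (step st) (λ _ → step) n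
    shift zero    st = refl
    shift (suc n) st = cong step (shift n st)
    acc : ∀ n l r → proj₂ (natrec (l , r) (λ _ → step) n) ≡ foldl (λ r x → x ∷ r) r (take n l)
    acc zero    l       r = refl
    acc (suc n) []      r = trans (cong proj₂ (shift n ([] , r))) (trans (acc n [] r) (stop n))
      where
      stop : ∀ n → foldl (λ r x → x ∷ r) r (take n []) ≡ r
      stop zero    = refl
      stop (suc n) = refl
    acc (suc n) (x ∷ l) r = trans (cong proj₂ (shift n (x ∷ l , r))) (acc n l (x ∷ r))
    go : ∀ n l → reverse (proj₂ (natrec (l , []) (λ _ → step) n)) ≡ take n l
    go n l = trans (cong reverse (acc n l [])) (reverse-involutive (take n l))

  is-justC : {m : Γ → Maybe A} → Comp χ m → Comp χ (λ γ → is-just (m γ))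
  is-justC {m} cm = extC (λ γ → go (m γ)) (caseMC (constC false) (constC true) cm)
    where
    go : ∀ m → caseM false (λ _ → true) m ≡ is-just m
    go nothing  = refl
    go (just _) = refl

-- A universal program

decodeWith-stable : ∀ j k n → n < j → n < k → decodeWith j n ≡ decodeWith k n
decodeWith-stable (suc j) (suc k) n (s≤s h) (s≤s h′) = node (unpair n) (unpair-sum n)
  where
  sub : ∀ t m → suc (t + m) ≤ n → m < n
  sub t m h = ≤-trans (s≤s (m≤n+m m t)) h
  subˡ : ∀ m → m < n → proj₁ (unpair m) < n
  subˡ m h = ≤-<-trans (≤-trans (m≤m+n _ _) (unpair-sum m)) h
  subʳ : ∀ m → m < n → proj₂ (unpair m) < n
  subʳ m h = ≤-<-trans (≤-trans (m≤n+m _ (proj₁ (unpair m))) (unpair-sum m)) h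
  ih : ∀ m → m < n → decodeWith j m ≡ decodeWith k m
  ih m m<n = decodeWith-stable j k m (<-≤-trans m<n h) (<-≤-trans m<n h′)
  node : ∀ p → proj₁ p + proj₂ p ≤ n → decodeNode j p ≡ decodeNode k p
  node (0 , m) q = refl
  node (1 , m) q = refl
  node (2 , m) q = refl
  node (3 , m) q = refl
  node (4 , m) q = refl
  node (5 , m) q = cong₂ pair (ih _ (subˡ m (sub 4 m q))) (ih _ (subʳ m (sub 4 m q)))
  node (6 , m) q = cong₂ comp (ih _ (subˡ m (sub 5 m q))) (ih _ (subʳ m (sub 5 m q)))
  node (7 , m) q = cong₂ prec (ih _ (subˡ m (sub 6 m q))) (ih _ (subʳ m (sub 6 m q)))
  node (suc (suc (suc (suc (suc (suc (suc (suc t))))))) , m) q = cong rfind (ih m (sub (7 + t) m q))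

decodeHead : ℕ × ℕ → Code
decodeHead (0 , _) = zero
decodeHead (1 , _) = succ
decodeHead (2 , _) = left
decodeHead (3 , _) = right
decodeHead (4 , _) = query
decodeHead (5 , m) = pair (decode (proj₁ (unpair m))) (decode (proj₂ (unpair m)))
decodeHead (6 , m) = comp (decode (proj₁ (unpair m))) (decode (proj₂ (unpair m)))
decodeHead (7 , m) = prec (decode (proj₁ (unpair m))) (decode (proj₂ (unpair m)))
decodeHead (suc (suc (suc (suc (suc (suc (suc (suc _))))))) , m) = rfind (decode m)

-- Once decoding is independent of surplus fuel, each subprogram is decoded under its own index,
-- which is the form in which the machine meets it.
decode-unfold : ∀ e → decode e ≡ decodeHead (unpair e)
decode-unfold e = node (unpair e) (unpair-sum e)
  where
  sub : ∀ t m → suc (t + m) ≤ e → m < e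
  sub t m h = ≤-trans (s≤s (m≤n+m m t)) h
  subˡ : ∀ m → m < e → proj₁ (unpair m) < e
  subˡ m h = ≤-<-trans (≤-trans (m≤m+n _ _) (unpair-sum m)) h
  subʳ : ∀ m → m < e → proj₂ (unpair m) < e
  subʳ m h = ≤-<-trans (≤-trans (m≤n+m _ (proj₁ (unpair m))) (unpair-sum m)) h
  st : ∀ m → m < e → decodeWith e m ≡ decode m
  st m h = decodeWith-stable e (suc m) m h (n<1+n m)
  node : ∀ p → proj₁ p + proj₂ p ≤ e → decodeNode e p ≡ decodeHead p
  node (0 , m) q = refl
  node (1 , m) q = refl
  node (2 , m) q = refl
  node (3 , m) q = refl
  node (4 , m) q = refl
  node (5 , m) q = cong₂ pair (st _ (subˡ m (sub 4 m q))) (st _ (subʳ m (sub 4 m q)))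
  node (6 , m) q = cong₂ comp (st _ (subˡ m (sub 5 m q))) (st _ (subʳ m (sub 5 m q)))
  node (7 , m) q = cong₂ prec (st _ (subˡ m (sub 6 m q))) (st _ (subʳ m (sub 6 m q)))
  node (suc (suc (suc (suc (suc (suc (suc (suc t))))))) , m) q = cong rfind (st m (sub (7 + t) m q))

-- A stack machine for `run`.  The operations, coded by their first component, are
--   0 s e _  apply the code e with fuel s to the current value;
--   1 s g x  save the current value and apply g with fuel s to x;
--   2 y _ _  pair the saved y with the current value;
--   3 a n _  form the argument ⟨ a , ⟨ n , _ ⟩ ⟩ of a step of a primitive recursion;
--   4 s e x  test the current value, the search e being at x.
-- The value `nothing` marks a computation that has run out of fuel.

Op : Set
Op = ℕ × ℕ × ℕ × ℕ

State : Set
State = List Op × Maybe ℕ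

expand : List Bool → ℕ → ℕ → List Op → ℕ → State
expand σ s e ops v =
  if does (t ≟ 0) then ops , just 0 else
  if does (t ≟ 1) then ops , just (suc v) else
  if does (t ≟ 2) then ops , just (proj₁ (unpair v)) else
  if does (t ≟ 3) then ops , just (proj₂ (unpair v)) else
  if does (t ≟ 4) then caseM ([] , nothing) (λ b → ops , just (enc b)) (head (drop v σ)) else
  if does (t ≟ 5) then (0 , s , m₁ , 0) ∷ (1 , s , m₂ , v) ∷ ops , just v else
  if does (t ≟ 6) then (0 , s , m₂ , 0) ∷ (0 , s , m₁ , 0) ∷ ops , just v else
  if does (t ≟ 7) then caseℕ ((0 , s , m₁ , 0) ∷ ops , just (proj₁ (unpair v)))
                             (λ n → (0 , s , e , 0) ∷ (3 , proj₁ (unpair v) , n , 0) ∷ (0 , s , m₂ , 0) ∷ ops ,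
                                    just ⟨ proj₁ (unpair v) , n ⟩)
                             (proj₂ (unpair v)) else
  ((0 , s , m , 0) ∷ (4 , s , e , v) ∷ ops , just v)
  where
  t = proj₁ (unpair e)
  m = proj₂ (unpair e)
  m₁ = proj₁ (unpair m)
  m₂ = proj₂ (unpair m)

execute : List Bool → ℕ → Op → List Op → State
execute σ v (t , s , e , x) ops =
  if does (t ≟ 0) then caseℕ ([] , nothing) (λ s → expand σ s e ops v) s else
  if does (t ≟ 1) then (0 , s , e , 0) ∷ (2 , v , 0 , 0) ∷ ops , just x else
  if does (t ≟ 2) then ops , just ⟨ s , v ⟩ else
  if does (t ≟ 3) then ops , just ⟨ s , ⟨ e , v ⟩ ⟩ else
  caseℕ (ops , just (proj₂ (unpair x)))
        (λ _ → (0 , s , e , 0) ∷ ops , just ⟨ proj₁ (unpair x) , suc (proj₂ (unpair x)) ⟩) v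

transition : List Bool → State → State
transition σ (ops , v) = caseL ([] , v) (λ op ops → caseM ([] , nothing) (λ v → execute σ v op ops) v) ops

module _ (σ : List Bool) where

  steps : ℕ → State → State
  steps n st = natrec st (λ _ → transition σ) n

  steps-suc : ∀ n st → steps (suc n) st ≡ steps n (transition σ st)
  steps-suc zero    st = refl
  steps-suc (suc n) st = cong (transition σ) (steps-suc n st)

  steps-+ : ∀ m n st → steps (m + n) st ≡ steps n (steps m st)
  steps-+ zero    n st = refl
  steps-+ (suc m) n st =
      trans (steps-suc (m + n) st) (trans (steps-+ m n (transition σ st)) (cong (steps n) (sym (steps-suc m st))))

  infix 4 _⇒_
  _⇒_ : State → State → Set
  st ⇒ st′ = ∃[ n ] (steps n st ≡ st′)

  ⇒-refl : ∀ {st} → st ⇒ st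
  ⇒-refl = 0 , refl

  ⇒-trans : ∀ {st st′ st″} → st ⇒ st′ → st′ ⇒ st″ → st ⇒ st″
  ⇒-trans {st} (m , p) (n , q) = m + n , trans (steps-+ m n st) (trans (cong (steps n) p) q)

  ⇒-step : ∀ {st st′} → transition σ st ⇒ st′ → st ⇒ st′
  ⇒-step {st} (n , p) = suc n , trans (steps-suc n st) p

  resume : List Op → Maybe ℕ → State
  resume ops = caseM ([] , nothing) (λ y → ops , just y)

  ⇒-bind : ∀ {st ops ops′} m {f : ℕ → Maybe ℕ} → st ⇒ resume ops m →
           (∀ y → (ops , just y) ⇒ resume ops′ (f y)) → st ⇒ resume ops′ (m >>= f)
  ⇒-bind nothing  p q = p
  ⇒-bind (just y) p q = ⇒-trans p (q y)

  -- `run` calls itself several times at one level of fuel, whereas the machine iterates a single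
  -- step; this turns the interpreter into a search for the halting time. The continuation `ops` is
  -- arbitrary, as the recursion pushes further operations onto it.
  machine-runs : ∀ s e v ops r → ((0 , s , e , r) ∷ ops , just v) ⇒ resume ops (run σ s (decode e) v)
  machine-runs zero    e v ops r = ⇒-step ⇒-refl
  machine-runs (suc s) e v ops r rewrite decode-unfold e = ⇒-step node
    where
    m₁ m₂ : ℕ
    m₁ = proj₁ (unpair (proj₂ (unpair e)))
    m₂ = proj₂ (unpair (proj₂ (unpair e)))
    again : ∀ x ops → ((0 , s , e , 0) ∷ ops , just x) ⇒ resume ops (run σ s (decode e) x)
    again x ops = machine-runs s e x ops 0
    node : expand σ s e ops v ⇒ resume ops (run σ (suc s) (decodeHead (unpair e)) v)
    node with unpair e | decode-unfold e | again
    ... | 0 , m | _ | _ = ⇒-refl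
    ... | 1 , m | _ | _ = ⇒-refl
    ... | 2 , m | _ | _ = ⇒-refl
    ... | 3 , m | _ | _ = ⇒-refl
    ... | 4 , m | _ | _ with head (drop v σ)
    ...   | nothing = ⇒-refl
    ...   | just b  = ⇒-refl
    node | 5 , m | _ | _ =
      ⇒-bind (run σ s (decode (proj₁ (unpair m))) v) (machine-runs s _ v _ 0) λ y → ⇒-step
        (⇒-bind (run σ s (decode (proj₂ (unpair m))) v) (machine-runs s _ v _ 0) λ z → ⇒-step ⇒-refl)
    node | 6 , m | _ | _ =
      ⇒-bind (run σ s (decode (proj₂ (unpair m))) v) (machine-runs s _ v _ 0) λ y → machine-runs s _ y ops 0
    node | 7 , m | eq | again with unpair v
    ... | a , zero  = machine-runs s _ a ops 0
    ... | a , suc n = ⇒-bind (run σ s c ⟨ a , n ⟩)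
      (subst (λ c → ((0 , s , e , 0) ∷ next-ops , just ⟨ a , n ⟩) ⇒ resume next-ops (run σ s c ⟨ a , n ⟩)) eq
          (again ⟨ a , n ⟩ next-ops))
      λ y → ⇒-step (machine-runs s _ ⟨ a , ⟨ n , y ⟩ ⟩ ops 0)
      where
      c : Code
      c = prec (decode (proj₁ (unpair m))) (decode (proj₂ (unpair m)))
      next-ops : List Op
      next-ops = (3 , a , n , 0) ∷ (0 , s , proj₂ (unpair m) , 0) ∷ ops
    node | suc (suc (suc (suc (suc (suc (suc (suc t))))))) , m | eq | again with unpair v in eqv
    ... | a , n = ⇒-bind (run σ s (decode m) v) (machine-runs s m v _ 0) λ
      { zero    → ⇒-step (0 , cong (λ p → ops , just (proj₂ p)) eqv)
      ; (suc _) → ⇒-step (subst₂ (λ p c → ((0 , s , e , 0) ∷ ops , just ⟨ proj₁ p , suc (proj₂ p) ⟩) ⇒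
                                           resume ops (run σ s c ⟨ a , suc n ⟩))
                                 (sym eqv) eq (again ⟨ a , suc n ⟩ ops)) }

  steps-done : ∀ n v → steps n ([] , v) ≡ ([] , v)
  steps-done zero    v = refl
  steps-done (suc n) v = cong (transition σ) (steps-done n v)

  start : ℕ → ℕ → ℕ → State
  start s e x = ((0 , s , e , 0) ∷ []) , just x

  empty? : State → Bool
  empty? (ops , _) = caseL true (λ _ _ → false) ops

  -- A halted state is a fixed point of the machine, so any two halting times show the same value,
  -- and the search may return whichever it finds.
  steps-unique : ∀ k n {st v} → steps n st ≡ ([] , v) → empty? (steps k st) ≡ true → proj₂ (steps k st) ≡ v
  steps-unique k n {st} {v} p q with steps k st in eq
  ... | [] , w = trans (cong proj₂ (sym (steps-done n w))) (trans (cong (proj₂ ∘ steps n) (sym eq))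
        (trans (cong proj₂ (sym (steps-+ k n st))) (trans (cong (λ j → proj₂ (steps j st)) (+-comm k n))
          (trans (cong proj₂ (steps-+ n k st)) (trans (cong (proj₂ ∘ steps k) p) (cong proj₂ (steps-done k v)))))))

  resume-[] : ∀ m → resume [] m ≡ ([] , m)
  resume-[] nothing  = refl
  resume-[] (just _) = refl

  halts : ∀ s e x → start s e x ⇒ ([] , run σ s (decode e) x)
  halts s e x = subst (start s e x ⇒_) (resume-[] (run σ s (decode e) x)) (machine-runs s e x [] 0)

  halting-time : ∀ s e x → ∃[ n ] (empty? (steps n (start s e x)) ≡ true)
  halting-time s e x = proj₁ (halts s e x) , cong empty? (proj₂ (halts s e x))

module _ {χ : ℕ → Bool} where

  expandC : Comp χ {List Bool × ℕ × ℕ × List Op × ℕ} (λ (σ , s , e , ops , v) → expand σ s e ops v)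
  expandC =
    ifC (≟C ct (constC 0)) (cops ,C constC (just 0)) (
    ifC (≟C ct (constC 1)) (cops ,C justC (sucC cv)) (
    ifC (≟C ct (constC 2)) (cops ,C justC (fstC (unpairC cv))) (
    ifC (≟C ct (constC 3)) (cops ,C justC (sndC (unpairC cv))) (
    ifC (≟C ct (constC 4)) (caseMC (constC ([] , nothing)) (cops ∘C v₁ ,C justC (encC v₂)) (headC (dropC cv cσ))) (
    ifC (≟C ct (constC 5))
        (((constC 0 ,C cs ,C c₁ ,C constC 0) ∷C (constC 1 ,C cs ,C c₂ ,C cv) ∷C cops) ,C justC cv) (
    ifC (≟C ct (constC 6))
        (((constC 0 ,C cs ,C c₂ ,C constC 0) ∷C (constC 0 ,C cs ,C c₁ ,C constC 0) ∷C cops) ,C justC cv) (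
    ifC (≟C ct (constC 7)) (caseℕC (((constC 0 ,C cs ,C c₁ ,C constC 0) ∷C cops) ,C justC (fstC (unpairC cv)))
      (((constC 0 ,C cs ∘C v₁ ,C ce ∘C v₁ ,C constC 0) ∷C (constC 3 ,C fstC (unpairC cv) ∘C v₁ ,C v₂ ,C constC 0) ∷C
        (constC 0 ,C cs ∘C v₁ ,C c₂ ∘C v₁ ,C constC 0) ∷C cops ∘C v₁) ,C
        justC (⟨⟩C (fstC (unpairC cv) ∘C v₁) v₂))
      (sndC (unpairC cv)))
    (((constC 0 ,C cs ,C sndC (unpairC ce) ,C constC 0) ∷C (constC 4 ,C cs ,C ce ,C cv) ∷C cops) ,C justC cv))))))))
    where
    Ctx : Set
    Ctx = List Bool × ℕ × ℕ × List Op × ℕ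
    cσ : Comp χ {Ctx} proj₁
    cσ = v₁
    cs : Comp χ {Ctx} (proj₁ ∘ proj₂)
    cs = vₖ
    ce : Comp χ {Ctx} (proj₁ ∘ proj₂ ∘ proj₂)
    ce = fstC vᵣ
    cops : Comp χ {Ctx} (proj₁ ∘ proj₂ ∘ proj₂ ∘ proj₂)
    cops = fstC (sndC vᵣ)
    cv : Comp χ {Ctx} (proj₂ ∘ proj₂ ∘ proj₂ ∘ proj₂)
    cv = sndC (sndC vᵣ)
    ct : Comp χ {Ctx} (λ (σ , s , e , ops , v) → proj₁ (unpair e))
    ct = fstC (unpairC ce)
    c₁ : Comp χ {Ctx} (λ (σ , s , e , ops , v) → proj₁ (unpair (proj₂ (unpair e))))
    c₁ = fstC (unpairC (sndC (unpairC ce)))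
    c₂ : Comp χ {Ctx} (λ (σ , s , e , ops , v) → proj₂ (unpair (proj₂ (unpair e))))
    c₂ = sndC (unpairC (sndC (unpairC ce)))

  executeC : Comp χ {List Bool × ℕ × Op × List Op} (λ (σ , v , op , ops) → execute σ v op ops)
  executeC =
    ifC (≟C ct (constC 0)) (caseℕC (constC ([] , nothing))
      (expandC ∘C (cσ ∘C v₁ ,C v₂ ,C ce ∘C v₁ ,C cops ∘C v₁ ,C cv ∘C v₁)) cs) (
    ifC (≟C ct (constC 1))
        (((constC 0 ,C cs ,C ce ,C constC 0) ∷C (constC 2 ,C cv ,C constC 0 ,C constC 0) ∷C cops) ,C justC cx) (
    ifC (≟C ct (constC 2)) (cops ,C justC (⟨⟩C cs cv)) (
    ifC (≟C ct (constC 3)) (cops ,C justC (⟨⟩C cs (⟨⟩C ce cv)))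
    (caseℕC (cops ,C justC (sndC (unpairC cx)))
      (((constC 0 ,C cs ∘C v₁ ,C ce ∘C v₁ ,C constC 0) ∷C cops ∘C v₁) ,C
        justC (⟨⟩C (fstC (unpairC cx) ∘C v₁) (sucC (sndC (unpairC cx) ∘C v₁)))) cv))))
    where
    Ctx : Set
    Ctx = List Bool × ℕ × Op × List Op
    cσ : Comp χ {Ctx} proj₁
    cσ = v₁
    cv : Comp χ {Ctx} (proj₁ ∘ proj₂)
    cv = vₖ
    cops : Comp χ {Ctx} (proj₂ ∘ proj₂ ∘ proj₂)
    cops = sndC vᵣ
    ct : Comp χ {Ctx} (λ (σ , v , (t , s , e , x) , ops) → t)
    ct = fstC (fstC vᵣ)
    cs : Comp χ {Ctx} (λ (σ , v , (t , s , e , x) , ops) → s)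
    cs = fstC (sndC (fstC vᵣ))
    ce : Comp χ {Ctx} (λ (σ , v , (t , s , e , x) , ops) → e)
    ce = fstC (sndC (sndC (fstC vᵣ)))
    cx : Comp χ {Ctx} (λ (σ , v , (t , s , e , x) , ops) → x)
    cx = sndC (sndC (sndC (fstC vᵣ)))

  transitionC : Comp χ {List Bool × State} (λ (σ , st) → transition σ st)
  transitionC = caseLC (constC [] ,C vᵣ)
    (caseMC (constC ([] , nothing))
      (executeC ∘C (fstC (fstC v₁) ,C v₂ ,C fstC (sndC v₁) ,C sndC (sndC v₁)))
      (sndC (sndC v₁)))
    (fstC v₂)

  stepsC : Comp χ {(List Bool × ℕ × ℕ × ℕ) × ℕ} (λ ((σ , s , e , x) , n) → steps σ n (start σ s e x))
  stepsC = natrecC (((constC 0 ,C fstC (sndC v₁) ,C fstC (sndC (sndC v₁)) ,C constC 0) ∷C constC []) ,C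
                    justC (sndC (sndC (sndC v₁))))
                   (transitionC ∘C (fstC (fstC v₁) ,C vᵣ)) v₂

abstract
  runC : ∀ {χ} → Comp χ {List Bool × ℕ × ℕ × ℕ} (λ (σ , s , e , x) → run σ s (decode e) x)
  runC = extC (λ (σ , s , e , x) → let ex = halting-time σ s e x in
      steps-unique σ (μ _ ex) (proj₁ (halts σ s e x)) (proj₂ (halts σ s e x)) (proj₁ (proj₂ (least _ ex))))
    (sndC (stepsC ∘C (idC ,C
      μC {p = λ ((σ , s , e , x) , n) → empty? σ (steps σ n (start σ s e x))}
         (caseLC (constC true) (constC false) (fstC stepsC))
         (λ (σ , s , e , x) → halting-time σ s e x))))

-- The construction

-- A node of the binary tree is listed with its last edge first.
Path : Set
Path = List Bool

infix 4 _⊑_ _◁_ _⊑?_ _◁?_ _≟P_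

data _⊑_ (γ : Path) : Path → Set where
  ⊑-refl : γ ⊑ γ
  ⊑-step : ∀ {b β} → γ ⊑ β → γ ⊑ b ∷ β

_◁_ : Path → Path → Set
δ ◁ β = ∃[ γ ] (true ∷ γ ⊑ δ × false ∷ γ ⊑ β)

⊑-trans : ∀ {α β γ} → α ⊑ β → β ⊑ γ → α ⊑ γ
⊑-trans p ⊑-refl     = p
⊑-trans p (⊑-step q) = ⊑-step (⊑-trans p q)

⊑-tail : ∀ {b α β} → b ∷ α ⊑ β → α ⊑ β
⊑-tail = ⊑-trans (⊑-step ⊑-refl)

⊑-length : ∀ {α β} → α ⊑ β → length α ≤ length β
⊑-length ⊑-refl     = ≤-refl
⊑-length (⊑-step p) = m≤n⇒m≤1+n (⊑-length p)

∷⋢ : ∀ {b γ} → ¬ (b ∷ γ ⊑ γ)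
∷⋢ p = <-irrefl refl (⊑-length p)

⊑-split : ∀ {γ β} → γ ⊑ β → γ ≡ β ⊎ ∃[ b ] (b ∷ γ ⊑ β)
⊑-split ⊑-refl = inj₁ refl
⊑-split (⊑-step {b} p) with ⊑-split p
... | inj₁ refl    = inj₂ (b , ⊑-refl)
... | inj₂ (c , q) = inj₂ (c , ⊑-step q)

⊑-∷⁻ : ∀ {b β γ} → β ⊑ b ∷ γ → b ∷ γ ⊑ β ⊎ β ⊑ γ
⊑-∷⁻ ⊑-refl     = inj₁ ⊑-refl
⊑-∷⁻ (⊑-step p) = inj₂ p

⊑-chain : ∀ {α α′ β} → α ⊑ β → α′ ⊑ β → α ⊑ α′ ⊎ α′ ⊑ α
⊑-chain ⊑-refl     q          = inj₂ q
⊑-chain (⊑-step p) ⊑-refl     = inj₁ (⊑-step p)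
⊑-chain (⊑-step p) (⊑-step q) = ⊑-chain p q

⊑-unique : ∀ {b c γ β} → b ∷ γ ⊑ β → c ∷ γ ⊑ β → b ≡ c
⊑-unique p q with ⊑-chain p q
... | inj₁ ⊑-refl     = refl
... | inj₁ (⊑-step r) = contradiction r ∷⋢
... | inj₂ ⊑-refl     = refl
... | inj₂ (⊑-step r) = contradiction r ∷⋢

⊑-root : ∀ η → [] ⊑ η
⊑-root []      = ⊑-refl
⊑-root (b ∷ η) = ⊑-step (⊑-root η)

⊑-compare : ∀ β η → (β ⊑ η ⊎ η ⊑ β) ⊎ (β ◁ η ⊎ η ◁ β)
⊑-compare [] η = inj₁ (inj₁ (⊑-root η))
⊑-compare (b ∷ β) η with ⊑-compare β η
... | inj₁ (inj₂ p) = inj₁ (inj₂ (⊑-step p))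
... | inj₂ (inj₁ (γ , p , q)) = inj₂ (inj₁ (γ , ⊑-step p , q))
... | inj₂ (inj₂ (γ , p , q)) = inj₂ (inj₂ (γ , p , ⊑-step q))
... | inj₁ (inj₁ p) with ⊑-split p
...   | inj₁ refl = inj₁ (inj₂ (⊑-step ⊑-refl))
...   | inj₂ (c , q) with b | c
...     | true  | true  = inj₁ (inj₁ q)
...     | false | false = inj₁ (inj₁ q)
...     | true  | false = inj₂ (inj₁ (β , ⊑-refl , q))
...     | false | true  = inj₂ (inj₂ (β , q , ⊑-refl))

◁-⊑ˡ : ∀ {α α′ β} → α ◁ β → α ⊑ α′ → α′ ◁ β
◁-⊑ˡ (γ , p , q) r = γ , ⊑-trans p r , q

◁-⊑ʳ : ∀ {α β β′} → α ◁ β → β ⊑ β′ → α ◁ β′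
◁-⊑ʳ (γ , p , q) r = γ , p , ⊑-trans q r

◁-true : ∀ {δ γ} → δ ◁ true ∷ γ → δ ◁ γ
◁-true (c , p , ⊑-step q) = c , p , q

◁-false : ∀ {δ γ} → δ ◁ false ∷ γ → true ∷ γ ⊑ δ ⊎ δ ◁ γ
◁-false (c , p , ⊑-refl)   = inj₁ p
◁-false (c , p , ⊑-step q) = inj₂ (c , p , q)

encPath-injective : ∀ (γ β : Path) → enc γ ≡ enc β → γ ≡ β
encPath-injective []      []      eq = refl
encPath-injective (b ∷ γ) (c ∷ β) eq with ⟨⟩-injective (suc-injective eq)
... | eq₂ = cong₂ _∷_ (bit b c (cong proj₁ eq₂)) (encPath-injective γ β (cong proj₂ eq₂))
  where
  bit : ∀ b c → enc b ≡ enc c → b ≡ c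
  bit true  true  _  = refl
  bit false false _  = refl
  bit true  false ()
  bit false true  ()

⊑-enc : ∀ {γ β} → γ ⊑ β → enc γ ≤ enc β
⊑-enc ⊑-refl = ≤-refl
⊑-enc (⊑-step {b} {β} p) = ≤-trans (⊑-enc p) (m≤n⇒m≤1+n (≤-trans (m≤n+m _ (enc b)) (+≤⟨⟩ (enc b) (enc β))))

_≟P_ : (γ β : Path) → Dec (γ ≡ β)
γ ≟P β = map′ (encPath-injective γ β) (cong enc) (enc γ ≟ enc β)

_⊑?_ : ∀ γ β → Dec (γ ⊑ β)
γ ⊑? []      = map′ (λ { refl → ⊑-refl }) (λ { ⊑-refl → refl }) (γ ≟P [])
γ ⊑? (b ∷ β) = map′ (λ { (inj₁ refl) → ⊑-refl ; (inj₂ p) → ⊑-step p })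
                    (λ { ⊑-refl → inj₁ refl ; (⊑-step p) → inj₂ p })
                    ((γ ≟P b ∷ β) ⊎-dec (γ ⊑? β))

_◁?_ : ∀ δ β → Dec (δ ◁ β)
δ ◁? []          = no λ { (_ , _ , ()) }
δ ◁? (true ∷ β)  = map′ (λ (γ , p , q) → γ , p , ⊑-step q) ◁-true (δ ◁? β)
δ ◁? (false ∷ β) = map′ (λ { (inj₁ p) → β , p , ⊑-refl ; (inj₂ (γ , p , q)) → γ , p , ⊑-step q })
                        ◁-false ((true ∷ β ⊑? δ) ⊎-dec (δ ◁? β))

gate : Path → Maybe Path
gate = recL nothing (λ b γ g → if b then just γ else g)

gate-⊑ : ∀ γ {g} → gate γ ≡ just g → true ∷ g ⊑ γ
gate-⊑ (true ∷ γ)  refl = ⊑-refl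
gate-⊑ (false ∷ γ) eq   = ⊑-step (gate-⊑ γ eq)

gate-just : ∀ {γ x} → true ∷ γ ⊑ x → ∃[ g ] (gate x ≡ just g × (g ≡ γ ⊎ true ∷ γ ⊑ g))
gate-just ⊑-refl = _ , refl , inj₁ refl
gate-just (⊑-step {true} p)  = _ , refl , inj₂ p
gate-just (⊑-step {false} p) = gate-just p

-- A move (g , b , z) sends the ball z launched at stage b to the gate g, or into A if g is `nothing`.
-- The event of a stage consists of the last node visited and of the move, if any.
Move Event History : Set
Move    = Maybe Path × ℕ × ℕ
Event   = Path × Maybe Move
History = List Event

entersAs : ℕ → Maybe Move → Bool
entersAs z = caseM false (λ (g , _ , x) → caseM (does (x ≟ z)) (λ _ → false) g)

arrivesAt : Path → Maybe Move → Maybe (ℕ × ℕ)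
arrivesAt γ = caseM nothing (λ (g , b , z) → caseM nothing (λ g → if does (g ≟P γ) then just (b , z) else nothing) g)

inA : History → ℕ → Bool
inA h z = recL false (λ (_ , m) _ r → entersAs z m ∨ r) h

-- One slot per gate is enough: a ball arrives at `γ` during a walk through `true ∷ γ`, and such a
-- walk gets past `γ` only if the gate is empty. The arrival takes precedence over the emptying of
-- the gate by the same visit.
ballAt : History → Path → Maybe (ℕ × ℕ)
ballAt h γ = recL nothing
  (λ (δ , m) _ r → if does (δ ◁? γ) then nothing else
                   caseM (if does (true ∷ γ ⊑? δ) then nothing else r) just (arrivesAt γ m)) h

-- The first stage after the last one at which the node visited satisfies p; 0 if there is none.
lastStage : (Path → Bool) → History → ℕ
lastStage p = recL 0 (λ (δ , _) h r → if p δ then suc (length h) else r)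

lastVisit restraint : History → Path → ℕ
lastVisit h γ = lastStage (λ δ → does (γ ⊑? δ)) h
restraint h γ = lastStage (λ δ → does (δ ◁? γ)) h

module Construction (W? : ℕ → ℕ → ℕ → Bool) (R : ℕ → ℕ → List Bool → Bool) where

  opaque
    -- `lastVisit` is one more than the stage of the last visit, so that the bound includes the `y`
    -- equal to that stage; before the first visit nothing is asked.
    evidence : History → Path → Bool
    evidence h γ = allB (lastVisit h (true ∷ γ)) (λ y → R (length γ) y (applyUpTo (inA h) (length h)))

  -- The node β believes in the evidence at y ≤ enc β, and launches no z that could destroy it.
  respects : History → Path → ℕ → Bool
  respects h β z = recL true
    (λ b γ r → (if b then allB (suc (enc β)) (λ y → R (length γ) y (applyUpTo (inA h) z)) else true) ∧ r) β

  satisfied : History → ℕ → Bool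
  satisfied h n = anyB (length h) (λ x → W? n (length h) x ∧ inA h x)

  -- The restraint protects what was seen at visits to the left, `respects` what the node itself
  -- believes, and the bound by twice the code thins out `A`.
  eligible : History → Path → ℕ → Bool
  eligible h γ z = W? (length γ) (length h) z ∧ does (restraint h γ ≤? z) ∧ does (enc γ + enc γ <? z) ∧ respects h γ z

  opaque
    -- A node keeps no record of its balls. It is reached again only when its last ball has entered
    -- `A` or has been cancelled, because all gates above it must then be empty.
    pick : History → Path → Maybe ℕ
    pick h γ = if satisfied h (length γ) then nothing else findB (length h) (eligible h γ)

  descend : History → Event → Event
  descend h (γ , m) = caseM
    (caseM (if evidence h γ
            then caseM (true ∷ γ , nothing) (λ ball → true ∷ γ , just (gate γ , ball)) (ballAt h γ)
            else (false ∷ γ , nothing))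
           (λ z → γ , just (gate γ , length h , z))
           (pick h γ))
    (λ m → γ , just m) m

  walk : History → ℕ → Event
  walk h = natrec ([] , nothing) (λ _ → descend h)

  data Reached (h : History) : Path → Set where
    root : Reached h []
    goˡ  : ∀ {γ} → Reached h γ → pick h γ ≡ nothing → evidence h γ ≡ true → ballAt h γ ≡ nothing →
        Reached h (true ∷ γ)
    goʳ  : ∀ {γ} → Reached h γ → pick h γ ≡ nothing → evidence h γ ≡ false → Reached h (false ∷ γ)

  data Outcome (h : History) (k : ℕ) : Event → Set where
    wait   : ∀ {γ} → Reached h γ → length γ ≡ k → Outcome h k (γ , nothing)
    launch : ∀ {γ z} → Reached h γ → pick h γ ≡ just z → Outcome h k (γ , just (gate γ , length h , z))
    fall   : ∀ {γ ball} → Reached h γ → pick h γ ≡ nothing → evidence h γ ≡ true → ballAt h γ ≡ just ball →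
             Outcome h k (true ∷ γ , just (gate γ , ball))

  walk-outcome : ∀ h k → Outcome h k (walk h k)
  walk-outcome h zero = wait root refl
  walk-outcome h (suc k) with walk h k | walk-outcome h k
  ... | .(_ , just _) | launch r p = launch r p
  ... | .(_ , just _) | fall r p e b = fall r p e b
  ... | .(γ , nothing) | wait {γ} r l with pick h γ in p
  ...   | just z = launch r p
  ...   | nothing with evidence h γ in e
  ...     | false = wait (goʳ r p e) (cong suc l)
  ...     | true with ballAt h γ in b
  ...       | nothing   = wait (goˡ r p e b) (cong suc l)
  ...       | just ball = fall r p e b

  reached-true : ∀ {h γ δ} → Reached h δ → true ∷ γ ⊑ δ → pick h γ ≡ nothing × evidence h γ ≡ true ×
      ballAt h γ ≡ nothing
  reached-true (goˡ r p e b) ⊑-refl     = p , e , b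
  reached-true (goˡ r _ _ _) (⊑-step q) = reached-true r q
  reached-true (goʳ r _ _)   (⊑-step q) = reached-true r q

  reached-false : ∀ {h γ δ} → Reached h δ → false ∷ γ ⊑ δ → pick h γ ≡ nothing × evidence h γ ≡ false
  reached-false (goʳ r p e)   ⊑-refl     = p , e
  reached-false (goˡ r _ _ _) (⊑-step q) = reached-false r q
  reached-false (goʳ r _ _)   (⊑-step q) = reached-false r q

  opaque
    history : ℕ → History
    history = natrec [] (λ _ h → walk h (length h) ∷ h)

    δ : ℕ → Path
    δ s = proj₁ (walk (history s) (length (history s)))

    move : ℕ → Maybe Move
    move s = proj₂ (walk (history s) (length (history s)))

    length-history : ∀ s → length (history s) ≡ s
    length-history zero    = refl
    length-history (suc s) = cong suc (length-history s)

    outcome : ∀ s → Outcome (history s) s (δ s , move s)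
    outcome s = subst (λ k → Outcome (history s) k (walk (history s) (length (history s)))) (length-history s)
                      (walk-outcome (history s) (length (history s)))

  Fallen : History → Event → Path → ℕ × ℕ → Set
  Fallen h (d , m) γ ball = d ≡ true ∷ γ × m ≡ just (gate γ , ball) × ballAt h γ ≡ just ball

  outcome-true : ∀ {h k e γ} → Outcome h k e → true ∷ γ ⊑ proj₁ e → pick h γ ≡ nothing × evidence h γ ≡ true ×
                 (ballAt h γ ≡ nothing ⊎ ∃[ ball ] Fallen h e γ ball)
  outcome-true (wait r _)   v = let p , e , b = reached-true r v in p , e , inj₁ b
  outcome-true (launch r _) v = let p , e , b = reached-true r v in p , e , inj₁ b
  outcome-true (fall r p e b) ⊑-refl     = p , e , inj₂ (_ , refl , refl , b)
  outcome-true (fall r _ _ _) (⊑-step v) = let p , e , b = reached-true r v in p , e , inj₁ b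

  outcome-false : ∀ {h k e γ} → Outcome h k e → false ∷ γ ⊑ proj₁ e → pick h γ ≡ nothing × evidence h γ ≡ false
  outcome-false (wait r _)     v          = reached-false r v
  outcome-false (launch r _)   v          = reached-false r v
  outcome-false (fall r _ _ _) (⊑-step v) = reached-false r v

  Launched : History → Event → ℕ → Set
  Launched h (d , m) z = m ≡ just (gate d , length h , z) × pick h d ≡ just z

  data Source (h : History) (e : Event) (g : Maybe Path) (b z : ℕ) : Set where
    launched : g ≡ gate (proj₁ e) → b ≡ length h → Launched h e z → Source h e g b z
    fallen  : ∀ γ → g ≡ gate γ → Fallen h e γ (b , z) → evidence h γ ≡ true → Source h e g b z

  outcome-source : ∀ {h k d g b z} → Outcome h k (d , just (g , b , z)) → Source h (d , just (g , b , z)) g b z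
  outcome-source (launch r p)         = launched refl refl (refl , p)
  outcome-source (fall {γ} r p e b) = fallen γ refl (refl , refl , b) e

  data Stop (h : History) (k : ℕ) (e : Event) : Path → Set where
    short  : ∀ {γ} → length γ ≡ k → Stop h k e γ
    launch : ∀ {γ z} → Launched h e z → Stop h k e γ
    fall   : ∀ {γ ball} → Fallen h e γ ball → Stop h k e (true ∷ γ)

  outcome-stop : ∀ {h k e} → Outcome h k e → Stop h k e (proj₁ e)
  outcome-stop (wait r l)     = short l
  outcome-stop (launch r p)   = launch (refl , p)
  outcome-stop (fall r p e b) = fall (refl , refl , b)

-- Balls and visits

does⇒ : ∀ {P : Set} (d : Dec P) → does d ≡ true → P
does⇒ (yes p) _ = p

∧-true : ∀ {a b} → a ∧ b ≡ true → a ≡ true × b ≡ true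
∧-true {true} eq = refl , eq

∨-true : ∀ {a b} → a ∨ b ≡ true → a ≡ true ⊎ b ≡ true
∨-true {true}  eq = inj₁ refl
∨-true {false} eq = inj₂ eq

∨-introʳ : ∀ a {b} → b ≡ true → a ∨ b ≡ true
∨-introʳ true  _  = refl
∨-introʳ false eq = eq

≢true : ∀ {b} → ¬ (b ≡ true) → b ≡ false
≢true {true}  h = contradiction refl h
≢true {false} h = refl

allB-elim : ∀ n p → allB n p ≡ true → ∀ {k} → k < n → p k ≡ true
allB-elim (suc n) p eq {k} (s≤s k≤n) with m≤n⇒m<n∨m≡n k≤n | ∧-true {p n} eq
... | inj₁ k<n  | _ , q = allB-elim n p q k<n
... | inj₂ refl | q , _ = q

allB-intro : ∀ n p → (∀ {k} → k < n → p k ≡ true) → allB n p ≡ true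
allB-intro zero    p h = refl
allB-intro (suc n) p h rewrite h (n<1+n n) = allB-intro n p (λ k<n → h (m<n⇒m<1+n k<n))

anyB-elim : ∀ n p → anyB n p ≡ true → ∃[ k ] (k < n × p k ≡ true)
anyB-elim (suc n) p eq with ∨-true {p n} eq
... | inj₁ q = n , n<1+n n , q
... | inj₂ q = let k , k<n , r = anyB-elim n p q in k , m<n⇒m<1+n k<n , r

anyB-intro : ∀ n p {k} → k < n → p k ≡ true → anyB n p ≡ true
anyB-intro (suc n) p (s≤s k≤n) eq with m≤n⇒m<n∨m≡n k≤n
... | inj₁ k<n            = ∨-introʳ (p n) (anyB-intro n p k<n eq)
anyB-intro (suc n) p _ eq | inj₂ refl = subst (λ b → b ∨ anyB n p ≡ true) (sym eq) refl

findB-just : ∀ n {p k} → findB n p ≡ just k → k < n × p k ≡ true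
findB-just (suc n) {p} eq with findB n p in f | p n in q
findB-just (suc n) refl | just k  | _    = let k<n , r = findB-just n f in m<n⇒m<1+n k<n , r
findB-just (suc n) refl | nothing | true = n<1+n n , q

findB-nothing : ∀ n {p} → findB n p ≡ nothing → ∀ {k} → k < n → p k ≡ false
findB-nothing (suc n) {p} eq {k} (s≤s k≤n) with findB n p in f | p n in q | m≤n⇒m<n∨m≡n k≤n
... | nothing | false | inj₁ k<n  = findB-nothing n f k<n
... | nothing | false | inj₂ refl = q

InfinitelyOften : (ℕ → Set) → Set
InfinitelyOften P = ∀ n → ∃[ s ] (n ≤ s × P s)

Eventually : (ℕ → Set) → Set
Eventually P = ∃[ n ] (∀ {s} → n ≤ s → P s)

Eventually-× : ∀ {P Q} → Eventually P → Eventually Q → Eventually (λ s → P s × Q s)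
Eventually-× (m , p) (n , q) = m ⊔ n , λ h → p (≤-trans (m≤m⊔n m n) h) , q (≤-trans (m≤n⊔m m n) h)

Eventually-∀< : ∀ {P : ℕ → ℕ → Set} → (∀ c → Eventually (P c)) → ∀ n → Eventually (λ s → ∀ {c} → c < n → P c s)
Eventually-∀< p zero    = 0 , λ _ ()
Eventually-∀< p (suc n) =
  let m , h = Eventually-× (p n) (Eventually-∀< p n)
  in m , λ q {c} → λ { (s≤s c≤n) → [ proj₂ (h q) , (λ { refl → proj₁ (h q) }) ]′ (m≤n⇒m<n∨m≡n c≤n) }

Eventually-⊆ : ∀ {P Q : ℕ → Set} → (∀ {s} → P s → Q s) → Eventually P → Eventually Q
Eventually-⊆ f (m , p) = m , λ h → f (p h)

module Classical (em : ExcludedMiddle 0ℓ) where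

  ¬∀⇒∃¬ : ∀ {A : Set} {P : A → Set} → ¬ (∀ x → P x) → ∃[ x ] ¬ P x
  ¬∀⇒∃¬ {P = P} h with em {∃[ x ] ¬ P x}
  ... | yes e = e
  ... | no ¬e = contradiction (λ x → case em {P x} of λ { (yes p) → p ; (no ¬p) → contradiction (x , ¬p) ¬e }) h

  infinitely-or-never : ∀ (P : ℕ → Set) → InfinitelyOften P ⊎ Eventually (λ s → ¬ P s)
  infinitely-or-never P with em {InfinitelyOften P}
  ... | yes i = inj₁ i
  ... | no ¬i = let n , h = ¬∀⇒∃¬ ¬i in inj₂ (n , λ {s} n≤s p → h (s , n≤s , p))

  first : ∀ (P : ℕ → Set) n {s} → n ≤ s → P s → ∃[ t ] (n ≤ t × t ≤ s × P t × (∀ {u} → n ≤ u → u < t → ¬ P u))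
  first P n {s} n≤s p = go (s ∸ n) n (m∸n+n≡m n≤s)
    where
    go : ∀ k n → k + n ≡ s → ∃[ t ] (n ≤ t × t ≤ s × P t × (∀ {u} → n ≤ u → u < t → ¬ P u))
    go k n eq with em {P n}
    ... | yes q = n , ≤-refl , subst (n ≤_) eq (m≤n+m n k) , q , λ n≤u u<n → contradiction u<n (≤⇒≯ n≤u)
    go zero    n refl | no ¬q = contradiction p ¬q
    go (suc k) n eq   | no ¬q with go k (suc n) (trans (+-suc k n) eq)
    ... | t , n<t , t≤s , q , below = t , <⇒≤ n<t , t≤s , q , λ {u} n≤u u<t →
      [ (λ n<u → below n<u u<t) , (λ { refl → ¬q }) ]′ (m≤n⇒m<n∨m≡n n≤u)

  char : (ℕ → Set) → ℕ → Bool
  char A n = does (em {A n})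

◁-⋢ : ∀ {δ γ} → δ ◁ γ → ¬ (γ ⊑ δ)
◁-⋢ (c , p , q) r with ⊑-unique p (⊑-trans q r)
... | ()

◁-⋣ : ∀ {γ δ} → γ ◁ δ → ¬ (γ ⊑ δ)
◁-⋣ (c , p , q) r with ⊑-unique (⊑-trans p r) q
... | ()

⊑-or-right : ∀ β {g} → ¬ (true ∷ g ⊑ β) → ¬ (β ◁ true ∷ g) → β ⊑ g ⊎ true ∷ g ◁ β
⊑-or-right β {g} ¬p ¬l with ⊑-compare β (true ∷ g)
... | inj₁ (inj₁ ⊑-refl)     = contradiction ⊑-refl ¬p
... | inj₁ (inj₁ (⊑-step q)) = inj₁ q
... | inj₁ (inj₂ p)          = contradiction p ¬p
... | inj₂ (inj₁ l)          = contradiction l ¬l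
... | inj₂ (inj₂ r)          = inj₂ r

entersAs-sound : ∀ z m → entersAs z m ≡ true → ∃[ b ] (m ≡ just (nothing , b , z))
entersAs-sound z (just (nothing , b , x)) eq = b , cong (λ x → just (nothing , b , x)) (does⇒ (x ≟ z) eq)

arrivesAt-sound : ∀ γ m {ball} → arrivesAt γ m ≡ just ball → m ≡ just (just γ , ball)
arrivesAt-sound γ (just (just g , ball)) eq with does (g ≟P γ) in d
arrivesAt-sound γ (just (just g , ball)) refl | true = cong (λ g → just (just g , ball)) (does⇒ (g ≟P γ) d)

arrivesAt-complete : ∀ γ ball → arrivesAt γ (just (just γ , ball)) ≡ just ball
arrivesAt-complete γ ball rewrite dec-true (γ ≟P γ) refl = refl

module Dynamics (W? : ℕ → ℕ → ℕ → Bool) (R : ℕ → ℕ → List Bool → Bool) where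

  open Construction W? R public

  A[_] : ℕ → ℕ → Bool
  A[ s ] = inA (history s)

  Enters : ℕ → ℕ → ℕ → Set
  Enters s b z = move s ≡ just (nothing , b , z)

  opaque
    unfolding history δ move
    A-sound : ∀ s {z} → A[ s ] z ≡ true → ∃[ t ] (t < s × ∃[ b ] Enters t b z)
    A-sound (suc s) {z} eq with ∨-true {entersAs z (move s)} eq
    ... | inj₁ p = s , n<1+n s , entersAs-sound z (move s) p
    ... | inj₂ p = let t , t<s , e = A-sound s p in t , m<n⇒m<1+n t<s , e

    A-complete : ∀ {s t b z} → t < s → Enters t b z → A[ s ] z ≡ true
    A-complete {suc s} {t} {b} {z} (s≤s t≤s) e with m≤n⇒m<n∨m≡n t≤s
    ... | inj₁ t<s  = ∨-introʳ (entersAs z (move s)) (A-complete t<s e)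
    ... | inj₂ refl = subst (λ m → entersAs z m ∨ A[ s ] z ≡ true) (sym e)
                        (cong (_∨ A[ s ] z) (dec-true (z ≟ z) refl))

  A-mono : ∀ {s t z} → s ≤ t → A[ s ] z ≡ true → A[ t ] z ≡ true
  A-mono {s} s≤t eq = let u , u<s , b , e = A-sound s eq in A-complete (<-≤-trans u<s s≤t) e

  -- Only the visits excluded here can change what waits at the gate `γ`; arrivals are among them by
  -- `move-visits`.
  Quiet : Path → ℕ → ℕ → Set
  Quiet γ s t = ∀ {u} → s < u → u < t → ¬ (true ∷ γ ⊑ δ u) × ¬ (δ u ◁ γ)

  visit-true : ∀ {t γ} → true ∷ γ ⊑ δ t → pick (history t) γ ≡ nothing × evidence (history t) γ ≡ true ×
               (ballAt (history t) γ ≡ nothing ⊎ ∃[ ball ] Fallen (history t) (δ t , move t) γ ball)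
  visit-true {t} = outcome-true (outcome t)

  visit-false : ∀ {t γ} → false ∷ γ ⊑ δ t → pick (history t) γ ≡ nothing × evidence (history t) γ ≡ false
  visit-false {t} = outcome-false (outcome t)

  move-source : ∀ {t g b z} → move t ≡ just (g , b , z) → Source (history t) (δ t , move t) g b z
  move-source {t} eq = subst (λ m → Source (history t) (δ t , m) _ _ _) (sym eq)
    (outcome-source (subst (λ m → Outcome (history t) t (δ t , m)) eq (outcome t)))

  -- A launching node lies below the true edge of the gate it sends to, and so does the node at
  -- which a fall ends. Hence an arrival counts as a visit, and the evidence that later opens the
  -- gate has to cover the stage of arrival.
  move-visits : ∀ {t g ball} → move t ≡ just (just g , ball) → true ∷ g ⊑ δ t
  move-visits {t} eq with move-source {t} eq
  ... | launched p _ _           = gate-⊑ (δ t) (sym p)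
  ... | fallen γ p (q , _) _ = subst (_ ⊑_) (sym q) (⊑-step (gate-⊑ γ (sym p)))

  opaque
    unfolding history δ move
    ballAt-arrival : ∀ s {γ ball} → ballAt (history s) γ ≡ just ball →
                     ∃[ t ] (t < s × move t ≡ just (just γ , ball) × Quiet γ t s)
    ballAt-arrival (suc s) {γ} {ball} eq = go (δ s ◁? γ) (true ∷ γ ⊑? δ s) (arrivesAt γ (move s)) refl eq
      where
      go : (d : Dec (δ s ◁ γ)) (v : Dec (true ∷ γ ⊑ δ s)) (a : Maybe (ℕ × ℕ)) → arrivesAt γ (move s) ≡ a →
           (if does d then nothing else caseM (if does v then nothing else ballAt (history s) γ) just a) ≡ just ball →
           ∃[ t ] (t < suc s × move t ≡ just (just γ , ball) × Quiet γ t (suc s))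
      go (no _) _ (just _) e refl = s , n<1+n s , arrivesAt-sound γ (move s) e , λ s<u u<1+s →
          contradiction (<-≤-trans u<1+s s<u) (<-irrefl refl)
      go (no d) (no v) nothing e eq with ballAt-arrival s eq
      ... | t , t<s , m , quiet = t , m<n⇒m<1+n t<s , m , λ {u} t<u → λ { (s≤s u≤s) →
        [ quiet t<u , (λ { refl → v , d }) ]′ (m≤n⇒m<n∨m≡n u≤s) }

    ballAt-persists : ∀ {t s γ ball} → move t ≡ just (just γ , ball) → t < s → Quiet γ t s →
        ballAt (history s) γ ≡ just ball
    ballAt-persists {t} {suc s} {γ} {ball} m (s≤s t≤s) quiet with m≤n⇒m<n∨m≡n t≤s
    ... | inj₂ refl rewrite dec-false (δ t ◁? γ) (λ d → ◁-⋢ d (⊑-tail (move-visits {t} m)))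
                          | m | arrivesAt-complete γ ball = refl
    ... | inj₁ t<s rewrite dec-false (δ s ◁? γ) (proj₂ (quiet t<s (n<1+n s)))
                         | dec-false (true ∷ γ ⊑? δ s) (proj₁ (quiet t<s (n<1+n s))) =
        subst (λ a → caseM (ballAt (history s) γ) just a ≡ just ball) (sym (absent (arrivesAt γ (move s)) refl))
              (ballAt-persists m t<s λ t<u u<s → quiet t<u (m<n⇒m<1+n u<s))
      where
      absent : ∀ a → arrivesAt γ (move s) ≡ a → a ≡ nothing
      absent nothing  _ = refl
      absent (just _) e = contradiction (move-visits {s} (arrivesAt-sound γ (move s) e)) (proj₁ (quiet t<s (n<1+n s)))

    lastStage-> : ∀ p {s t} → t < s → p (δ t) ≡ true → t < lastStage p (history s)
    lastStage-> p {suc s} {t} (s≤s t≤s) eq with m≤n⇒m<n∨m≡n t≤s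
    ... | inj₂ refl = subst (λ b → t < (if b then suc (length (history t)) else lastStage p (history t))) (sym eq)
                        (s≤s (≤-reflexive (sym (length-history t))))
    ... | inj₁ t<s with p (δ s)
    ...   | true  = s≤s (≤-trans t≤s (≤-reflexive (sym (length-history s))))
    ...   | false = lastStage-> p t<s eq

    lastStage-≤ : ∀ p {n} s → (∀ {t} → n ≤ t → ¬ (p (δ t) ≡ true)) → lastStage p (history s) ≤ n
    lastStage-≤ p zero    h = z≤n
    lastStage-≤ p {n} (suc s) h with p (δ s) in eq
    ... | true  = ≰⇒> λ n≤l → h (subst (n ≤_) (length-history s) n≤l) eq
    ... | false = lastStage-≤ p s h

  lastVisit-> : ∀ {s t γ} → t < s → γ ⊑ δ t → t < lastVisit (history s) γ
  lastVisit-> {t = t} {γ} t<s v = lastStage-> _ t<s (dec-true (γ ⊑? δ t) v)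

  lastVisit-≤ : ∀ {n γ} s → (∀ {t} → n ≤ t → ¬ (γ ⊑ δ t)) → lastVisit (history s) γ ≤ n
  lastVisit-≤ {γ = γ} s h = lastStage-≤ _ s λ {t} n≤t eq → h n≤t (does⇒ (γ ⊑? δ t) eq)

  restraint-> : ∀ {s t γ} → t < s → δ t ◁ γ → t < restraint (history s) γ
  restraint-> {t = t} {γ} t<s v = lastStage-> _ t<s (dec-true (δ t ◁? γ) v)

  restraint-≤ : ∀ {n γ} s → (∀ {t} → n ≤ t → ¬ (δ t ◁ γ)) → restraint (history s) γ ≤ n
  restraint-≤ {γ = γ} s h = lastStage-≤ _ s λ {t} n≤t eq → h n≤t (does⇒ (δ t ◁? γ) eq)

  opaque
    unfolding evidence
    evidence-elim : ∀ {s t y γ} → evidence (history s) γ ≡ true → t < s → true ∷ γ ⊑ δ t → y ≤ t →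
                    R (length γ) y (applyUpTo A[ s ] s) ≡ true
    evidence-elim {s} {t} {y} {γ} e t<s v y≤t = subst (λ n → R (length γ) y (applyUpTo A[ s ] n) ≡ true)
        (length-history s)
      (allB-elim _ (λ y → R (length γ) y (applyUpTo A[ s ] (length (history s)))) e
          (≤-<-trans y≤t (lastVisit-> t<s v)))

  opaque
    unfolding evidence
    evidence-intro : ∀ {n s γ} → lastVisit (history s) (true ∷ γ) ≤ n →
                     (∀ {y} → y < n → R (length γ) y (applyUpTo A[ s ] s) ≡ true) → evidence (history s) γ ≡ true
    evidence-intro {n} {s} {γ} l h = allB-intro (lastVisit (history s) (true ∷ γ))
        (λ y → R (length γ) y (applyUpTo A[ s ] (length (history s)))) λ {y} y< →
      subst (λ k → R (length γ) y (applyUpTo A[ s ] k) ≡ true) (sym (length-history s)) (h (<-≤-trans y< l))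

  record Picked (s : ℕ) (β : Path) (z : ℕ) : Set where
    field
      inside    : W? (length β) s z ≡ true
      bounded   : z < s
      restr     : restraint (history s) β ≤ z
      large     : enc β + enc β < z
      respected : ∀ {γ y} → true ∷ γ ⊑ β → y ≤ enc β → R (length γ) y (applyUpTo A[ s ] z) ≡ true

  respects-elim : ∀ (f : ℕ → ℕ → Bool) n β →
      recL true (λ b γ r → (if b then allB n (f (length γ)) else true) ∧ r) β ≡ true →
                  ∀ {γ y} → true ∷ γ ⊑ β → y < n → f (length γ) y ≡ true
  respects-elim f n (true ∷ β) eq ⊑-refl y<n = allB-elim n (f (length β)) (proj₁ (∧-true eq)) y<n
  respects-elim f n (b ∷ β) eq (⊑-step p) y<n =
    respects-elim f n β (proj₂ (∧-true {if b then allB n (f (length β)) else true} eq)) p y<n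

  respects-intro : ∀ (f : ℕ → ℕ → Bool) n β → (∀ {γ y} → true ∷ γ ⊑ β → y < n → f (length γ) y ≡ true) →
                   recL true (λ b γ r → (if b then allB n (f (length γ)) else true) ∧ r) β ≡ true
  respects-intro f n []          h = refl
  respects-intro f n (true ∷ β)  h rewrite allB-intro n (f (length β)) (h ⊑-refl) = respects-intro f n β (h ∘ ⊑-step)
  respects-intro f n (false ∷ β) h = respects-intro f n β (h ∘ ⊑-step)

  eligible-elim : ∀ {s β z} → z < s → eligible (history s) β z ≡ true → Picked s β z
  eligible-elim {s} {β} {z} lt eq with ∧-true {W? (length β) (length (history s)) z} eq
  ... | w , eq₁ with ∧-true {does (restraint (history s) β ≤? z)} eq₁
  ... | r , eq₂ with ∧-true {does (enc β + enc β <? z)} eq₂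
  ... | l , eq₃ = record
    { inside    = subst (λ n → W? (length β) n z ≡ true) (length-history s) w
    ; bounded   = lt
    ; restr     = does⇒ (restraint (history s) β ≤? z) r
    ; large     = does⇒ (enc β + enc β <? z) l
    ; respected = λ p y≤c → respects-elim (λ n y → R n y (applyUpTo A[ s ] z)) (suc (enc β)) β eq₃ p (s≤s y≤c)
    }

  eligible-intro : ∀ {s β z} → Picked s β z → eligible (history s) β z ≡ true
  eligible-intro {s} {β} {z} p rewrite length-history s | Picked.inside p
    | dec-true (restraint (history s) β ≤? z) (Picked.restr p)
    | dec-true (enc β + enc β <? z) (Picked.large p)
    = respects-intro (λ n y → R n y (applyUpTo A[ s ] z)) (suc (enc β)) β
        (λ q y<1+c → Picked.respected p q (s≤s⁻¹ y<1+c))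

  opaque
    unfolding pick
    pick-sound : ∀ {s β z} → pick (history s) β ≡ just z → Picked s β z × satisfied (history s) (length β) ≡ false
    pick-sound {s} {β} {z} eq with satisfied (history s) (length β)
    ... | false = let z<l , e = findB-just (length (history s)) eq in
                  eligible-elim (subst (z <_) (length-history s) z<l) e , refl

    pick-complete : ∀ {s β z} → pick (history s) β ≡ nothing → Picked s β z → satisfied (history s) (length β) ≡ true
    pick-complete {s} {β} {z} eq p with satisfied (history s) (length β)
    ... | true  = refl
    ... | false with trans (sym (eligible-intro p))
                     (findB-nothing (length (history s)) eq
                         (subst (z <_) (sym (length-history s)) (Picked.bounded p)))
    ...   | ()

  satisfied-elim : ∀ {s n} → satisfied (history s) n ≡ true → ∃[ x ] (W? n s x ≡ true × A[ s ] x ≡ true)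
  satisfied-elim {s} {n} eq with anyB-elim (length (history s)) (λ x → W? n (length (history s)) x ∧ A[ s ] x) eq
  ... | x , _ , e with ∧-true {W? n (length (history s)) x} e
  ... | w , a = x , subst (λ k → W? n k x ≡ true) (length-history s) w , a

  satisfied-intro : ∀ {s n x} → x < s → W? n s x ≡ true → A[ s ] x ≡ true → satisfied (history s) n ≡ true
  satisfied-intro {s} {n} {x} x<s w a rewrite length-history s = anyB-intro s (λ x → W? n s x ∧ A[ s ] x) x<s
      (trans (cong (_∧ A[ s ] x) w) a)

  -- The itinerary of a ball: sent below x at stage t, it reaches the gate g at stage s.
  Hop : ℕ → Path → ℕ → Set
  Hop t g u = t < u × δ u ≡ true ∷ g × Quiet g t u × evidence (history u) g ≡ true

  data Flight (b z : ℕ) (t : ℕ) (x : Path) (s : ℕ) : Maybe Path → Set where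
    here : ∀ {g} → t ≡ s → g ≡ gate x → Flight b z t x s g
    hop  : ∀ {g g′ u} → gate x ≡ just g → Hop t g u → move u ≡ just (gate g , b , z) →
           Flight b z u g s g′ → Flight b z t x s g′

  Flight-≤ : ∀ {b z t x s g} → Flight b z t x s g → t ≤ s
  Flight-≤ (here refl _)           = ≤-refl
  Flight-≤ (hop _ (t<u , _) _ f) = ≤-trans (<⇒≤ t<u) (Flight-≤ f)

  Flight-∷ʳ : ∀ {b z t x s g u} → Flight b z t x s (just g) → Hop s g u → move u ≡ just (gate g , b , z) →
              Flight b z t x u (gate g)
  Flight-∷ʳ (here refl e)  h m = hop (sym e) h m (here refl refl)
  Flight-∷ʳ (hop e k n f) h m = hop e k n (Flight-∷ʳ f h m)

  Launch : ℕ → ℕ → Set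
  Launch b z = move b ≡ just (gate (δ b) , b , z) × pick (history b) (δ b) ≡ just z

  -- A waiting ball carries the stage of its launch but not its way; the way is recovered backwards,
  -- from each arrival to the one before.
  trace : ∀ {s g b z} → move s ≡ just (g , b , z) → Launch b z × Flight b z b (δ b) s g
  trace {s} = <-rec (λ s → ∀ {g b z} → move s ≡ just (g , b , z) → Launch b z × Flight b z b (δ b) s g) step s
    where
    step : ∀ s → (∀ {t} → t < s → ∀ {g b z} → move t ≡ just (g , b , z) → Launch b z × Flight b z b (δ b) t g) →
           ∀ {g b z} → move s ≡ just (g , b , z) → Launch b z × Flight b z b (δ b) s g
    step s ih m with move-source {s} m
    ... | launched refl b≡l (m′ , p) with trans b≡l (length-history s)
    ...   | refl = (m , subst (λ z → _ ≡ just z) (cong (proj₂ ∘ proj₂) (just-injective (trans (sym m′) m))) p)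
        , here refl refl
    step s ih m | fallen γ refl (eqδ , _ , at) e with ballAt-arrival s at
    ... | t , t<s , m′ , quiet = let l , f = ih t<s m′ in l , Flight-∷ʳ f (t<s , eqδ , quiet , e) m

  -- Between launch and entry a ball is always waiting somewhere. Since `true ∷ h ⊑ x`, the gate
  -- found here relates later visits to the position of the launching node.
  locate : ∀ {b z t x s g u} → Flight b z t x s g → t < u → u ≤ s →
           ∃₂ λ v h → ∃[ w ] (v < u × u ≤ w × Hop v h w × true ∷ h ⊑ x × move w ≡ just (gate h , b , z) ×
               Flight b z w h s g)
  locate (here refl _) t<u u≤s = contradiction (<-≤-trans t<u u≤s) (<-irrefl refl)
  locate {x = x} {u = u} (hop {u = w} e k m f) t<u u≤s with u ≤? w
  ... | yes u≤w = _ , _ , w , t<u , u≤w , k , gate-⊑ x e , m , f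
  ... | no u≰w = let v , h , w′ , p , q , r , below , rest = locate f (≰⇒> u≰w) u≤s
                 in v , h , w′ , p , q , r , ⊑-trans (⊑-step below) (gate-⊑ x e) , rest

  through : ∀ {b z t x s γ} → move t ≡ just (gate x , b , z) → Flight b z t x s nothing → true ∷ γ ⊑ x →
            ∃₂ λ v w → t ≤ v × move v ≡ just (just γ , b , z) × Hop v γ w × w ≤ s
  through m (here _ e) p with gate-just p
  ... | _ , q , _ with trans e q
  ...   | ()
  through m (hop e k n f) p with gate-just p
  ... | g , q , r with just-injective (trans (sym e) q)
  through m (hop e k n f) p | g , q , inj₁ refl | refl =
      _ , _ , ≤-refl , trans m (cong (λ g → just (g , _)) e) , k , Flight-≤ f
  through m (hop e k n f) p | g , q , inj₂ r    | refl =
    let v , w , u≤v , rest = through n f r in v , w , ≤-trans (<⇒≤ (proj₁ k)) u≤v , rest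

  -- A visit to true ∷ g cancels the balls launched above it or to its right.
  kill : ∀ {b z s t g} → Flight b z b (δ b) s nothing → b < t → t ≤ s → true ∷ g ⊑ δ t →
         δ b ⊑ g ⊎ true ∷ g ◁ δ b → ⊥
  kill {b} {t = t} {g} f b<t t≤s v side with locate f b<t t≤s
  ... | _ , h , w , v<t , t≤w , (_ , eqδ , quiet , _) , h⊑ , _ with m≤n⇒m<n∨m≡n t≤w | side
  ...   | inj₂ refl | inj₁ p = ∷⋢ (⊑-trans (⊑-trans (subst (true ∷ g ⊑_) eqδ v) h⊑) p)
  ...   | inj₂ refl | inj₂ p = ◁-⋣ p (⊑-trans (subst (true ∷ g ⊑_) eqδ v) h⊑)
  -- The visit leads through `true ∷ h`, where the ball would have had to fall.
  ...   | inj₁ t<w  | inj₁ p = proj₁ (quiet v<t t<w) (⊑-trans h⊑ (⊑-trans p (⊑-tail v)))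
  -- If `h` lies above the point `c` where the two nodes part, the visit leads through `true ∷ h`;
  -- otherwise it is to the left of `h`.
  ...   | inj₁ t<w  | inj₂ (c , p , q) with ⊑-chain h⊑ q
  ...     | inj₁ (⊑-step r) = proj₁ (quiet v<t t<w) (⊑-trans r (⊑-tail (⊑-trans p v)))
  ...     | inj₂ (⊑-step r) = proj₂ (quiet v<t t<w) (c , ⊑-trans p v , r)

-- The true path

module Verification
  (em : ExcludedMiddle 0ℓ)
  (W? : ℕ → ℕ → ℕ → Bool)
  (W-mono : ∀ n x {s t} → s ≤ t → W? n s x ≡ true → W? n t x ≡ true)
  (R : ℕ → ℕ → List Bool → Bool)
  (R-mono : ∀ n y {f g : ℕ → Bool} {u v} → u ≤ v → (∀ {x} → x < u → f x ≡ g x) →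
            R n y (applyUpTo f u) ≡ true → R n y (applyUpTo g v) ≡ true)
  where

  open Classical em
  open Dynamics W? R

  A : ℕ → Set
  A x = ∃[ s ] (A[ s ] x ≡ true)

  χ : ℕ → Bool
  χ = char A

  χ-true : ∀ {x} → A x → χ x ≡ true
  χ-true {x} = dec-true (em {A x})

  χ-sound : ∀ {x} → χ x ≡ true → A x
  χ-sound {x} = does⇒ (em {A x})

  enters-new : ∀ {s t z} → A[ s ] z ≡ false → A[ t ] z ≡ true →
               ∃[ u ] (s ≤ u × u < t × A[ u ] z ≡ false × ∃[ b ] Enters u b z)
  enters-new {s} {t} {z} a a′ with A-sound t a′
  ... | w , w<t , b , e with first (λ u → ∃[ b ] Enters u b z) 0 z≤n (b , e)
  ...   | u , _ , u≤w , (c , e′) , below = u , ≮⇒≥ u≮s , ≤-<-trans u≤w w<t , new , c , e′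
    where
    new : A[ u ] z ≡ false
    new = ≢true λ q → let v , v<u , d , e″ = A-sound u q in below z≤n v<u (d , e″)
    u≮s : ¬ (u < s)
    u≮s u<s with trans (sym a) (A-complete u<s e′)
    ... | ()

  same-ball : ∀ {s t g h b y z} → move s ≡ just (g , b , y) → move t ≡ just (h , b , z) → y ≡ z
  same-ball {s} {t} m m′ = just-injective (trans (sym (proj₂ (proj₁ (trace {s} m)))) (proj₂ (proj₁ (trace {t} m′))))

  -- Until it is in `A`, the ball launched at `b` waits at gates above its node, and no walk gets
  -- past an occupied gate on its true side to launch from that node.
  relaunch : ∀ {b c y z s g} → Flight b y b (δ b) s g → b < c → c ≤ s → Launch c z → ¬ (δ b ≡ δ c)
  relaunch f b<c c≤s (m , _) eq with locate f b<c c≤s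
  ... | v , h , w , v<c , c≤w , (_ , _ , quiet , _) , h⊑ , m′ , _ with m≤n⇒m<n∨m≡n c≤w
  ...   | inj₁ c<w  = proj₁ (quiet v<c c<w) (subst (true ∷ h ⊑_) eq h⊑)
  ...   | inj₂ refl = <-irrefl (cong (proj₁ ∘ proj₂) (just-injective (trans (sym m′) m))) b<c

  -- If one of two balls is launched while the other is under way, `relaunch` applies; if only after
  -- the entry of the other, the requirement of the node is satisfied and the node launches nothing.
  enters-once : ∀ {s t b c y z} → Enters s b y → Enters t c z → s < t → δ b ≡ δ c → b ≡ c
  enters-once {s} {t} {b} {c} {y} {z} e e′ s<t eq with trace {s} e | trace {t} e′ | <-cmp b c
  ... | _ | _ | tri≈ _ b≡c _ = b≡c
  ... | (m , _) , f | l , f′ | tri> _ _ c<b =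
    contradiction (sym eq) (relaunch f′ c<b (≤-trans (Flight-≤ f) (<⇒≤ s<t)) (m , proj₂ (proj₁ (trace {s} e))))
  ... | (_ , p) , f | l , f′ | tri< b<c _ _ with c ≤? s
  ...   | yes c≤s = contradiction eq (relaunch f b<c c≤s l)
  ...   | no c≰s with trans (sym (proj₂ (pick-sound {c} {δ c} (proj₂ l))))
                    (satisfied-intro {c} {x = y} y<c (W-mono _ y (<⇒≤ b<c) inside) (A-complete (≰⇒> c≰s) e))
    where
    y<c : y < c
    y<c = <-trans (Picked.bounded (proj₁ (pick-sound {b} {δ b} p))) b<c
    inside : W? (length (δ c)) b y ≡ true
    inside = subst (λ γ → W? (length γ) b y ≡ true) eq (Picked.inside (proj₁ (pick-sound {b} {δ b} p)))
  ...     | ()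

  -- By enters-once, a node contributes at most one new element.
  entries-cease : ∀ n → Eventually (λ s → ∀ {c} → c < n → ∀ {b z} → Enters s b z → A[ s ] z ≡ false →
      ¬ (enc (δ b) ≡ c))
  entries-cease = Eventually-∀< λ c → one c
    where
    one : ∀ c → Eventually (λ s → ∀ {b z} → Enters s b z → A[ s ] z ≡ false → ¬ (enc (δ b) ≡ c))
    one c with em {∃[ s ] ∃₂ λ b z → Enters s b z × enc (δ b) ≡ c}
    ... | no ¬e = 0 , λ {s} _ {b} {z} e _ eq → ¬e (s , b , z , e , eq)
    ... | yes (t , b , z , e , eq) = suc t , λ {s} t<s {b′} {z′} e′ new eq′ →
      let b≡ = enters-once e e′ t<s (encPath-injective _ _ (trans eq (sym eq′)))
          z≡ = same-ball {t} {s} e (subst (λ b → Enters s b z′) (sym b≡) e′)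
      in case trans (sym new) (A-complete t<s (subst (Enters t b) z≡ e)) of λ ()

  record TruePath (γ : Path) : Set where
    field
      recurs : InfinitelyOften (λ s → γ ⊑ δ s)
      leftmost : Eventually (λ s → ¬ (δ s ◁ γ))
  open TruePath

  TruePath-⊑ : ∀ {γ β} → γ ⊑ β → TruePath β → TruePath γ
  TruePath-⊑ p t .recurs n   = let s , n≤s , v = recurs t n in s , n≤s , ⊑-trans p v
  TruePath-⊑ p t .leftmost = Eventually-⊆ (λ ¬l l → ¬l (◁-⊑ʳ l p)) (leftmost t)

  -- Every gate above a node of the true path opens again, so that the ball descends into A.
  flush : ∀ {γ n} → InfinitelyOften (λ s → γ ⊑ δ s) → (∀ {s} → n ≤ s → ¬ (δ s ◁ γ)) →
          ∀ {b z} k x {t} → length x ≤ k → x ⊑ γ → n ≤ t → move t ≡ just (gate x , b , z) → ∃[ s ] Enters s b z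
  flush {γ} {n} inf clear {b} {z} k x {t} x≤k x⊑γ n≤t m with gate x in eq
  ... | nothing = t , m
  ... | just g with inf (suc t)
  ...   | s , t<s , v with first (λ s → true ∷ g ⊑ δ s) (suc t) t<s (⊑-trans (⊑-trans (gate-⊑ x eq) x⊑γ) v)
  ...     | u , t<u , _ , w , below with visit-true {u} w
  ...       | _ , _ , at = go k x≤k at
    where
    at-gate : ballAt (history u) g ≡ just (b , z)
    at-gate = ballAt-persists {t} {u} m t<u λ {v} t<v v<u → below t<v v<u ,
      λ l → clear (≤-trans n≤t (<⇒≤ t<v)) (◁-⊑ʳ l (⊑-trans (⊑-tail (gate-⊑ x eq)) x⊑γ))
    go : ∀ k → length x ≤ k → ballAt (history u) g ≡ nothing ⊎ ∃[ ball ] Fallen (history u) (δ u , move u) g ball →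
         ∃[ s ] Enters s b z
    go k x≤k (inj₁ none) = case trans (sym none) at-gate of λ ()
    go zero x≤k (inj₂ _) = contradiction (≤-trans (⊑-length (gate-⊑ x eq)) x≤k) λ ()
    go (suc k) x≤k (inj₂ (ball , _ , m′ , at)) = flush inf clear k g (s≤s⁻¹ (≤-trans (⊑-length (gate-⊑ x eq)) x≤k))
      (⊑-trans (⊑-tail (gate-⊑ x eq)) x⊑γ) (≤-trans n≤t (<⇒≤ t<u))
      (trans m′ (cong (λ ball → just (gate g , ball)) (just-injective (trans (sym at) at-gate))))

  -- Once nothing to the left is visited any more, a ball launched by `γ` cannot be cancelled; it
  -- enters `A` by `flush` and satisfies the requirement of `γ` for good.
  launches-cease : ∀ {γ} → TruePath γ → Eventually (λ s → ∀ {z} → Launch s z → ¬ (δ s ≡ γ))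
  launches-cease {γ} tp with leftmost tp
  ... | n , clear with em {∃[ s ] (n ≤ s × ∃[ z ] (Launch s z × δ s ≡ γ))}
  ... | no ¬e = n , λ {s} n≤s {z} l eq → ¬e (s , n≤s , z , l , eq)
  ... | yes (t , n≤t , z , (m , p) , refl) with flush (recurs tp) clear (length (δ t)) (δ t) {t} ≤-refl ⊑-refl n≤t m
  ...   | u , e = suc u ⊔ t , λ {s} h {z′} (_ , p′) eq →
    let q = proj₁ (pick-sound {t} {δ t} p)
        t≤s = ≤-trans (m≤n⊔m (suc u) t) h
        sat = satisfied-intro {s} {x = z} (<-≤-trans (Picked.bounded q) t≤s)
                (W-mono _ z t≤s (subst (λ γ → W? (length γ) t z ≡ true) (sym eq) (Picked.inside q)))
                (A-complete (≤-trans (m≤m⊔n (suc u) t) h) e)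
    in case trans (sym (proj₂ (pick-sound {s} {δ s} p′))) sat of λ ()

  -- Walks may end at `γ = true ∷ γ₀` because a ball falls there. But between two such falls the
  -- gate `γ₀` must be filled again, and apart from launches of `γ` itself, which cease, what fills
  -- it comes from a node strictly below `γ`.
  child-visited : ∀ {γ} → TruePath γ → InfinitelyOften (λ s → ∃[ b ] (b ∷ γ ⊑ δ s))
  child-visited {γ} tp n with launches-cease tp
  ... | n₁ , quiet = result
    where
    N : ℕ
    -- From stage `suc (length γ)` on, the bound on the length of a walk no longer stops it at `γ`.
    N = n ⊔ n₁ ⊔ suc (length γ)
    n≤N : n ≤ N
    n≤N = ≤-trans (m≤m⊔n n n₁) (m≤m⊔n _ _)
    n₁≤N : n₁ ≤ N
    n₁≤N = ≤-trans (m≤n⊔m n n₁) (m≤m⊔n _ _)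
    not-short : ∀ {s} → N ≤ s → ¬ (length γ ≡ s)
    not-short N≤s refl = <-irrefl refl (≤-trans (m≤n⊔m (n ⊔ n₁) _) N≤s)
    launch-elsewhere : ∀ {s z} → N ≤ s → Launched (history s) (δ s , move s) z → δ s ≡ γ → ⊥
    launch-elsewhere {s} {z} N≤s (m , p) = quiet (≤-trans n₁≤N N≤s)
      (trans m (cong (λ b → just (gate (δ s) , b , z)) (length-history s)) , p)
    Child : ℕ → Set
    Child s = ∃[ b ] (b ∷ γ ⊑ δ s)
    attempt : ∀ {s} → N ≤ s → γ ⊑ δ s →
              Child s ⊎ ∃₂ λ γ₀ ball → γ ≡ true ∷ γ₀ × Fallen (history s) (δ s , move s) γ₀ ball
    attempt {s} N≤s v with ⊑-split v
    ... | inj₂ p  = inj₁ p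
    ... | inj₁ eq with subst (Stop (history s) s (δ s , move s)) (sym eq) (outcome-stop (outcome s))
    ...   | short l        = contradiction l (not-short N≤s)
    ...   | launch l       = ⊥-elim (launch-elsewhere N≤s l (sym eq))
    ...   | fall {γ₀} d = inj₂ (γ₀ , _ , refl , d)
    refilled : ∀ {s u γ₀ ball ball′} → N ≤ s → s < u → γ ≡ true ∷ γ₀ → Fallen (history s) (δ s , move s) γ₀ ball →
               Fallen (history u) (δ u , move u) γ₀ ball′ → ∃[ t ] (N ≤ t × Child t)
    refilled {s} {u} {γ₀} {ball} {ball′} N≤s s<u eq (e , m , _) (_ , _ , at) with ballAt-arrival u at
    ... | t , t<u , m′ , still with <-cmp s t
    ...   | tri> _ _ t<s  = contradiction (subst (true ∷ γ₀ ⊑_) (sym e) ⊑-refl) (proj₁ (still t<s s<u))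
    ...   | tri≈ _ refl _ = contradiction (gate-⊑ γ₀ (cong proj₁ (just-injective (trans (sym m) m′)))) ∷⋢
    ...   | tri< s<t _ _ with move-source {t} m′
    ...     | launched q b≡ l with ⊑-split (subst (_⊑ δ t) (sym eq) (gate-⊑ (δ t) (sym q)))
    ...       | inj₂ p   = t , ≤-trans N≤s (<⇒≤ s<t) , p
    ...       | inj₁ γ≡δ = ⊥-elim (launch-elsewhere (≤-trans N≤s (<⇒≤ s<t)) l (sym γ≡δ))
    refilled {γ₀ = γ₀} N≤s s<u eq (e , m , _) (_ , _ , at)
      | t , t<u , m′ , still | tri< s<t _ _ | fallen γ₁ q (e′ , _) _ =
      t , ≤-trans N≤s (<⇒≤ s<t) ,
          [ (λ γ≡γ₁ → true , subst (true ∷ γ ⊑_) (sym (trans e′ (cong (true ∷_) (sym γ≡γ₁)))) ⊑-refl)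
                                  , (λ (b , p) → b , subst (b ∷ γ ⊑_) (sym e′) (⊑-step p)) ]′
                                  (⊑-split (subst (_⊑ γ₁) (sym eq) (gate-⊑ γ₁ (sym q))))
    conclude : ∃[ s ] (N ≤ s × Child s) → ∃[ s ] (n ≤ s × Child s)
    conclude (s , N≤s , c) = s , ≤-trans n≤N N≤s , c
    result : ∃[ s ] (n ≤ s × Child s)
    result with recurs tp N
    ... | s , N≤s , v with attempt N≤s v
    ...   | inj₁ c = conclude (s , N≤s , c)
    ...   | inj₂ (γ₀ , _ , eq , d) with recurs tp (suc s)
    ...     | u , s<u , w with attempt (≤-trans N≤s (<⇒≤ s<u)) w
    ...       | inj₁ c = conclude (u , ≤-trans N≤s (<⇒≤ s<u) , c)
    ...       | inj₂ (γ₁ , _ , eq′ , d′) with trans (sym eq) eq′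
    ...         | refl = conclude (refilled N≤s s<u eq d d′)

  true-path-child : ∀ {γ} → TruePath γ →
      TruePath (true ∷ γ) ⊎ (TruePath (false ∷ γ) × Eventually (λ s → ¬ (true ∷ γ ⊑ δ s)))
  true-path-child {γ} tp with infinitely-or-never (λ s → true ∷ γ ⊑ δ s)
  ... | inj₁ inf = inj₁ λ where
    .recurs   → inf
    .leftmost → Eventually-⊆ (λ ¬l l → ¬l (◁-true l)) (leftmost tp)
  ... | inj₂ (n , never) = inj₂ (right-child , (n , never))
    where
    right-visit : ∀ {m} → ∃[ s ] (m ⊔ n ≤ s × ∃[ b ] (b ∷ γ ⊑ δ s)) → ∃[ s ] (m ≤ s × false ∷ γ ⊑ δ s)
    right-visit {m} (s , h , false , v) = s , ≤-trans (m≤m⊔n m n) h , v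
    right-visit {m} (s , h , true , v)  = contradiction v (never (≤-trans (m≤n⊔m m n) h))

    right-child : TruePath (false ∷ γ)
    right-child .recurs m = right-visit (child-visited tp (m ⊔ n))
    right-child .leftmost = Eventually-⊆ (λ (¬l , ¬v) l → [ ¬v , ¬l ]′ (◁-false l))
        (Eventually-× (leftmost tp) (n , never))

  spine : ∀ n → ∃[ γ ] (length γ ≡ n × TruePath γ)
  spine zero = [] , refl , λ where
    .recurs n → n , ≤-refl , ⊑-root (δ n)
    .leftmost → 0 , λ { _ (_ , _ , ()) }
  spine (suc n) with spine n
  ... | γ , l , tp with true-path-child tp
  ...   | inj₁ tp′       = true ∷ γ , cong suc l , tp′
  ...   | inj₂ (tp′ , _) = false ∷ γ , cong suc l , tp′

  A-settles : ∀ u → Eventually (λ s → ∀ {x} → x < u → χ x ≡ A[ s ] x)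
  A-settles = Eventually-∀< one
    where
    one : ∀ x → Eventually (λ s → χ x ≡ A[ s ] x)
    one x with em {A x}
    ... | yes (s , a) = s , λ s≤t → sym (A-mono s≤t a)
    ... | no ¬a       = 0 , λ {s} _ → sym (≢true λ a → ¬a (s , a))

  evidence-settles : ∀ {n y u} → R n y (applyUpTo χ u) ≡ true → Eventually (λ s → R n y (applyUpTo A[ s ] s) ≡ true)
  evidence-settles {n} {y} {u} r with A-settles u
  ... | m , agree = m ⊔ u , λ h → R-mono n y (≤-trans (m≤n⊔m m u) h) (agree (≤-trans (m≤m⊔n m u) h)) r

  Holds : ℕ → Set
  Holds n = ∀ y → ∃[ u ] (R n y (applyUpTo χ u) ≡ true)

  -- With only finitely many visits to `true ∷ γ` the amount of evidence asked for stays bounded. It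
  -- is eventually present for good, and from then on `false ∷ γ` cannot be visited.
  holds⇒true : ∀ {γ} → TruePath γ → Holds (length γ) → TruePath (true ∷ γ)
  holds⇒true {γ} tp holds with true-path-child tp
  ... | inj₁ tp′ = tp′
  ... | inj₂ (tp′ , n , never) with Eventually-∀< (λ y → evidence-settles (proj₂ (holds y))) n
  ...   | m , settled with recurs tp′ m
  ...     | s , m≤s , v with trans (sym (proj₂ (visit-false {s} v)))
                             (evidence-intro {n} {s} {γ} (lastVisit-≤ s never) (settled m≤s))
  ...       | ()

  false⇒fails : ∀ {γ} → TruePath (false ∷ γ) → ¬ Holds (length γ)
  false⇒fails {γ} tp holds with leftmost tp
  ... | n , clear with recurs (holds⇒true (TruePath-⊑ (⊑-step ⊑-refl) tp) holds) n
  ...   | s , n≤s , v = clear n≤s (γ , v , ⊑-refl)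

  -- Preservation of the evidence on the true path

  module Preservation {γ : Path} (tp : TruePath (true ∷ γ)) (y : ℕ) where

    Goal : Set
    Goal = ∃[ u ] (R (length γ) y (applyUpTo χ u) ≡ true)

    private
      n₁ n₂ v₀ T : ℕ
      n₁ = proj₁ (leftmost tp)
      n₂ = proj₁ (entries-cease (suc (y ⊔ enc γ)))
      v₀ = proj₁ (recurs tp y)
      -- From `T` on, nothing to the left is visited, new elements come from nodes of code above `y`
      -- and `enc γ`, and the evidence at a visit covers `y`, as the visit at `v₀ ≥ y` has taken
      -- place.
      T = n₁ ⊔ n₂ ⊔ suc v₀

    clear : ∀ {s} → T ≤ s → ¬ (δ s ◁ true ∷ γ)
    clear h = proj₂ (leftmost tp) (≤-trans (≤-trans (m≤m⊔n n₁ n₂) (m≤m⊔n _ _)) h)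

    new-entry : ∀ {s b z} → T ≤ s → Enters s b z → A[ s ] z ≡ false → y < enc (δ b) × enc γ < enc (δ b)
    new-entry {s} {b} h e new = ≤-<-trans (m≤m⊔n y (enc γ)) big , ≤-<-trans (m≤n⊔m y (enc γ)) big
      where
      big : y ⊔ enc γ < enc (δ b)
      big = ≰⇒> λ small → proj₂ (entries-cease (suc (y ⊔ enc γ)))
          (≤-trans (≤-trans (m≤n⊔m n₁ n₂) (m≤m⊔n _ _)) h) (s≤s small) e new refl

    evident : ∀ {t} → T ≤ t → true ∷ γ ⊑ δ t → R (length γ) y (applyUpTo A[ t ] t) ≡ true
    evident {t} h v = evidence-elim {t} {v₀} (proj₁ (proj₂ (visit-true {t} v))) (≤-trans (m≤n⊔m (n₁ ⊔ n₂) (suc v₀)) h)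
                                    (proj₂ (proj₂ (recurs tp y))) (proj₁ (proj₂ (recurs tp y)))

    -- `u` is the use of the evidence found at the visit `t`, and `z` a number below it that enters
    -- first thereafter. The minimality of `u` excludes the balls launched below `true ∷ γ` from
    -- stage `t` on.
    record Injury (t : ℕ) : Set where
      field
        {s b z u} : ℕ
        t≤s : t ≤ s
        enters : Enters s b z
        new : A[ s ] z ≡ false
        z<u : z < u
        u≤t : u ≤ t
        minimal : ∀ {v} → v < u → R (length γ) y (applyUpTo A[ t ] v) ≡ false
        intact : ∀ {x} → x < u → A[ s ] x ≡ A[ t ] x

    preserved-or-injured : ∀ {t} → T ≤ t → true ∷ γ ⊑ δ t → Goal ⊎ Injury t
    preserved-or-injured {t} h v with least (λ u → R (length γ) y (applyUpTo A[ t ] u)) (t , evident h v)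
    ... | u , r , minimal with em {∃[ s ] (t ≤ s × ∃₂ λ b z → z < u × Enters s b z × A[ s ] z ≡ false)}
    ...   | no ¬e = inj₁ (u , R-mono (length γ) y ≤-refl agree r)
      where
      agree : ∀ {x} → x < u → A[ t ] x ≡ χ x
      agree {x} x<u with A[ t ] x in eq
      ... | true  = sym (χ-true (t , eq))
      ... | false = sym (≢true λ c → let s , a = χ-sound c
                                         w , t≤w , _ , new , b , e = enters-new eq a
                                     in ¬e (w , t≤w , b , x , x<u , e , new))
    ...   | yes (s₀ , t≤s₀ , inj) with first (λ s → ∃₂ λ b z → z < u × Enters s b z × A[ s ] z ≡ false) t t≤s₀ inj
    ...     | s , t≤s , _ , (b , z , z<u , e , new) , below = inj₂ record
      { t≤s = t≤s ; enters = e ; new = new ; z<u = z<u ; minimal = minimal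
      ; u≤t = ≮⇒≥ λ t<u → case trans (sym (minimal t<u)) (evident h v) of λ ()
      ; intact = intact
      }
      where
      intact : ∀ {x} → x < u → A[ s ] x ≡ A[ t ] x
      intact {x} x<u with A[ t ] x in eq
      ... | true  = A-mono t≤s eq
      ... | false = ≢true λ a → let w , t≤w , w<s , new , b , e = enters-new eq a
                                in below t≤w w<s (b , x , x<u , e , new)

    -- Balls are nested: between the launch and the entry of a ball, no ball is launched that outlives it.
    nested : ∀ {s b z s′ b′ z′} → Enters s b z → Enters s′ b′ z′ → s ≤ s′ → b < b′ → b′ < s → ⊥
    nested {s} {b} {z} {s′} {b′} e e′ s≤s′ b<b′ b′<s with trace {s} e | trace {s′} e′
    ... | _ , f | (m′ , _) , f′ with locate f b<b′ (<⇒≤ b′<s)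
    ...   | v , h , w , v<b′ , b′≤w , (_ , eqδ , quiet , _) , h⊑ , m , rest with m≤n⇒m<n∨m≡n b′≤w
    ...     | inj₂ refl = <-irrefl (cong (proj₁ ∘ proj₂) (just-injective (trans (sym m) m′))) b<b′
    -- While the older ball waits at `h`, the node `δ b′` is neither below `true ∷ h` nor to the
    -- left of `h`; the fall at `w` then does away with the younger ball.
    ...     | inj₁ b′<w = kill {g = h} f′ b′<w (≤-trans (Flight-≤ rest) s≤s′) (subst (true ∷ h ⊑_) (sym eqδ) ⊑-refl)
                (⊑-or-right (δ b′) (proj₁ (quiet v<b′ b′<w)) (λ l → proj₂ (quiet v<b′ b′<w) (◁-true l)))

    -- The next culprit is not the same ball, which enters only once; nor one launched after `b` and
    -- before `s`, by nesting; nor one launched at `s`, a stage taken by the entry; nor one launched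
    -- between `s` and the next visit `t`, which that visit removes; nor one launched from `t` on,
    -- by `late`.
    older : ∀ {s b z t} → T ≤ s → Enters s b z → s < t → true ∷ γ ⊑ δ t →
        (∀ {u} → suc s ≤ u → u < t → ¬ (true ∷ γ ⊑ δ u)) →
            (i : Injury t) → Injury.b i < b
    older {s} {b} {z} {t} T≤s e s<t v below i = ≰⇒> λ b≤b′ → [ younger , same ]′ (m≤n⇒m<n∨m≡n b≤b′)
      where
      open Injury i renaming (s to s′; b to b′; z to z′)
      T≤s′ : T ≤ s′
      T≤s′ = ≤-trans T≤s (≤-trans (<⇒≤ s<t) t≤s)
      l : Launch b′ z′
      l = proj₁ (trace {s′} enters)
      f : Flight b′ z′ b′ (δ b′) s′ nothing
      f = proj₂ (trace {s′} enters)
      picked : Picked b′ (δ b′) z′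
      picked = proj₁ (pick-sound {b′} {δ b′} (proj₂ l))
      same : b ≡ b′ → ⊥
      same refl = case trans (sym new)
          (A-complete (<-≤-trans s<t t≤s) (subst (Enters s b) (same-ball {s} {s′} e enters) e)) of λ ()
      above : ¬ (δ b′ ⊑ γ)
      above p = <⇒≱ (proj₂ (new-entry T≤s′ enters new)) (⊑-enc p)
      -- Below `z′` nothing has entered since stage `t`, so the evidence that the launching node
      -- respects was there at `t` already, with use at most `z′ < u`, against the choice of `u`.
      below-node : t ≤ b′ → true ∷ γ ⊑ δ b′ → ⊥
      below-node t≤b′ p = case trans (sym (minimal z<u)) (R-mono (length γ) y ≤-refl agree
                                 (Picked.respected picked p (<⇒≤ (proj₁ (new-entry T≤s′ enters new))))) of λ ()
        where
        agree : ∀ {x} → x < z′ → A[ b′ ] x ≡ A[ t ] x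
        agree {x} x<z′ with A[ t ] x in eq
        ... | true  = A-mono t≤b′ eq
        ... | false = ≢true λ a → case trans (sym (trans (intact (<-trans x<z′ z<u)) eq))
            (A-mono (Flight-≤ f) a) of λ ()
      late : t ≤ b′ → ⊥
      late t≤b′ with ⊑-compare (δ b′) (true ∷ γ)
      ... | inj₁ (inj₁ p) = [ below-node t≤b′ , above ]′ (⊑-∷⁻ p)
      ... | inj₁ (inj₂ p) = below-node t≤b′ p
      ... | inj₂ (inj₁ p) = clear (≤-trans T≤s (≤-trans (<⇒≤ s<t) t≤b′)) p
      ... | inj₂ (inj₂ p) with m≤n⇒m<n∨m≡n t≤b′
      ...   | inj₂ refl = ◁-⋣ p v
      -- The restraint exceeds the stage `t` of the visit, while `z′ < u ≤ t`.
      ...   | inj₁ t<b′ = <-irrefl refl (<-≤-trans (restraint-> {b′} t<b′ (◁-⊑ˡ p v))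
                            (≤-trans (Picked.restr picked) (≤-trans (<⇒≤ z<u) u≤t)))
      younger : b < b′ → ⊥
      younger b<b′ with <-cmp b′ s
      ... | tri< b′<s _ _ = nested e enters (≤-trans (<⇒≤ s<t) t≤s) b<b′ b′<s
      ... | tri≈ _ refl _ = <-irrefl (cong (proj₁ ∘ proj₂) (just-injective (trans (sym e) (proj₁ l)))) b<b′
      ... | tri> _ _ s<b′ with t ≤? b′
      ...   | yes t≤b′ = late t≤b′
      ...   | no t≰b′  = kill f (≰⇒> t≰b′) t≤s v
                (⊑-or-right (δ b′) (below s<b′ (≰⇒> t≰b′)) (clear (≤-trans T≤s (<⇒≤ s<b′))))

    preserved : Goal
    preserved with recurs tp T
    ... | t , T≤t , v with preserved-or-injured T≤t v
    ...   | inj₁ g = g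
    ...   | inj₂ i = after (Injury.b i) (≤-trans T≤t (Injury.t≤s i)) (Injury.enters i)
      where
      after : ∀ b {s z} → T ≤ s → Enters s b z → Goal
      after = <-rec (λ b → ∀ {s z} → T ≤ s → Enters s b z → Goal) step
        where
        step : ∀ b → (∀ {b′} → b′ < b → ∀ {s z} → T ≤ s → Enters s b′ z → Goal) → ∀ {s z} → T ≤ s →
            Enters s b z → Goal
        step b ih {s} T≤s e with recurs tp (suc s)
        ... | t′ , s<t′ , v′ with first (λ t → true ∷ γ ⊑ δ t) (suc s) s<t′ v′
        ...   | t , s<t , _ , v , below with preserved-or-injured (≤-trans T≤s (<⇒≤ s<t)) v
        ...     | inj₁ g = g
        ...     | inj₂ i = ih (older T≤s e s<t v below i) (≤-trans T≤s (≤-trans (<⇒≤ s<t) (Injury.t≤s i)))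
            (Injury.enters i)

  true⇒holds : ∀ {γ} → TruePath (true ∷ γ) → Holds (length γ)
  true⇒holds tp y = Preservation.preserved tp y

  -- This makes the clause `respected` hold for all sufficiently large candidates.
  true-path-settles : ∀ c β → TruePath β →
    Eventually (λ z → ∀ {γ} → true ∷ γ ⊑ β → ∀ {y} → y < c → R (length γ) y (applyUpTo χ z) ≡ true)
  true-path-settles c []      _  = 0 , λ _ ()
  true-path-settles c (b ∷ β) tp with true-path-settles c β (TruePath-⊑ (⊑-step ⊑-refl) tp)
  true-path-settles c (false ∷ β) tp | k , h = k , λ { k≤z (⊑-step p) → h k≤z p }
  true-path-settles c (true ∷ β)  tp | k , h with Eventually-∀< (λ y → let u , r = true⇒holds tp y in
      (u , λ u≤z → R-mono (length β) y u≤z (λ _ → refl) r)) c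
  ... | k′ , h′ = k ⊔ k′ , λ { k≤z ⊑-refl y<c → h′ (≤-trans (m≤n⊔m k k′) k≤z) y<c
                             ; k≤z (⊑-step p) → h (≤-trans (m≤m⊔n k k′) k≤z) p }

  -- A large enough element of `W n` becomes eligible at the node of length `n` on the true path; a
  -- walk that goes on to a child all the same shows that the requirement is satisfied.
  A-meets-W : ∀ n → (∀ m → ∃₂ λ x s → m ≤ x × W? n s x ≡ true) → ∃₂ λ x s → A x × W? n s x ≡ true
  A-meets-W n unbounded with spine n
  ... | β , refl , tp with leftmost tp | true-path-settles (suc (enc β)) β tp
  -- The three bounds on the candidate serve the restraint, the respect for evidence and the bound
  -- by twice the code.
  ...   | n₁ , clear | k , respected with unbounded (n₁ ⊔ k ⊔ suc (enc β + enc β))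
  ...     | z , s₀ , z≥ , w with A-settles z
  ...       | m , agree with child-visited tp (m ⊔ s₀ ⊔ suc z)
  ...         | s , s≥ , b , v = let x , w , a =
                                       satisfied-elim {s} {length β} (pick-complete {s} {β} {z} (unpicked b v) picked)
                                 in x , s , (s , a) , w
    where
    unpicked : ∀ b → b ∷ β ⊑ δ s → pick (history s) β ≡ nothing
    unpicked true  v = proj₁ (visit-true {s} v)
    unpicked false v = proj₁ (visit-false {s} v)
    picked : Picked s β z
    picked = record
      { inside    = W-mono (length β) z (≤-trans (≤-trans (m≤n⊔m m s₀) (m≤m⊔n _ _)) s≥) w
      ; bounded   = ≤-trans (m≤n⊔m (m ⊔ s₀) (suc z)) s≥
      ; restr     = ≤-trans (restraint-≤ s clear) (≤-trans (≤-trans (m≤m⊔n n₁ k) (m≤m⊔n _ _)) z≥)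
      ; large     = ≤-trans (m≤n⊔m (n₁ ⊔ k) _) z≥
      ; respected = λ {γ} {y} p y≤c →
          R-mono (length γ) y ≤-refl (agree (≤-trans (≤-trans (m≤m⊔n m s₀) (m≤m⊔n _ _)) s≥))
                      (respected (≤-trans (≤-trans (m≤n⊔m n₁ k) (m≤m⊔n _ _)) z≥) p (s≤s y≤c))
      }

  -- An element of A exceeds twice the code of the node that launched it, so A has at most k elements up to 2k.
  co-infinite : ∀ xs → ¬ (∀ {x} → ¬ A x → x ∈ₗ xs)
  co-infinite xs covers = conclude (pigeonhole (n<1+n (k + k)) (λ i → proj₁ (at i)))
    where
    k : ℕ
    k = length xs
    -- The first `k` places are for elements of `A`, by the code of the launching node, the other
    -- `k` for positions in `xs`; the `k + k + 1` numbers up to `k + k` do not fit injectively.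
    data Place (x : ℕ) (p : Fin (k + k)) : Set where
      inside  : ∀ {s b} → Enters s b x → enc (δ b) ≡ toℕ p → enc (δ b) < k → Place x p
      outside : (i : Fin k) → lookup xs i ≡ x → toℕ p ≡ k + toℕ i → Place x p
    place : ∀ x → x ≤ k + k → ∃[ p ] Place x p
    place x x≤2k with em {A x}
    ... | no ¬a = let x∈ = covers ¬a in k ↑ʳ position x∈ , outside (position x∈) (sym (lookup-index x∈))
        (toℕ-↑ʳ k (position x∈))
    ... | yes (s , a) with A-sound s a
    ...   | t , _ , b , e with pick-sound {b} {δ b} (proj₂ (proj₁ (trace {t} e)))
    ...     | picked , _ = fromℕ< (≤-trans c<k (m≤m+n k k)) , inside e (sym (toℕ-fromℕ< _)) c<k
      where
      c<k : enc (δ b) < k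
      c<k = ≰⇒> λ k≤c → <⇒≱ (<-≤-trans (Picked.large picked) x≤2k) (+-mono-≤ k≤c k≤c)
    distinct : ∀ {x y p q} → Place x p → Place y q → toℕ p ≡ toℕ q → x ≡ y
    distinct (inside {s} e c _) (inside {t} e′ c′ _) p≡q
      with encPath-injective _ _ (trans c (trans p≡q (sym c′))) | <-cmp s t
    ... | _  | tri≈ _ refl _ = cong (proj₂ ∘ proj₂) (just-injective (trans (sym e) e′))
    ... | eq | tri< s<t _ _ with enters-once e e′ s<t eq
    ...   | refl = same-ball {s} {t} e e′
    distinct (inside {s} e c _) (inside {t} e′ c′ _) p≡q | eq | tri> _ _ t<s with enters-once e′ e t<s (sym eq)
    ...   | refl = same-ball {s} {t} e e′
    distinct (outside i a c) (outside j b c′) p≡q with toℕ-injective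
        (+-cancelˡ-≡ k _ _ (trans (sym c) (trans p≡q c′)))
    ... | refl = trans (sym a) b
    distinct (inside _ c c<k) (outside j _ c′) p≡q =
      contradiction (subst (_< k) (trans c (trans p≡q c′)) c<k) (≤⇒≯ (m≤m+n k (toℕ j)))
    distinct (outside i _ c) (inside _ c′ c<k) p≡q =
      contradiction (subst (_< k) (trans c′ (trans (sym p≡q) c)) c<k) (≤⇒≯ (m≤m+n k (toℕ i)))
    at : (i : Fin (suc (k + k))) → ∃[ p ] Place (toℕ i) p
    at i = place (toℕ i) (s≤s⁻¹ (toℕ<n i))
    conclude : ∃₂ (λ i j → i Fin.< j × proj₁ (at i) ≡ proj₁ (at j)) → ⊥
    conclude (i , j , i<j , eq) = <⇒≢ i<j (distinct (proj₂ (at i)) (proj₂ (at j)) (cong toℕ eq))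

  -- The 2-c.e. set of a node on the true path

  module Announcement {γ : Path} (tp : TruePath (true ∷ γ)) where

    private
      n₁ n₂ : ℕ
      n₁ = proj₁ (leftmost tp)
      n₂ = proj₁ (entries-cease (suc (enc γ)))

    threshold : ℕ
    threshold = n₁ ⊔ n₂

    -- The 2-c.e. set of γ consists of the numbers admitted and not announced.  The stage has to go beyond
    -- true ∷ γ, for otherwise it may move a ball to a gate above γ, past the announcement.
    Admits : ℕ → ℕ → Set
    Admits t x = true ∷ γ ⊑ δ t × suc (length γ) < length (δ t) × x < t × A[ suc t ] x ≡ false

    Announces : ℕ → ℕ → Set
    Announces t x = ∃[ b ] (move t ≡ just (just γ , b , x))

    admitted : ∀ n {x} → ¬ A x → ∃[ t ] (n ≤ t × Admits t x)
    admitted n {x} ¬a with child-visited tp (n ⊔ suc x)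
    ... | t , h , b , v = t , ≤-trans (m≤m⊔n n (suc x)) h , ⊑-tail v , ⊑-length v , ≤-trans (m≤n⊔m n (suc x)) h ,
                          ≢true λ a → ¬a (suc t , a)

    announced⇒A : ∀ {t x} → threshold ≤ t → Announces t x → A x
    announced⇒A {t} h (b , m) with flush (recurs tp) (λ {s} n≤s → proj₂ (leftmost tp) {s} n≤s)
        (suc (length γ)) (true ∷ γ) {t} ≤-refl ⊑-refl
                                          (≤-trans (m≤m⊔n n₁ n₂) h) m
    ... | s , e = suc s , A-complete (n<1+n s) e

    -- At the admission the gate `γ` is still ahead of the ball. If launched later, it starts below
    -- `true ∷ γ`: the nodes above have ceased to contribute, those to the left are not visited, and
    -- the restraint of those to the right exceeds `x`. If already waiting, it waits below
    -- `true ∷ γ`: gates above are passed by the visit, balls to the right are cancelled by it, and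
    -- a ball to the left could only leave through a visit to the left.
    announced-first : ∀ {n t s x} → threshold ≤ n → n ≤ t → Admits t x → A[ s ] x ≡ true →
      ∃₂ λ v w → n ≤ v × Announces v x × w < s × R (length γ) v (applyUpTo A[ w ] w) ≡ true
    announced-first {n} {t} {s} {x} h n≤t (γ⊑ , long , x<t , out) a with enters-new out a
    ... | s′ , t<s′ , s′<s , new , b , e with trace {s′} e
    ...   | (m , p) , f = [ early , late ]′ (<-≤-connex b t)
      where
      clear : ∀ {u} → t ≤ u → ¬ (δ u ◁ true ∷ γ)
      clear t≤u = proj₂ (leftmost tp) (≤-trans (m≤m⊔n n₁ n₂) (≤-trans h (≤-trans n≤t t≤u)))
      above : ¬ (δ b ⊑ γ)
      above q = proj₂ (entries-cease (suc (enc γ))) (≤-trans (m≤n⊔m n₁ n₂) (≤-trans h (≤-trans n≤t (<⇒≤ t<s′))))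
                  (s≤s (⊑-enc q)) e new refl
      Result : Set
      Result = ∃₂ λ v w → n ≤ v × Announces v x × w < s × R (length γ) v (applyUpTo A[ w ] w) ≡ true
      pass : ∀ {u y} → t ≤ u → move u ≡ just (gate y , b , x) → Flight b x u y s′ nothing → true ∷ γ ⊑ y → Result
      pass t≤u m f q = let v , w , u≤v , m′ , (v<w , _ , _ , ev) , w≤s′ = through m f q in
        v , w , ≤-trans n≤t (≤-trans t≤u u≤v) , (b , m′) , ≤-<-trans w≤s′ s′<s ,
        evidence-elim {w} {v} ev v<w (move-visits {v} m′) ≤-refl
      late : t ≤ b → Result
      late t≤b with ⊑-compare (δ b) (true ∷ γ)
      ... | inj₁ (inj₁ q) = [ pass t≤b m f , (λ r → contradiction r above) ]′ (⊑-∷⁻ q)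
      ... | inj₁ (inj₂ q) = pass t≤b m f q
      ... | inj₂ (inj₁ l) = contradiction l (clear t≤b)
      ... | inj₂ (inj₂ r) with m≤n⇒m<n∨m≡n t≤b
      ...   | inj₂ refl = contradiction γ⊑ (◁-⋣ r)
      ...   | inj₁ t<b  = contradiction (<-trans x<t (restraint-> {b} {t} t<b (◁-⊑ˡ r γ⊑)))
                            (≤⇒≯ (Picked.restr (proj₁ (pick-sound {b} {δ b} p))))
      early : b < t → Result
      early b<t with locate f b<t (<⇒≤ t<s′)
      ... | v , g , w , v<t , t≤w , (_ , eqδ , quiet , _) , g⊑ , m′ , rest = result
        where
        not-above : ¬ (true ∷ g ⊑ true ∷ γ)
        not-above q with m≤n⇒m<n∨m≡n t≤w
        ... | inj₁ t<w  = proj₁ (quiet v<t t<w) (⊑-trans q γ⊑)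
        ... | inj₂ refl = <⇒≱ long (subst (λ β → length β ≤ _) (sym eqδ) (⊑-length q))
        result : Result
        result with ⊑-compare (δ b) (true ∷ γ)
        ... | inj₁ (inj₁ q) = contradiction (⊑-trans g⊑ q) not-above
        ... | inj₂ (inj₂ r) = ⊥-elim (kill f b<t (<⇒≤ t<s′) γ⊑ (inj₂ r))
        ... | inj₁ (inj₂ q) with ⊑-chain g⊑ q
        ...   | inj₁ r = contradiction r not-above
        ...   | inj₂ r with ⊑-∷⁻ r
        ...     | inj₁ r′ = contradiction r′ not-above
        ...     | inj₂ r′ = pass t≤w m′ rest r′
        result | inj₂ (inj₁ (c , q , r)) with ⊑-chain g⊑ q
        ...   | inj₂ q′ = contradiction (c , subst (true ∷ c ⊑_) (sym eqδ) q′ , r) (clear t≤w)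
        ...   | inj₁ q′ with ⊑-∷⁻ q′
        ...     | inj₁ q″ = contradiction (c , subst (true ∷ c ⊑_) (sym eqδ) q″ , r) (clear t≤w)
        ...     | inj₂ q″ = contradiction (⊑-trans q″ (⊑-tail r)) not-above

-- Computability of the construction

module _ {χ : ℕ → Bool} where

  ≟PC : ∀ {Γ} ⦃ _ : Coded Γ ⦄ {f g : Γ → Path} → Comp χ f → Comp χ g → Comp χ (λ x → does (f x ≟P g x))
  ≟PC cf cg = ≟C (encC cf) (encC cg)

  ⊑?C : Comp χ {Path × Path} (λ (γ , β) → does (γ ⊑? β))
  ⊑?C = extC (λ (γ , β) → go γ β) (recLC (≟PC v₁ (constC [])) (≟PC (fstC v₁) (vₖ ∷C fstC vᵣ) ∨C sndC vᵣ) v₂)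
    where
    go : ∀ γ β → recL (does (γ ≟P [])) (λ b β r → does (γ ≟P b ∷ β) ∨ r) β ≡ does (γ ⊑? β)
    go γ []      = refl
    go γ (b ∷ β) = cong (does (γ ≟P b ∷ β) ∨_) (go γ β)

  ◁?C : Comp χ {Path × Path} (λ (δ , β) → does (δ ◁? β))
  ◁?C = extC (λ (δ , β) → go δ β)
    (recLC (constC false) (ifC vₖ (sndC vᵣ) (⊑?C ∘C ((constC true ∷C fstC vᵣ) ,C fstC v₁) ∨C sndC vᵣ)) v₂)
    where
    go : ∀ δ β → recL false (λ b β r → if b then r else does (true ∷ β ⊑? δ) ∨ r) β ≡ does (δ ◁? β)
    go δ []          = refl
    go δ (true ∷ β)  = go δ β
    go δ (false ∷ β) = cong (does (true ∷ β ⊑? δ) ∨_) (go δ β)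

  gateC : Comp χ gate
  gateC = recLC (constC nothing) (ifC vₖ (justC (fstC vᵣ)) (sndC vᵣ)) idC

  inAC : Comp χ {History × ℕ} (λ (h , z) → inA h z)
  inAC = recLC (constC false) (entersAsC ∘C (sndC v₁ ,C sndC vₖ) ∨C sndC vᵣ) v₁
    where
    entersAsC : Comp χ {ℕ × Maybe Move} (λ (z , m) → entersAs z m)
    entersAsC = caseMC (constC false) (caseMC (≟C (sndC (sndC v₂)) (fstC v₁)) (constC false) (fstC v₂)) v₂

  arrivesAtC : Comp χ {Path × Maybe Move} (λ (γ , m) → arrivesAt γ m)
  arrivesAtC = caseMC (constC nothing)
    (caseMC (constC nothing) (ifC (≟PC v₂ (fstC (fstC v₁))) (justC (sndC (sndC v₁))) (constC nothing)) (fstC v₂)) v₂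

  ballAtC : Comp χ {History × Path} (λ (h , γ) → ballAt h γ)
  ballAtC = recLC (constC nothing)
    (ifC (◁?C ∘C (fstC vₖ ,C sndC v₁)) (constC nothing)
      (caseMC (ifC (⊑?C ∘C ((constC true ∷C sndC v₁) ,C fstC vₖ)) (constC nothing) (sndC vᵣ))
              (justC v₂) (arrivesAtC ∘C (sndC v₁ ,C sndC vₖ)))) v₁

  lastVisitC : Comp χ {History × Path} (λ (h , γ) → lastVisit h γ)
  lastVisitC = recLC (constC 0) (ifC (⊑?C ∘C (sndC v₁ ,C fstC vₖ)) (sucC (lengthC (fstC vᵣ))) (sndC vᵣ)) v₁

  restraintC : Comp χ {History × Path} (λ (h , γ) → restraint h γ)
  restraintC = recLC (constC 0) (ifC (◁?C ∘C (fstC vₖ ,C sndC v₁)) (sucC (lengthC (fstC vᵣ))) (sndC vᵣ)) v₁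

module ComputableConstruction {χ : ℕ → Bool} (W? : ℕ → ℕ → ℕ → Bool) (R : ℕ → ℕ → List Bool → Bool)
  (W?C : Comp χ {ℕ × ℕ × ℕ} (λ (n , s , x) → W? n s x))
  (RC : Comp χ {ℕ × ℕ × List Bool} (λ (n , y , τ) → R n y τ)) where

  open Construction W? R

  initialC : Comp χ {History × ℕ} (λ (h , n) → applyUpTo (inA h) n)
  initialC = applyUpToC (inAC ∘C (fstC v₁ ,C v₂)) v₂

  opaque
    unfolding evidence

    evidenceC : Comp χ {History × Path} (λ (h , γ) → evidence h γ)
    evidenceC = allC (lastVisitC ∘C (v₁ ,C constC true ∷C v₂))
      (RC ∘C (lengthC (sndC v₁) ,C v₂ ,C initialC ∘C (fstC v₁ ,C lengthC (fstC v₁))))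

  respectsC : Comp χ {History × Path × ℕ} (λ (h , β , z) → respects h β z)
  respectsC = recLC (constC true)
    (ifC vₖ (allC (sucC (encC (fstC (sndC v₁))))
               (RC ∘C (lengthC (fstC (sndC (sndC v₁))) ,C v₂ ,C initialC ∘C
                   (fstC (fstC v₁) ,C sndC (sndC (fstC v₁))))))
            (constC true) ∧C sndC vᵣ) vₖ

  satisfiedC : Comp χ {History × ℕ} (λ (h , n) → satisfied h n)
  satisfiedC = anyC (lengthC v₁) (W?C ∘C (sndC v₁ ,C lengthC (fstC v₁) ,C v₂) ∧C inAC ∘C (fstC v₁ ,C v₂))

  eligibleC : Comp χ {(History × Path) × ℕ} (λ ((h , γ) , z) → eligible h γ z)
  eligibleC = W?C ∘C (lengthC (sndC v₁) ,C lengthC (fstC v₁) ,C v₂) ∧C ≤?C (restraintC ∘C v₁) v₂ ∧C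
    <?C (+C (encC (sndC v₁)) (encC (sndC v₁))) v₂ ∧C respectsC ∘C (fstC v₁ ,C sndC v₁ ,C v₂)

  opaque
    unfolding pick

    pickC : Comp χ {History × Path} (λ (h , γ) → pick h γ)
    pickC = ifC (satisfiedC ∘C (v₁ ,C lengthC v₂)) (constC nothing) (findC (lengthC v₁) eligibleC)

  descendC : Comp χ {History × Event} (λ (h , e) → descend h e)
  descendC = caseMC
    (caseMC
      (ifC (evidenceC ∘C (v₁ ,C fstC v₂))
           (caseMC ((constC true ∷C fstC v₂) ,C constC nothing)
                   ((constC true ∷C fstC (sndC v₁)) ,C justC (gateC ∘C fstC (sndC v₁) ,C v₂))
                   (ballAtC ∘C (v₁ ,C fstC v₂)))
           ((constC false ∷C fstC v₂) ,C constC nothing))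
      (fstC (sndC v₁) ,C justC (gateC ∘C fstC (sndC v₁) ,C lengthC (fstC v₁) ,C v₂))
      (pickC ∘C (v₁ ,C fstC v₂)))
    (fstC (sndC v₁) ,C justC v₂)
    (sndC v₂)

  walkC : Comp χ {History × ℕ} (λ (h , k) → walk h k)
  walkC = natrecC (constC ([] , nothing)) (descendC ∘C (fstC v₁ ,C vᵣ)) v₂

  opaque
    unfolding history δ move

    historyC : Comp χ history
    historyC = natrecC (constC []) (walkC ∘C (vᵣ ,C lengthC vᵣ) ∷C vᵣ) idC

    δC : Comp χ δ
    δC = fstC (walkC ∘C (historyC ,C lengthC historyC))

    moveC : Comp χ move
    moveC = sndC (walkC ∘C (historyC ,C lengthC historyC))

-- Jumps and c.e. sets

_decides_ : (ℕ → Bool) → Subset → Set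
χ decides B = ∀ n → Reflects (n ∈ B) (χ n)

Reflects-det : ∀ {P : Set} {a b} → Reflects P a → Reflects P b → a ≡ b
Reflects-det (ofʸ _) (ofʸ _)  = refl
Reflects-det (ofⁿ _) (ofⁿ _)  = refl
Reflects-det (ofʸ p) (ofⁿ ¬p) = contradiction p ¬p
Reflects-det (ofⁿ ¬p) (ofʸ p) = contradiction p ¬p

Reflects-⇔ : ∀ {P Q : Set} {b} → P ⇔ Q → Reflects P b → Reflects Q b
Reflects-⇔ e (ofʸ p)  = ofʸ (to e p)
Reflects-⇔ e (ofⁿ ¬p) = ofⁿ (λ q → ¬p (from e q))

Reflects-true : ∀ {P : Set} {b} → Reflects P b → P ⇔ (b ≡ true)
Reflects-true (ofʸ p)  = mk⇔ (λ _ → refl) (λ _ → p)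
Reflects-true (ofⁿ ¬p) = mk⇔ (λ p → contradiction p ¬p) (λ ())

no-oracle : ℕ → Bool
no-oracle _ = false

no-oracle-decides : no-oracle decides ∅
no-oracle-decides n = ofⁿ λ ()

replicate-false : ∀ n → replicate n false ≡ applyUpTo no-oracle n
replicate-false zero    = refl
replicate-false (suc n) = cong (false ∷_) (replicate-false n)

head-drop-length : ∀ {A : Set} (σ : List A) n {b} → head (drop n σ) ≡ just b → n < length σ
head-drop-length []      zero    ()
head-drop-length []      (suc n) ()
head-drop-length (x ∷ σ) zero    _  = s≤s z≤n
head-drop-length (x ∷ σ) (suc n) eq = s≤s (head-drop-length σ n eq)

module _ {χ : ℕ → Bool} {B : Subset} (dec : χ decides B) where

  ≺⇒≼ : ∀ {σ n} → σ ≺ B → length σ ≤ n → σ ≼ applyUpTo χ n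
  ≺⇒≼ {σ} {n} σ≺B l i {b} eq = trans (head-drop-applyUpTo χ (<-≤-trans (head-drop-length σ i eq) l))
    (cong just (Reflects-det (dec i) (σ≺B i b eq)))

  applyUpTo-≺ : ∀ n → applyUpTo χ n ≺ B
  applyUpTo-≺ n i b eq with head-drop-bound χ n i eq
  ... | _ , refl = dec i

  Φ⇔Converges : ∀ {e x y} → Φ e B x y ⇔ Converges χ (decode e) x y
  Φ⇔Converges {e} {x} = mk⇔
    (λ (σ , s , σ≺B , eq) → s ⊔ length σ , run-mono (≺⇒≼ σ≺B (m≤n⊔m s (length σ))) (m≤m⊔n s (length σ))
        (decode e) x eq)
    (λ (s , eq) → applyUpTo χ s , s , applyUpTo-≺ s , eq)

  ≤T-intro : ∀ {A : Subset} {f : ℕ → Bool} → f decides A → Comp χ f → A ≤T B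
  ≤T-intro {A} {f} fA cf = encode (code cf) , λ n →
      (λ a → subst (Φ _ B n) (cong enc (to (Reflects-true (fA n)) a)) (value n)) ,
      (λ ¬a → subst (Φ _ B n) (cong enc (Reflects-det (fA n) (ofⁿ ¬a))) (value n))
    where
    value : ∀ n → Φ (encode (code cf)) B n (enc (f n))
    value n = from Φ⇔Converges (subst (λ c → Converges χ c n (enc (f n))) (sym (decode-encode (code cf)))
        (computes cf n))

halts? : (ℕ → Bool) → ℕ → ℕ → Bool
halts? χ e s = is-just (run (applyUpTo χ s) s (decode e) e)

is-just-elim : ∀ {A : Set} (m : Maybe A) → is-just m ≡ true → ∃[ x ] (m ≡ just x)
is-just-elim (just x) _ = x , refl

jump⇔halts : ∀ {χ B} → χ decides B → ∀ e → e ∈ B ′ ⇔ (∃[ s ] (halts? χ e s ≡ true))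
jump⇔halts dec e = mk⇔
  (λ (y , φ) → let s , eq = to (Φ⇔Converges dec) φ in s , cong is-just eq)
  (λ (s , h) → let y , eq = is-just-elim _ h in y , from (Φ⇔Converges dec) (s , eq))

halts-mono : ∀ {χ e s t} → s ≤ t → halts? χ e s ≡ true → halts? χ e t ≡ true
halts-mono {χ} {e} s≤t h = cong is-just (run-extend χ s≤t (decode e) e (proj₂ (is-just-elim _ h)))

haltsC : ∀ {χ Γ} ⦃ _ : Coded Γ ⦄ {f : Γ × ℕ → Bool} {e s : Γ → ℕ} → Comp χ f → Comp χ e → Comp χ s →
         Comp χ (λ γ → halts? (λ n → f (γ , n)) (e γ) (s γ))
haltsC cf ce cs = is-justC (runC ∘C (applyUpToC cf cs ,C cs ,C ce ,C ce))

encConst : ℕ → ℕ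
encConst n = encode (constCode n)

encConstC : ∀ {χ} → Comp χ encConst
encConstC = extC go (natrecC (constC (encode zero)) (⟨⟩C (constC 6) (⟨⟩C (constC (encode succ)) vᵣ)) idC)
  where
  go : ∀ n → natrec (encode zero) (λ _ r → ⟨ 6 , ⟨ encode succ , r ⟩ ⟩) n ≡ encConst n
  go zero    = refl
  go (suc n) = cong (λ r → ⟨ 6 , ⟨ encode succ , r ⟩ ⟩) (go n)

applyConst : Code → ℕ → Code
applyConst c n = comp c (constCode n)

applyLeft : Code → Code → ℕ → Code
applyLeft c d w = comp c (pair (constCode w) d)

encode-applyConstC : ∀ {χ} c → Comp χ (λ n → encode (applyConst c n))
encode-applyConstC c = ⟨⟩C (constC 6) (⟨⟩C (constC (encode c)) encConstC)

encode-applyLeftC : ∀ {χ} c d → Comp χ (λ w → encode (applyLeft c d w))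
encode-applyLeftC c d = ⟨⟩C (constC 6) (⟨⟩C (constC (encode c)) (⟨⟩C (constC 5) (⟨⟩C encConstC (constC (encode d)))))

applyConst-elim : ∀ {χ} c n {x y} → Converges χ (applyConst c n) x y → Converges χ c n y
applyConst-elim {χ} c n {x} {y} (suc s , eq) =
  let z , e₁ , e₂ = >>=-just (run (applyUpTo χ (suc s)) s (constCode n) x) _ eq
      z≡ = Converges-det {χ} {constCode n} {x} (run⇒Converges {χ} {suc s} {s} e₁) (conv-const n)
  in run⇒Converges {χ} {suc s} {s} (subst (λ z → run (applyUpTo χ (suc s)) s c z ≡ just y) z≡ e₂)

applyLeft-elim : ∀ {χ} c w {x y} → Converges χ (applyLeft c idCode w) x y → Converges χ c ⟨ w , x ⟩ y
applyLeft-elim {χ} c w {x} {y} (suc s , eq) =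
  let z , e₁ , e₂ = >>=-just (run (applyUpTo χ (suc s)) s (pair (constCode w) idCode) x) _ eq
      z≡ = Converges-det {χ} {pair (constCode w) idCode} {x} (run⇒Converges {χ} {suc s} {s} e₁)
                         (conv-pair (conv-const w) conv-id)
  in run⇒Converges {χ} {suc s} {s} (subst (λ z → run (applyUpTo χ (suc s)) s c z ≡ just y) z≡ e₂)

-- The index is computable with every oracle, being obtained by writing a constant into a fixed
-- code; this allows reductions to be iterated one jump higher.
record Reduction {A : Set} ⦃ _ : Coded A ⦄ (B : Subset) (P : A → Set) : Set where
  field
    index : A → ℕ
    computable : ∀ {χ} → Comp χ index
    reduces : ∀ a → index a ∈ B ′ ⇔ P a

abstract
  -- The program for `a` carries `enc a` as a constant and ignores its input, so that running it on
  -- its own index performs the search for `a`.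
  jump-reduction : ∀ {χ B} → χ decides B → ∀ {A} ⦃ _ : Coded A ⦄ {p : A × ℕ → Bool} → Comp χ p →
                   Reduction B (λ a → ∃[ n ] (p (a , n) ≡ true))
  jump-reduction {χ} {B} dec {A} {p} cp = reduction (searchCode cp) (searchCode-total cp) (searchCode-sound cp)
    where
    reduction : ∀ c → (∀ a (ex : ∃[ n ] (p (a , n) ≡ true)) → Converges χ c (enc a) (μ (λ n → p (a , n)) ex)) →
                (∀ a {y} → Converges χ c (enc a) y → ∃[ n ] (p (a , n) ≡ true)) →
                    Reduction B (λ a → ∃[ n ] (p (a , n) ≡ true))
    reduction c total sound = record
      { index = λ a → encode (applyConst c (enc a))
      ; computable = encode-applyConstC c ∘C encC idC
      ; reduces = λ a → mk⇔
          (λ (y , φ) → sound a (applyConst-elim c (enc a)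
            (subst (λ d → Converges χ d (encode (applyConst c (enc a))) y)
                (decode-encode (applyConst c (enc a))) (to (Φ⇔Converges dec) φ))))
          (λ ex → μ (λ n → p (a , n)) ex , from (Φ⇔Converges dec)
            (subst (λ d → Converges χ d (encode (applyConst c (enc a))) (μ (λ n → p (a , n)) ex))
                (sym (decode-encode (applyConst c (enc a))))
                    (conv-comp (conv-const (enc a)) (total a ex))))
      }

W? : ℕ → ℕ → ℕ → Bool
W? n s x = does (x <? s) ∧ is-just (run (applyUpTo no-oracle s) s (decode n) x)

W?C : ∀ {χ} → Comp χ {ℕ × ℕ × ℕ} (λ (n , s , x) → W? n s x)
W?C = <?C vᵣ vₖ ∧C is-justC (runC ∘C (applyUpToC (constC false) vₖ ,C vₖ ,C v₁ ,C vᵣ))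

W?⇔W : ∀ {n s x} → x ∈ W[ n , s ] ⇔ (W? n s x ≡ true)
W?⇔W {n} {s} {x} rewrite replicate-false s = mk⇔
  (λ (x<s , j) → trans (cong (_∧ is-just m) (dec-true (x <? s) x<s)) (just⇒ m j))
  (λ eq → let lt , j = ∧-true {does (x <? s)} eq in does⇒ (x <? s) lt , just⇐ m j)
  where
  m : Maybe ℕ
  m = run (applyUpTo no-oracle s) s (decode n) x
  just⇒ : ∀ (m : Maybe ℕ) → Is-just m → is-just m ≡ true
  just⇒ (just _) _ = refl
  just⇐ : ∀ (m : Maybe ℕ) → is-just m ≡ true → Is-just m
  just⇐ (just _) _ = just tt

W-mono : ∀ n x {s t} → s ≤ t → W? n s x ≡ true → W? n t x ≡ true
W-mono n x {s} {t} s≤t eq with ∧-true {does (x <? s)} eq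
... | lt , j with is-just-elim _ j
...   | y , r rewrite run-extend no-oracle s≤t (decode n) x r =
  trans (cong (_∧ true) (dec-true (x <? t) (<-≤-trans (does⇒ (x <? s) lt) s≤t))) refl

converges⇒W : ∀ {c x y} → Converges no-oracle c x y → x ∈ W (encode c)
converges⇒W {c} {x} (s , eq) = s ⊔ suc x , from W?⇔W (cong₂ _∧_
  (dec-true (x <? s ⊔ suc x) (m≤n⊔m s (suc x)))
  (cong is-just (subst (λ c → run _ (s ⊔ suc x) c x ≡ _) (sym (decode-encode c))
      (run-extend no-oracle (m≤m⊔n s (suc x)) c x eq))))

W⇒converges : ∀ {c x} → x ∈ W (encode c) → ∃[ y ] Converges no-oracle c x y
W⇒converges {c} {x} (s , x∈) =
  let y , eq = is-just-elim _ (proj₂ (∧-true {does (x <? s)} (to W?⇔W x∈)))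
  in y , s , subst (λ c → run _ s c x ≡ just y) (decode-encode c) eq

record Family (P : ℕ → ℕ → Set) : Set where
  field
    index : ℕ → ℕ
    computable : ∀ {χ} → Comp χ index
    enumerates : ∀ w x → x ∈ W (index w) ⇔ P w x

abstract
  ce-family : ∀ {p : (ℕ × ℕ) × ℕ → Bool} → Comp no-oracle p → Family (λ w x → ∃[ n ] (p ((w , x) , n) ≡ true))
  ce-family {p} cp = family (searchCode cp) (searchCode-total cp) (searchCode-sound cp)
    where
    family : ∀ c → (∀ a (ex : ∃[ n ] (p (a , n) ≡ true)) → Converges no-oracle c (enc a) (μ (λ n → p (a , n)) ex)) →
             (∀ a {y} → Converges no-oracle c (enc a) y → ∃[ n ] (p (a , n) ≡ true)) →
                 Family (λ w x → ∃[ n ] (p ((w , x) , n) ≡ true))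
    family c total sound = record
      { index = λ w → encode (applyLeft c idCode w)
      ; computable = encode-applyLeftC c idCode
      ; enumerates = λ w x → mk⇔
          (λ x∈ → let y , conv = W⇒converges {applyLeft c idCode w} x∈ in sound (w , x) (applyLeft-elim c w conv))
          (λ ex → converges⇒W {applyLeft c idCode w}
              (conv-comp (conv-pair (conv-const w) conv-id) (total (w , x) ex)))
      }

-- The evidence

applyUpTo-cong : ∀ {A : Set} {f g : ℕ → A} n → (∀ {x} → x < n → f x ≡ g x) → applyUpTo f n ≡ applyUpTo g n
applyUpTo-cong zero    h = refl
applyUpTo-cong (suc n) h = cong₂ _∷_ (h (s≤s z≤n)) (applyUpTo-cong n (h ∘ s≤s))

take-applyUpTo : ∀ {A : Set} (f : ℕ → A) {m n} → m ≤ n → take m (applyUpTo f n) ≡ applyUpTo f m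
take-applyUpTo f {zero}          _       = refl
take-applyUpTo f {suc m} {suc n} (s≤s h) = cong (f 0 ∷_) (take-applyUpTo (f ∘ suc) h)

-- Evidence at y that the i-th function (without oracle) is total, and evidence at
-- y = ⟨ s , w ⟩ that i is not in the double jump of the set with initial segment τ: the
-- stage-w approximation to the jump yields no computation of length s, or it has changed below s.

converges-by : ℕ → ℕ → ℕ → Bool
converges-by i y t = caseM false (λ v → does (v ≤? t)) (run (applyUpTo no-oracle t) t (decode i) y)

jumpAt : List Bool → ℕ → ℕ → Bool
jumpAt τ w n = is-just (run (take w τ) w (decode n) n)

diverges-by : ℕ → ℕ → List Bool → Bool
diverges-by i y τ = does (w ≤? length τ) ∧
  (not (halts? (jumpAt τ w) i s) ∨ anyB s (λ n → not (jumpAt τ w n) ∧ jumpAt τ (length τ) n))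
  where
  s = proj₁ (unpair y)
  w = proj₂ (unpair y)

R : ℕ → ℕ → List Bool → Bool
R n y τ = if does (proj₁ (unpair n) ≟ 0) then converges-by (proj₂ (unpair n)) y (length τ)
          else diverges-by (proj₂ (unpair n)) y τ

module _ {χ : ℕ → Bool} where

  converges-byC : Comp χ {ℕ × ℕ × ℕ} (λ (i , y , t) → converges-by i y t)
  converges-byC = caseMC (constC false) (≤?C v₂ (sndC (sndC v₁)))
      (runC ∘C (applyUpToC (constC false) vᵣ ,C vᵣ ,C v₁ ,C vₖ))

  jumpAtC : Comp χ {List Bool × ℕ × ℕ} (λ (τ , w , n) → jumpAt τ w n)
  jumpAtC = is-justC (runC ∘C (takeC vₖ v₁ ,C vₖ ,C vᵣ ,C vᵣ))

  diverges-byC : Comp χ {ℕ × ℕ × List Bool} (λ (i , y , τ) → diverges-by i y τ)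
  diverges-byC = ≤?C (sndC (unpairC vₖ)) (lengthC vᵣ) ∧C
    (notC (haltsC (jumpAtC ∘C (sndC (sndC v₁) ,C sndC (unpairC (fstC (sndC v₁))) ,C v₂)) v₁ (fstC (unpairC vₖ))) ∨C
     anyC (fstC (unpairC vₖ))
       (notC (jumpAtC ∘C (sndC (sndC v₁) ,C sndC (unpairC (fstC (sndC v₁))) ,C v₂)) ∧C
        jumpAtC ∘C (sndC (sndC v₁) ,C lengthC (sndC (sndC v₁)) ,C v₂)))

  RC : Comp χ {ℕ × ℕ × List Bool} (λ (n , y , τ) → R n y τ)
  RC = ifC (≟C (fstC (unpairC v₁)) (constC 0))
           (converges-byC ∘C (sndC (unpairC v₁) ,C vₖ ,C lengthC vᵣ))
           (diverges-byC ∘C (sndC (unpairC v₁) ,C vₖ ,C vᵣ))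

halts-cong : ∀ {f g : ℕ → Bool} e s → (∀ {x} → x < s → f x ≡ g x) → halts? f e s ≡ halts? g e s
halts-cong e s h = cong (λ σ → is-just (run σ s (decode e) e)) (applyUpTo-cong s h)

jumpAt-applyUpTo : ∀ f {w} u n → w ≤ u → jumpAt (applyUpTo f u) w n ≡ halts? f n w
jumpAt-applyUpTo f {w} u n w≤u = cong (λ σ → is-just (run σ w (decode n) n)) (take-applyUpTo f w≤u)

Diverges : (ℕ → Bool) → ℕ → ℕ → ℕ → ℕ → Set
Diverges f i s w u = w ≤ u ×
  (halts? (λ n → halts? f n w) i s ≡ false ⊎ ∃[ n ] (n < s × halts? f n w ≡ false × halts? f n u ≡ true))

diverges-by⇔Diverges : ∀ f i y u →
  diverges-by i y (applyUpTo f u) ≡ true ⇔ Diverges f i (proj₁ (unpair y)) (proj₂ (unpair y)) u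
diverges-by⇔Diverges f i y u with unpair y
... | s , w rewrite length-applyUpTo f u with w ≤? u
...   | no w≰u rewrite dec-false (w ≤? u) w≰u = mk⇔ (λ ()) (λ (w≤u , _) → contradiction w≤u w≰u)
...   | yes w≤u rewrite dec-true (w ≤? u) w≤u = mk⇔
        (λ eq → w≤u , [ inj₁ ∘ stable , inj₂ ∘ changed ]′ (∨-true {not (halts? (jumpAt τ w) i s)} eq))
        (λ { (_ , inj₁ e) → cong (_∨ anyB s later) (trans (cong not same) (cong not e))
           ; (_ , inj₂ (n , n<s , e , e′)) → ∨-introʳ (not (halts? (jumpAt τ w) i s)) (anyB-intro s later n<s
               (cong₂ _∧_ (cong not (trans (jumpAt-applyUpTo f u n w≤u) e))
                   (trans (jumpAt-applyUpTo f u n ≤-refl) e′))) })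
  where
  τ : List Bool
  τ = applyUpTo f u
  later : ℕ → Bool
  later n = not (jumpAt τ w n) ∧ jumpAt τ u n
  same : halts? (jumpAt τ w) i s ≡ halts? (λ n → halts? f n w) i s
  same = halts-cong i s λ {n} _ → jumpAt-applyUpTo f u n w≤u
  not-true : ∀ {b} → not b ≡ true → b ≡ false
  not-true {false} _ = refl
  stable : not (halts? (jumpAt τ w) i s) ≡ true → halts? (λ n → halts? f n w) i s ≡ false
  stable eq = trans (sym same) (not-true eq)
  changed : anyB s later ≡ true → ∃[ n ] (n < s × halts? f n w ≡ false × halts? f n u ≡ true)
  changed eq = let n , n<s , e = anyB-elim s later eq
                   e₁ , e₂ = ∧-true {not (jumpAt τ w n)} e
               in n , n<s , trans (sym (jumpAt-applyUpTo f u n w≤u)) (not-true e₁) ,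
                   trans (sym (jumpAt-applyUpTo f u n ≤-refl)) e₂

converges-by-elim : ∀ i y t → converges-by i y t ≡ true →
    ∃[ v ] (v ≤ t × run (applyUpTo no-oracle t) t (decode i) y ≡ just v)
converges-by-elim i y t eq with run (applyUpTo no-oracle t) t (decode i) y
... | just v = v , does⇒ (v ≤? t) eq , refl

converges-by-intro : ∀ {i y t v} → v ≤ t → run (applyUpTo no-oracle t) t (decode i) y ≡ just v →
    converges-by i y t ≡ true
converges-by-intro {t = t} {v} v≤t eq rewrite eq = dec-true (v ≤? t) v≤t

R-total : ∀ i y f u → R ⟨ 0 , i ⟩ y (applyUpTo f u) ≡ converges-by i y u
R-total i y f u rewrite unpair-⟨⟩ 0 i = cong (converges-by i y) (length-applyUpTo f u)

R-diverges : ∀ i y τ → R ⟨ 1 , i ⟩ y τ ≡ diverges-by i y τ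
R-diverges i y τ rewrite unpair-⟨⟩ 1 i = refl

-- Evidence is positive information: a convergence, the failure of a computation from the
-- approximation at `w`, which is fixed by the first `w` bits, or a change from divergence to
-- convergence, which longer strings keep.
R-mono : ∀ n y {f g : ℕ → Bool} {u v} → u ≤ v → (∀ {x} → x < u → f x ≡ g x) →
         R n y (applyUpTo f u) ≡ true → R n y (applyUpTo g v) ≡ true
R-mono n y {f} {g} {u} {v} u≤v agree eq with does (proj₁ (unpair n) ≟ 0)
... | true rewrite length-applyUpTo f u | length-applyUpTo g v =
  let k , k≤u , r = converges-by-elim (proj₂ (unpair n)) y u eq
  in converges-by-intro {proj₂ (unpair n)} {y} (≤-trans k≤u u≤v)
      (run-extend no-oracle u≤v (decode (proj₂ (unpair n))) y r)
... | false = from (diverges-by⇔Diverges g i y v) (grow (to (diverges-by⇔Diverges f i y u) eq))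
  where
  i s w : ℕ
  i = proj₂ (unpair n)
  s = proj₁ (unpair y)
  w = proj₂ (unpair y)
  grow : Diverges f i s w u → Diverges g i s w v
  grow (w≤u , alt) = ≤-trans w≤u u≤v , [ inj₁ ∘ trans (halts-cong i s λ {n} _ → sym (early n)) ,
      (λ (n , n<s , e , e′) → inj₂ (n , n<s , trans (sym (early n)) e ,
        halts-mono {g} {n} u≤v (trans (halts-cong n u λ x<u → sym (agree x<u)) e′))) ]′ alt
    where
    early : ∀ n → halts? f n w ≡ halts? g n w
    early n = halts-cong n w λ x<w → agree (<-≤-trans x<w w≤u)

total⇒evidence : ∀ {i y v} {f : ℕ → Bool} → Converges no-oracle (decode i) y v →
    ∃[ u ] (R ⟨ 0 , i ⟩ y (applyUpTo f u) ≡ true)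
total⇒evidence {i} {y} {v} {f} (s , r) = s ⊔ v , trans (R-total i y f (s ⊔ v))
  (converges-by-intro {i} {y} (m≤n⊔m s v) (run-extend no-oracle (m≤m⊔n s v) (decode i) y r))

-- The clause `v ≤ t` of `converges-by` is there for this: evidence of totality at `y` needs a
-- string at least as long as the value at `y`, so holding a ball until the evidence comes imposes a
-- delay by that value.
evidence⇒value : ∀ {i y v t} {f : ℕ → Bool} → Converges no-oracle (decode i) y v →
    R ⟨ 0 , i ⟩ y (applyUpTo f t) ≡ true → v ≤ t
evidence⇒value {i} {y} {v} {t} {f} c eq =
  let k , k≤t , r = converges-by-elim i y t (trans (sym (R-total i y f t)) eq)
  in subst (_≤ t) (Converges-det (t , r) c) k≤t

module _ (em : ExcludedMiddle 0ℓ) where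

  open Classical em

  char-decides : ∀ (B : Subset) → char B decides B
  char-decides B n = proof (em {B n})

  -- If a computation of length `s` puts `i` into the double jump, there is no evidence at
  -- `⟨ s , w ⟩` once the approximations to the jump are right below `s` from `w` on. If `i` is
  -- outside, any apparent computation relies on the absence of a number that enters the
  -- approximation later.
  double-jump : ∀ (A : Subset) i →
    (∀ y → ∃[ u ] (R ⟨ 1 , i ⟩ y (applyUpTo (char A) u) ≡ true)) ⇔ (¬ (i ∈ (A ′) ′))
  double-jump A i = mk⇔ divergent evident
    where
    χ χ′ : ℕ → Bool
    χ  = char A
    χ′ = char (A ′)
    double⇔ : i ∈ (A ′) ′ ⇔ (∃[ s ] (halts? χ′ i s ≡ true))
    double⇔ = jump⇔halts (char-decides (A ′)) i
    single : ∀ n s → halts? χ n s ≡ true → χ′ n ≡ true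
    single n s h = to (Reflects-true (char-decides (A ′) n)) (from (jump⇔halts (char-decides A) n) (s , h))
    settles : ∀ n → Eventually (λ w → halts? χ n w ≡ χ′ n)
    settles n with χ′ n in eq
    ... | false = 0 , λ {w} _ → ≢true λ h → case trans (sym eq) (single n w h) of λ ()
    ... | true  = let s , h = to (jump⇔halts (char-decides A) n) (from (Reflects-true (char-decides (A ′) n)) eq)
                  in s , λ s≤w → halts-mono {χ} {n} s≤w h
    divergent : (∀ y → ∃[ u ] (R ⟨ 1 , i ⟩ y (applyUpTo χ u) ≡ true)) → ¬ (i ∈ (A ′) ′)
    divergent ev i∈ with to double⇔ i∈
    ... | s , h with Eventually-∀< settles s
    ...   | w , settled with ev ⟨ s , w ⟩
    ...     | u , r with subst (λ p → Diverges χ i (proj₁ p) (proj₂ p) u) (unpair-⟨⟩ s w)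
                           (to (diverges-by⇔Diverges χ i ⟨ s , w ⟩ u) (trans (sym (R-diverges i ⟨ s , w ⟩ _)) r))
    ...       | _ , inj₁ e = case trans (sym e) (trans (halts-cong i s (settled ≤-refl)) h) of λ ()
    ...       | _ , inj₂ (n , n<s , e , e′) = case trans (sym e) (trans (settled ≤-refl n<s) (single n u e′)) of λ ()
    evident : ¬ (i ∈ (A ′) ′) → ∀ y → ∃[ u ] (R ⟨ 1 , i ⟩ y (applyUpTo χ u) ≡ true)
    evident i∉ y = let u , d = witness in u , trans (R-diverges i y _) (from (diverges-by⇔Diverges χ i y u) d)
      where
      s w : ℕ
      s = proj₁ (unpair y)
      w = proj₂ (unpair y)
      witness : ∃[ u ] Diverges χ i s w u
      witness with halts? (λ n → halts? χ n w) i s in eq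
      ... | false = w , ≤-refl , inj₁ refl
      ... | true with em {∃[ n ] (n < s × halts? χ n w ≡ false × χ′ n ≡ true)}
      ...   | yes (n , n<s , e , e′) = let k , settled = settles n in
              w ⊔ k , m≤m⊔n w k , inj₂ (n , n<s , e , trans (settled (m≤n⊔m w k)) e′)
      ...   | no ¬e = contradiction (from double⇔ (s , trans (halts-cong i s same) eq)) i∉
        where
        same : ∀ {n} → n < s → χ′ n ≡ halts? χ n w
        same {n} n<s with halts? χ n w in h
        ... | true  = single n w h
        ... | false = ≢true λ e → ¬e (n , n<s , h , e)

-- Canonical indices of finite sets

binary : List Bool → ℕ
binary = recL 0 (λ b _ r → enc b + (r + r))

binaryC : ∀ {χ} → Comp χ binary
binaryC = recLC (constC 0) (+C (encC vₖ) (+C (sndC vᵣ) (sndC vᵣ))) idC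

digit : ∀ (b : Bool) r → (enc b + (r + r)) % 2 ≡ enc b
digit b r rewrite sym (trans (*-comm r 2) (cong (r +_) (+-identityʳ r))) = trans ([m+kn]%n≡m%n (enc b) r 2) (bit b)
  where
  bit : ∀ (b : Bool) → enc b % 2 ≡ enc b
  bit true  = refl
  bit false = refl

halve : ∀ (b : Bool) r → (enc b + (r + r)) / 2 ≡ r
halve b r rewrite sym (trans (*-comm r 2) (cong (r +_) (+-identityʳ r))) =
  trans (+-distrib-/ (enc b) (r * 2) small) (cong₂ _+_ (bit b) (m*n/n≡m r 2))
  where
  bit : ∀ (b : Bool) → enc b / 2 ≡ 0
  bit true  = refl
  bit false = refl
  small : enc b % 2 + r * 2 % 2 < 2
  small = subst (λ k → enc b % 2 + k < 2) (sym (m*n%n≡0 r 2))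
      (subst (_< 2) (sym (+-identityʳ (enc b % 2))) (m%n<n (enc b) 2))

D-binary : ∀ σ i → i ∈ D (binary σ) ⇔ (head (drop i σ) ≡ just true)
D-binary [] i = mk⇔ (λ d → case trans (sym (cong (_% 2) (0/n≡0 (2 ^ i) ⦃ m^n≢0 2 i ⦄))) d of λ ())
    (λ h → case trans (sym (none i)) h of λ ())
  where
  none : ∀ i → head {A = Bool} (drop i []) ≡ nothing
  none zero    = refl
  none (suc i) = refl
D-binary (b ∷ σ) zero = mk⇔ (λ d → cong just (one b (trans (sym first-digit) d))) (λ { refl → first-digit })
  where
  first-digit : (enc b + (binary σ + binary σ)) / 1 % 2 ≡ enc b
  first-digit = trans (cong (_% 2) (n/1≡n (enc b + (binary σ + binary σ)))) (digit b (binary σ))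
  one : ∀ (b : Bool) → enc b ≡ 1 → b ≡ true
  one true _ = refl
D-binary (b ∷ σ) (suc i) = mk⇔ (λ d → to (D-binary σ i) (trans (sym (cong (_% 2) shift)) d))
                               (λ h → trans (cong (_% 2) shift) (from (D-binary σ i) h))
  where
  instance
    2^i≢0 : NonZero (2 ^ i)
    2^i≢0 = m^n≢0 2 i
    2^1+i≢0 : NonZero (2 ^ suc i)
    2^1+i≢0 = m^n≢0 2 (suc i)
  shift : (enc b + (binary σ + binary σ)) / 2 ^ suc i ≡ binary σ / 2 ^ i
  shift = trans (sym (m/n/o≡m/[n*o] (enc b + (binary σ + binary σ)) 2 (2 ^ i))) (cong (_/ 2 ^ i) (halve b (binary σ)))

-- The theorem

Reflects-not : ∀ {P : Set} {b} → Reflects P b → Reflects (¬ P) (not b)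
Reflects-not (ofʸ p)  = ofⁿ λ ¬p → ¬p p
Reflects-not (ofⁿ ¬p) = ofʸ ¬p

computable-intro : ∀ {f} → Comp no-oracle f → Computable f
computable-intro {f} cf = encode (code cf) , λ x → from (Φ⇔Converges no-oracle-decides)
  (subst (λ c → Converges no-oracle c x (f x)) (sym (decode-encode (code cf))) (computes cf x))

computable-elim : ∀ {f} → Computable f → Comp no-oracle f
computable-elim (e , φ) = decode e computedBy λ x → to (Φ⇔Converges no-oracle-decides) (φ x)

module _ (em : ExcludedMiddle 0ℓ) where

  open Classical em

  -- The jump of `∅` reduces to that of `A`, so `∅ ′` is decided with the oracle `A ′`, and the
  -- argument repeats one level up.
  ∅″≤T : ∀ A → (∅ ′) ′ ≤T (A ′) ′
  ∅″≤T A = ≤T-intro (char-decides em ((A ′) ′)) {f = λ e → char ((A ′) ′) (Reduction.index r₂ e)}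
    (λ e → Reflects-⇔ (double e) (char-decides em ((A ′) ′) (Reduction.index r₂ e)))
    (queryC (Reduction.computable r₂))
    where
    r₁ : Reduction A (λ e → ∃[ s ] (halts? no-oracle e s ≡ true))
    r₁ = jump-reduction (char-decides em A) (haltsC (constC false) v₁ v₂)
    χ : ℕ → Bool
    χ e = char (A ′) (Reduction.index r₁ e)
    χ-decides : χ decides (∅ ′)
    χ-decides e = Reflects-⇔ (mk⇔ (from (jump⇔halts no-oracle-decides e) ∘ to (Reduction.reduces r₁ e))
                                  (from (Reduction.reduces r₁ e) ∘ to (jump⇔halts no-oracle-decides e)))
                             (char-decides em (A ′) (Reduction.index r₁ e))
    r₂ : Reduction (A ′) (λ e → ∃[ s ] (halts? χ e s ≡ true))
    r₂ = jump-reduction (char-decides em (A ′)) (haltsC (queryC (Reduction.computable r₁ ∘C v₂)) v₁ v₂)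
    double : ∀ e → Reduction.index r₂ e ∈ (A ′) ′ ⇔ e ∈ (∅ ′) ′
    double e = mk⇔ (from (jump⇔halts χ-decides e) ∘ to (Reduction.reduces r₂ e))
                   (from (Reduction.reduces r₂ e) ∘ to (jump⇔halts χ-decides e))

  -- The first jump decides the inner existential statement. A failing `u` is then found by a search
  -- computable in `∅ ′`, and whether this search succeeds is a question to the second jump.
  module Π₂-Decision {A : Set} ⦃ _ : Coded A ⦄ {V : (A × ℕ) × ℕ → Bool} (cV : Comp no-oracle V) where

    private
      r₁ : Reduction ∅ (λ a → ∃[ t ] (V (a , t) ≡ true))
      r₁ = jump-reduction no-oracle-decides cV

      some? : A × ℕ → Bool
      some? a = char (∅ ′) (Reduction.index r₁ a)

      some?-reflects : ∀ a → Reflects (∃[ t ] (V (a , t) ≡ true)) (some? a)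
      some?-reflects a = Reflects-⇔ (Reduction.reduces r₁ a) (char-decides em (∅ ′) (Reduction.index r₁ a))

      fails? : A × ℕ → Bool
      fails? a = not (some? a)

      fails?C : Comp (char (∅ ′)) fails?
      fails?C = notC {f = some?} (queryC (Reduction.computable r₁))

      r₂ : Reduction (∅ ′) (λ a → ∃[ u ] (fails? (a , u) ≡ true))
      r₂ = jump-reduction (char-decides em (∅ ′)) fails?C

      refuted? : A → Bool
      refuted? a = char ((∅ ′) ′) (Reduction.index r₂ a)

      no-failure : ∀ {a} → ¬ (∃[ u ] (fails? (a , u) ≡ true)) → ∀ u → ∃[ t ] (V ((a , u) , t) ≡ true)
      no-failure {a} h u = case em {∃[ t ] (V ((a , u) , t) ≡ true)} of λ where
        (yes p) → p
        (no ¬p) → contradiction (u , to (Reflects-true (Reflects-not (some?-reflects (a , u)))) ¬p) h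

      failure : ∀ {a} → (∀ u → ∃[ t ] (V ((a , u) , t) ≡ true)) → ¬ (∃[ u ] (fails? (a , u) ≡ true))
      failure {a} h (u , e) = from (Reflects-true (Reflects-not (some?-reflects (a , u)))) e (h u)

    always? : A → Bool
    always? a = not (refuted? a)

    always?C : Comp (char ((∅ ′) ′)) always?
    always?C = notC {f = refuted?} (queryC (Reduction.computable r₂))

    always?-reflects : ∀ a → Reflects (∀ u → ∃[ t ] (V ((a , u) , t) ≡ true)) (always? a)
    always?-reflects a = Reflects-⇔ (mk⇔ no-failure failure)
      (Reflects-not (Reflects-⇔ (Reduction.reduces r₂ a) (char-decides em ((∅ ′) ′) (Reduction.index r₂ a))))

  -- Simplicity, and an enumeration by canonical indices

  open Verification em W? W-mono R R-mono
  open Dynamics W? R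

  module Computability {χ : ℕ → Bool} = ComputableConstruction {χ} W? R W?C RC
  open Computability

  A-atC : ∀ {χ} → Comp χ {ℕ × ℕ} (λ (s , x) → A[ s ] x)
  A-atC = inAC ∘C (historyC ∘C v₁ ,C v₂)

  launch-bound : ∀ {t g b z} → move t ≡ just (g , b , z) → z < t
  launch-bound {t} m = let (_ , p) , f = trace {t} m in <-≤-trans (Picked.bounded (proj₁ (pick-sound p))) (Flight-≤ f)

  -- Balls are smaller than the stages of their launch, so the first `s` bits of `A[ s ]` describe
  -- all of it and yield its canonical index.
  A-bound : ∀ {s x} → A[ s ] x ≡ true → x < s
  A-bound {s} a = let t , t<s , b , e = A-sound s a in <-trans (launch-bound {t} e) t<s

  simple : Simple A
  simple = (Family.index fam 0 , (λ {x} → from (Family.enumerates fam 0 x)) ,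
      (λ {x} → to (Family.enumerates fam 0 x)))
         , (λ (xs , covers) → co-infinite xs covers)
         , λ e inf → let x , s , a , w = A-meets-W e (unbounded e inf) in x , a , s , from W?⇔W w
    where
    fam : Family (λ w x → ∃[ s ] (A[ s ] x ≡ true))
    fam = ce-family (A-atC ∘C (v₂ ,C sndC v₁))
    unbounded : ∀ e → Infinite (W e) → ∀ m → ∃₂ λ x s → m ≤ x × W? e s x ≡ true
    unbounded e inf m with em {∃₂ λ x s → m ≤ x × W? e s x ≡ true}
    ... | yes p = p
    ... | no ¬p = contradiction (upTo m , λ {x} (s , x∈) → ∈-upTo⁺ (≰⇒> λ m≤x → ¬p (x , s , m≤x , to W?⇔W x∈))) inf

  stage⇔A : ∀ s x → x ∈ D (binary (applyUpTo A[ s ] s)) ⇔ (A[ s ] x ≡ true)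
  stage⇔A s x = mk⇔
    (λ d → sym (proj₂ (head-drop-bound A[ s ] s x (to (D-binary (applyUpTo A[ s ] s) x) d))))
    (λ a → from (D-binary (applyUpTo A[ s ] s) x) (trans (head-drop-applyUpTo A[ s ] (A-bound a)) (cong just a)))

  enumeration : ComputableEnumeration A
  enumeration = record
    { index      = λ s → binary (applyUpTo A[ s ] s)
    ; computable = computable-intro (binaryC ∘C applyUpToC A-atC idC)
    ; increasing = λ s {x} d → from (stage⇔A (suc s) x) (A-mono (n≤1+n s) (to (stage⇔A s x) d))
    ; union      = λ x → mk⇔ (λ (s , a) → s , from (stage⇔A s x) a) (λ (s , d) → s , to (stage⇔A s x) d)
    }

  -- Tardiness

  announces? : ℕ → ℕ → Maybe Move → Bool
  announces? c x = caseM false (λ (g , _ , z) → caseM false (λ γ → does (enc γ ≟ c) ∧ does (z ≟ x)) g)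

  announces?-sound : ∀ γ x m → announces? (enc γ) x m ≡ true → ∃[ b ] (m ≡ just (just γ , b , x))
  announces?-sound γ x (just (just β , b , z)) eq with ∧-true {does (enc β ≟ enc γ)} eq
  ... | e , e′ rewrite encPath-injective β γ (does⇒ (enc β ≟ enc γ) e) | does⇒ (z ≟ x) e′ = b , refl

  announces?-complete : ∀ γ x b → announces? (enc γ) x (just (just γ , b , x)) ≡ true
  announces?-complete γ x b = cong₂ _∧_ (dec-true (enc γ ≟ enc γ) refl) (dec-true (x ≟ x) refl)

  -- The parameter w = ⟨ n , enc γ ⟩ serves at the same time as a bound on the stages considered.
  announced? : (ℕ × ℕ) × ℕ → Bool
  announced? ((w , x) , t) = does (w ≤? t) ∧ announces? (proj₂ (unpair w)) x (move t)

  announced?C : ∀ {χ} → Comp χ announced?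
  announced?C {χ} = ≤?C (fstC v₁) v₂ ∧C announces?C ∘C (sndC (unpairC (fstC v₁)) ,C sndC v₁ ,C moveC ∘C v₂)
    where
    announces?C : Comp χ {ℕ × ℕ × Maybe Move} (λ (c , x , m) → announces? c x m)
    announces?C = caseMC (constC false)
      (caseMC (constC false) (≟C (encC v₂) (fstC (fstC v₁)) ∧C ≟C (sndC (sndC (sndC v₁)))
          (fstC (sndC (fstC v₁)))) (fstC v₂)) vᵣ

  abstract
    -- One family serves all `w`, before any `p` is given: the node to be used depends on
    -- `p ∘ delay`, so `delay` must not depend on the node. Since `w` and `x` need only be
    -- considered up to `t`, a single computable `delay` covers all members of the family.
    announced : Family (λ w x → ∃[ t ] (announced? ((w , x) , t) ≡ true))
    announced = ce-family announced?C

  module Announced = Family announced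

  listed? : ℕ → ℕ → ℕ → ℕ → Bool
  listed? t s w x = not (announced? ((w , x) , t)) ∨ W? (Announced.index w) s x

  all-listed? : ℕ × ℕ → Bool
  all-listed? (t , s) = allB (suc t) (λ w → allB (suc t) (listed? t s w))

  all-listed?C : ∀ {χ} → Comp χ all-listed?
  all-listed?C = allC (sucC v₁) (allC (sucC (fstC v₁))
    (notC (announced?C ∘C ((sndC v₁ ,C v₂) ,C fstC (fstC v₁))) ∨C
     W?C ∘C (Announced.computable ∘C sndC v₁ ,C sndC (fstC v₁) ,C v₂)))

  listed-eventually : ∀ t w x → Eventually (λ s → listed? t s w x ≡ true)
  listed-eventually t w x with announced? ((w , x) , t) in eq
  ... | false = 0 , λ _ → refl
  ... | true  = let s , x∈ = from (Announced.enumerates w x) (t , eq)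
                in s , λ s≤s′ → W-mono (Announced.index w) x s≤s′ (to W?⇔W x∈)

  all-listed-eventually : ∀ t → ∃[ s ] (all-listed? (t , s) ≡ true)
  all-listed-eventually t = let s , h = Eventually-∀< (λ w → Eventually-∀< (listed-eventually t w) (suc t)) (suc t)
    in s , allB-intro (suc t) (λ w → allB (suc t) (listed? t s w))
        (λ w< → allB-intro (suc t) (listed? t s _) (λ x< → h ≤-refl w< x<))

  -- By the stage delay t, every announcement of stage t has been enumerated.
  delay : ℕ → ℕ
  delay t = μ (λ s → all-listed? (t , s)) (all-listed-eventually t)

  delayC : Comp no-oracle delay
  delayC = μC all-listed?C all-listed-eventually

  delay-spec : ∀ {t w x} → w ≤ t → x ≤ t → announced? ((w , x) , t) ≡ true → W? (Announced.index w) (delay t) x ≡ true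
  delay-spec {t} {w} {x} w≤t x≤t a = subst (λ b → not b ∨ W? (Announced.index w) (delay t) x ≡ true) a
    (allB-elim (suc t) (listed? t (delay t) w)
      (allB-elim (suc t) (λ w → allB (suc t) (listed? t (delay t) w))
        (proj₁ (proj₂ (least (λ s → all-listed? (t , s)) (all-listed-eventually t)))) (s≤s w≤t)) (s≤s x≤t))

  totality-node : ∀ {c} {p : ℕ → ℕ} → (∀ x → Converges no-oracle c x (p x)) →
      ∃[ γ ] (length γ ≡ ⟨ 0 , encode c ⟩ × TruePath (true ∷ γ))
  totality-node {c} {p} conv with spine ⟨ 0 , encode c ⟩
  ... | γ , l , tp = γ , l , holds⇒true tp (subst Holds (sym l) λ y →
    total⇒evidence (subst (λ d → Converges no-oracle d y (p y)) (sym (decode-encode c)) (conv y)))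

  module Tardy (p : ℕ → ℕ) (p-mono : Monotonic₁ _≤_ _≤_ p) (c : Code)
    (computes-p : ∀ t → Converges no-oracle c t (p (delay t))) where

    abstract
      node : ∃[ γ ] (length γ ≡ ⟨ 0 , encode c ⟩ × TruePath (true ∷ γ))
      node = totality-node {c} {λ t → p (delay t)} computes-p

    γ : Path
    γ = proj₁ node

    open Announcement (proj₂ (proj₂ node))

    w : ℕ
    w = ⟨ threshold , enc γ ⟩

    threshold≤w : threshold ≤ w
    threshold≤w = ≤-trans (m≤m+n threshold (enc γ)) (+≤⟨⟩ threshold (enc γ))

    -- The node and the threshold are found non-effectively, but they are finite data and enter the
    -- program as constants.
    admits? : (ℕ × ℕ) × ℕ → Bool
    admits? ((_ , x) , t) = does (w ≤? t) ∧ does (true ∷ γ ⊑? δ t) ∧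
      does (suc (length γ) <? length (δ t)) ∧ does (x <? t) ∧ not (A[ suc t ] x)

    admits?C : Comp no-oracle admits?
    admits?C = ≤?C (constC w) v₂ ∧C ⊑?C ∘C (constC (true ∷ γ) ,C δC ∘C v₂) ∧C
      <?C (constC (suc (length γ))) (lengthC (δC ∘C v₂)) ∧C <?C (sndC v₁) v₂ ∧C notC (A-atC ∘C (sucC v₂ ,C sndC v₁))

    abstract
      admitted? : Family (λ v x → ∃[ t ] (admits? ((v , x) , t) ≡ true))
      admitted? = ce-family admits?C

    module Admitted = Family admitted?

    e : ℕ
    e = ⟨ Admitted.index 0 , Announced.index w ⟩

    W₁ W₂ : ℕ
    W₁ = proj₁ (unpair e)
    W₂ = proj₂ (unpair e)

    W₁≡ : W₁ ≡ Admitted.index 0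
    W₁≡ = cong proj₁ (unpair-⟨⟩ (Admitted.index 0) (Announced.index w))

    W₂≡ : W₂ ≡ Announced.index w
    W₂≡ = cong proj₂ (unpair-⟨⟩ (Admitted.index 0) (Announced.index w))

    admits?⇔ : ∀ x t → admits? ((0 , x) , t) ≡ true ⇔ (w ≤ t × Admits t x)
    admits?⇔ x t = mk⇔
      (λ a → let a₁ , r₁ = ∧-true {does (w ≤? t)} a
                 a₂ , r₂ = ∧-true {does (true ∷ γ ⊑? δ t)} r₁
                 a₃ , r₃ = ∧-true {does (suc (length γ) <? length (δ t))} r₂
                 a₄ , a₅ = ∧-true {does (x <? t)} r₃
             in does⇒ (w ≤? t) a₁ , does⇒ (true ∷ γ ⊑? δ t) a₂ , does⇒ (suc (length γ) <? length (δ t)) a₃ ,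
                 does⇒ (x <? t) a₄ , not-true a₅)
      (λ (w≤t , v , l , x<t , out) →
        cong₂ _∧_ (dec-true (w ≤? t) w≤t) (cong₂ _∧_ (dec-true (true ∷ γ ⊑? δ t) v)
          (cong₂ _∧_ (dec-true (suc (length γ) <? length (δ t)) l)
              (cong₂ _∧_ (dec-true (x <? t) x<t) (cong not out)))))
      where
      not-true : ∀ {b} → not b ≡ true → b ≡ false
      not-true {false} _ = refl

    W₁⇔ : ∀ x → x ∈ W W₁ ⇔ (∃[ t ] (w ≤ t × Admits t x))
    W₁⇔ x = mk⇔
      (λ x∈ → let t , a = to (Admitted.enumerates 0 x) (subst (λ e → x ∈ W e) W₁≡ x∈) in t , to (admits?⇔ x t) a)
      (λ (t , a) → subst (λ e → x ∈ W e) (sym W₁≡) (from (Admitted.enumerates 0 x) (t , from (admits?⇔ x t) a)))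

    announced?⇔ : ∀ x t → announced? ((w , x) , t) ≡ true ⇔ (w ≤ t × Announces t x)
    announced?⇔ x t = mk⇔
      (λ a → let a₁ , a₂ = ∧-true {does (w ≤? t)} a
             in does⇒ (w ≤? t) a₁ , announces?-sound γ x (move t)
                  (subst (λ q → announces? (proj₂ q) x (move t) ≡ true) (unpair-⟨⟩ threshold (enc γ)) a₂))
      (λ (w≤t , b , m) → cong₂ _∧_ (dec-true (w ≤? t) w≤t)
        (subst₂ (λ q m → announces? (proj₂ q) x m ≡ true) (sym (unpair-⟨⟩ threshold (enc γ))) (sym m)
            (announces?-complete γ x b)))

    W₂⇔ : ∀ x → x ∈ W W₂ ⇔ (∃[ t ] (w ≤ t × Announces t x))
    W₂⇔ x = mk⇔
      (λ x∈ → let t , a = to (Announced.enumerates w x) (subst (λ e → x ∈ W e) W₂≡ x∈) in t , to (announced?⇔ x t) a)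
      (λ (t , a) → subst (λ e → x ∈ W e) (sym W₂≡) (from (Announced.enumerates w x) (t , from (announced?⇔ x t) a)))

    complement : X² e ≐ ∁ A
    complement = (λ {x} (x∈₁ , x∉₂) (s , a) → let t , w≤t , ad = to (W₁⇔ x) x∈₁
                                                  v , _ , w≤v , an , _ = announced-first threshold≤w w≤t ad a
                                              in x∉₂ (from (W₂⇔ x) (v , w≤v , an)))
               , (λ {x} x∉ → from (W₁⇔ x) (admitted w x∉) ,
                    λ x∈₂ → let t , w≤t , an = to (W₂⇔ x) x∈₂ in x∉ (announced⇒A (≤-trans threshold≤w w≤t) an))

    enumerated : ∀ {x v} → w ≤ v → Announces v x → x ∈ W[ W₂ , delay v ]
    enumerated {x} {v} w≤v an = from W?⇔W (subst (λ e → W? e (delay v) x ≡ true) (sym W₂≡)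
      (delay-spec w≤v (<⇒≤ (launch-bound {v} (proj₂ an))) (from (announced?⇔ x v) (w≤v , an))))

    announced-late : ∀ {x v s} → w ≤ v → Announces v x → x ∉ W[ W₂ , s ] → s ≤ delay v
    announced-late {x} w≤v an x∉₂ = ≮⇒≥ λ d<s → x∉₂ (from W?⇔W (W-mono W₂ x (<⇒≤ d<s) (to W?⇔W (enumerated w≤v an))))

    waits : ∀ {v u} → R (length γ) v (applyUpTo A[ u ] u) ≡ true → p (delay v) ≤ u
    waits {v} {u} ev = evidence⇒value {encode c} {v} {p (delay v)} {u} {A[ u ]}
      (subst (λ d → Converges no-oracle d v (p (delay v))) (sym (decode-encode c)) (computes-p v))
      (subst (λ n → R n v (applyUpTo A[ u ] u) ≡ true) (proj₁ (proj₂ node)) ev)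

    -- Let `x` arrive at `γ` at stage `v` and leave it at stage `u`. Its announcement is not yet
    -- enumerated at `s`, so `s ≤ delay v`; the gate opens only with evidence at `v`, so
    -- `p (delay v) ≤ u`. Hence `p s ≤ u`, too early for `x` to be in `A`.
    tardy : ∀ x s → x ∈ X²[ e , s ] → ¬ (A[ p s ] x ≡ true)
    tardy x s (x∈₁ , x∉₂) a = late (to (W₁⇔ x) (s , x∈₁))
      where
      too-late : ∃₂ (λ v u → w ≤ v × Announces v x × u < p s × R (length γ) v (applyUpTo A[ u ] u) ≡ true) → ⊥
      too-late (v , u , w≤v , an , u<ps , ev) =
          <⇒≱ u<ps (≤-trans (p-mono (announced-late w≤v an x∉₂)) (waits {v} {u} ev))
      late : ∃[ t ] (w ≤ t × Admits t x) → ⊥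
      late (t , w≤t , ad) = too-late (announced-first {w} {t} {p s} {x} threshold≤w w≤t ad a)

  twoTardy : TwoTardy A
  twoTardy = enumeration , λ p cp mono →
    let c = computable-elim cp ∘C delayC
        open Tardy p mono (code c) (computes c)
    in e , complement , λ x s x∈ d → tardy x s x∈ (to (stage⇔A (p s) x) d)

  -- The node of length n above δ t: paths are listed from the leaf.
  ancestor : ℕ → ℕ → Path
  ancestor n t = drop (length (δ t) ∸ n) (δ t)

  ancestorC : ∀ {χ} → Comp χ {ℕ × ℕ} (λ (n , t) → ancestor n t)
  ancestorC = dropC (∸C (lengthC (δC ∘C v₂)) v₁) (δC ∘C v₂)

  drop-⊑ : ∀ {γ β} → γ ⊑ β → drop (length β ∸ length γ) β ≡ γ
  drop-⊑ {γ} ⊑-refl rewrite n∸n≡0 (length γ) = refl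
  drop-⊑ {γ} (⊑-step {b} {β} p) rewrite +-∸-assoc 1 (⊑-length p) = drop-⊑ p

  -- One more than the length of the node that asks about `i`, so that the last edge is the answer.
  depth : ℕ → ℕ
  depth i = suc ⟨ 1 , i ⟩

  -- For the node σ of length depth i above δ t₁: σ is visited after stage u, and nothing left of it at stage u ≥ t₁.
  on-path? : ((ℕ × ℕ) × ℕ) × ℕ → Bool
  on-path? (((i , t₁) , u) , t) = does (length (ancestor (depth i) t₁) ≟ depth i) ∧ does (u ≤? t) ∧
    does (ancestor (depth i) t₁ ⊑? δ t) ∧ (if does (t₁ ≤? u) then not (does (δ u ◁? ancestor (depth i) t₁)) else true)

  on-path?C : ∀ {χ} → Comp χ on-path?
  on-path?C {χ} = ≟C (lengthC σC) depthC ∧C ≤?C (sndC v₁) v₂ ∧C ⊑?C ∘C (σC ,C δC ∘C v₂) ∧C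
    ifC (≤?C (sndC (fstC v₁)) (sndC v₁)) (notC (◁?C ∘C (δC ∘C sndC v₁ ,C σC))) (constC true)
    where
    depthC : Comp χ {((ℕ × ℕ) × ℕ) × ℕ} (λ (((i , t₁) , u) , t) → depth i)
    depthC = sucC (⟨⟩C (constC 1) (fstC (fstC v₁)))
    σC : Comp χ {((ℕ × ℕ) × ℕ) × ℕ} (λ (((i , t₁) , u) , t) → ancestor (depth i) t₁)
    σC = ancestorC ∘C (depthC ,C sndC (fstC v₁))

  On-path : ℕ → ℕ → Set
  On-path i t₁ = ∀ u → ∃[ t ] (on-path? (((i , t₁) , u) , t) ≡ true)

  on-path-sound : ∀ i t₁ → On-path i t₁ → length (ancestor (depth i) t₁) ≡ depth i × TruePath (ancestor (depth i) t₁)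
  on-path-sound i t₁ h = does⇒ (length σ ≟ depth i) (proj₁ (parts 0)) , record
    { recurs   = λ u → let _ , t , r , v , _ = parts u in t , does⇒ (u ≤? t) r , does⇒ (σ ⊑? δ t) v
    ; leftmost = t₁ , λ {u} t₁≤u l → clear {u} t₁≤u l (proj₂ (proj₂ (proj₂ (proj₂ (parts u)))))
    }
    where
    σ : Path
    σ = ancestor (depth i) t₁
    parts : ∀ u → does (length σ ≟ depth i) ≡ true × ∃[ t ] (does (u ≤? t) ≡ true × does (σ ⊑? δ t) ≡ true ×
            (if does (t₁ ≤? u) then not (does (δ u ◁? σ)) else true) ≡ true)
    parts u = let t , e = h u
                  a , r₁ = ∧-true {does (length σ ≟ depth i)} e
                  b , r₂ = ∧-true {does (u ≤? t)} r₁
                  c , d  = ∧-true {does (σ ⊑? δ t)} r₂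
              in a , t , b , c , d
    clear : ∀ {u} → t₁ ≤ u → δ u ◁ σ → ¬ ((if does (t₁ ≤? u) then not (does (δ u ◁? σ)) else true) ≡ true)
    clear {u} t₁≤u l e = case trans (sym (cong not (dec-true (δ u ◁? σ) l)))
      (trans (cong (λ b → if b then not (does (δ u ◁? σ)) else true) (sym (dec-true (t₁ ≤? u) t₁≤u))) e) of λ ()

  on-path-exists : ∀ i → ∃[ t₁ ] On-path i t₁
  on-path-exists i = witness (spine (depth i))
    where
    witness : ∃[ γ ] (length γ ≡ depth i × TruePath γ) → ∃[ t₁ ] On-path i t₁
    witness (γ , l , tp) = t₁ , λ u → let t , u≤t , v = TruePath.recurs tp u in t ,
        cong₂ _∧_ (dec-true (length σ ≟ depth i) (trans (cong length σ≡γ) l)) (cong₂ _∧_ (dec-true (u ≤? t) u≤t)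
          (cong₂ _∧_ (dec-true (σ ⊑? δ t) (subst (_⊑ δ t) (sym σ≡γ) v)) (quiet u (t₁ ≤? u))))
      where
      n t₁ : ℕ
      n = proj₁ (TruePath.leftmost tp)
      -- The number `t₁` has two tasks: it names the node, as an ancestor of `δ t₁`, and it bounds
      -- the visits to the left. Hence a visit is chosen after the latter have ceased.
      t₁ = proj₁ (TruePath.recurs tp n)
      σ : Path
      σ = ancestor (depth i) t₁
      σ≡γ : σ ≡ γ
      σ≡γ = trans (cong (λ k → drop (length (δ t₁) ∸ k) (δ t₁)) (sym l))
          (drop-⊑ (proj₂ (proj₂ (TruePath.recurs tp n))))
      quiet : ∀ u (d : Dec (t₁ ≤ u)) → (if does d then not (does (δ u ◁? σ)) else true) ≡ true
      quiet u (no _)     = refl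
      quiet u (yes t₁≤u) = cong not (dec-false (δ u ◁? σ) λ l →
        proj₂ (TruePath.leftmost tp) (≤-trans (proj₁ (proj₂ (TruePath.recurs tp n))) t₁≤u) (subst (δ u ◁_) σ≡γ l))

  low₂ : (A ′) ′ ≤T (∅ ′) ′
  low₂ = ≤T-intro (char-decides em ((∅ ′) ′)) {f = answer}
      (λ i → decide i (ancestor (depth i) (stage i)) (proj₁ (on-path i)) (proj₂ (on-path i))) answerC
    where
    open Π₂-Decision on-path?C

    found : ∀ i → ∃[ t ] (always? (i , t) ≡ true)
    found i = let t , h = on-path-exists i in t , to (Reflects-true (always?-reflects (i , t))) h

    stage : ℕ → ℕ
    stage i = μ (λ t → always? (i , t)) (found i)

    -- A leftmost node ending in true means that i is not in the double jump.
    answer : ℕ → Bool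
    answer i = caseM false not (head (ancestor (depth i) (stage i)))

    answerC : Comp (char ((∅ ′) ′)) answer
    answerC = caseMC (constC false) (notC v₂)
      (headC (ancestorC ∘C (sucC (⟨⟩C (constC 1) idC) ,C μC always?C found)))

    on-path : ∀ i → length (ancestor (depth i) (stage i)) ≡ depth i × TruePath (ancestor (depth i) (stage i))
    on-path i = on-path-sound i (stage i) (from (Reflects-true (always?-reflects (i , stage i)))
                  (proj₁ (proj₂ (least (λ t → always? (i , t)) (found i)))))

    decide : ∀ i σ → length σ ≡ depth i → TruePath σ → Reflects (i ∈ (A ′) ′) (caseM false not (head σ))
    decide i (true ∷ γ)  l tp = ofⁿ (to (double-jump em A i) (subst Holds (suc-injective l) (true⇒holds tp)))
    decide i (false ∷ γ) l tp with em {i ∈ (A ′) ′}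
    ... | yes i∈ = ofʸ i∈
    ... | no i∉  = contradiction (subst Holds (sym (suc-injective l)) (from (double-jump em A i) i∉)) (false⇒fails tp)

theorem5p2 : ExcludedMiddle 0ℓ →
    ∃[ A ] (Simple A × TwoTardy A × (A ′) ′ ≡T (∅ ′) ′)
theorem5p2 em = _ , simple em , twoTardy em , low₂ em , ∅″≤T em _
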